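{- Let $W$ be a Coxeter group, and let $c$ be a Coxeter element of $W$. The following are equivalent. (i) Every nonempty convex set $\mathscr L\subseteq W$ is heavy with respect to $c$. (ii) Every nonempty finite convex set $\mathscr L\subseteq W$ is heavy with respect to $c$. (iii) Every nonempty finite convex set $\mathscr L\subseteq W$ is superheavy with respect to $c$.
   Context: Let $(W,S)$ be a Coxeter system with $S=\{s_i:i\in I\}$, $I$ a finite index set; $m(i,i')$ is the order of $s_is_{i'}$. The root space is $V=\mathbb R^I$ with standard basis the simple roots $\{\alpha_i:i\in I\}$ and symmetric bilinear form $B(\alpha_i,\alpha_{i'})=-\cos(\pi/m(i,i'))$ (and $-1$ if $m(i,i')=\infty$). $W$ acts on $V$ by $s_i\beta=\beta-2B(\beta,\alpha_i)\alpha_i$. The root system is $\Phi=\{w\alpha_i:w\in W,i\in I\}=\Phi^+\sqcup\Phi^-$, where $\Phi^+$ are the roots that are nonnegative combinations of simple roots and $\Phi^-=-\Phi^+$. For $\beta\in\Phi$ the half-space $H_\beta^+$ is $\{w\in W:w\beta\in\Phi^+\}$. A subset of $W$ is convex if it is an intersection of half-spaces (the empty intersection being $W$). For a nonempty convex set $\mathscr L\subseteq W$ let $\mathrm R(\mathscr L)=\{\beta\in\Phi:\mathscr L\subseteq H_\beta^+\}$. For $i\in I$, the toggle $\tau_i\colon W\to W$ is defined by $\tau_i(u)=u$ if $u^{ -1}\alpha_i\in\mathrm R(\mathscr L)$ and $\tau_i(u)=s_iu$ otherwise. A Coxeter element is a product $c=s_{i_n}\cdots s_{i_1}$ where $i_1,\ldots,i_n$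 is an ordering of $I$ (each element once); $\mathrm{Pro}_c=\tau_{i_n}\cdots\tau_{i_1}$ (composition), which depends only on $c$ and $\mathscr L$. With $\mathrm{Pro}_c$ defined with respect to $\mathscr L$: the set $\mathscr L$ is heavy with respect to $c$ if every periodic point of $\mathrm{Pro}_c$ (i.e. every $u\in W$ with $\mathrm{Pro}_c^K(u)=u$ for some $K\ge 1$) lies in $\mathscr L$; it is superheavy with respect to $c$ if for every $u\in W$ there is an integer $K\ge 0$ with $\mathrm{Pro}_c^K(u)\in\mathscr L$. -}

module Defs where

open import Level using (0ℓ)
open import Algebra.Bundles using (Group; CommutativeRing)
open import Axiom.ExcludedMiddle using (ExcludedMiddle)
open import Data.Nat.Base as ℕ using (ℕ; zero; suc)
open import Data.Nat.GeneralisedArithmetic using (fold)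
open import Data.Fin.Base using (Fin)
open import Data.Fin.Permutation using (Permutation′; _⟨$⟩ʳ_)
open import Data.Fin.Properties using (_≟_)
open import Data.List.Base as List using (List; []; _∷_; _++_; foldl; foldr)
open import Data.Product.Base using (∃; ∃-syntax; Σ-syntax; _×_)
open import Data.Vec.Functional using (Vector)
open import Function.Base using (_∘_)
open import Function.Bundles using (_⇔_)
open import Function.Definitions using (Injective)
open import Relation.Binary.Core using (Rel)
open import Relation.Binary.PropositionalEquality.Core using (_≡_)
open import Relation.Binary.Structures using (IsTotalOrder)
open import Relation.Nullary using (¬_; yes; no)
open import Relation.Unary using (Pred; Satisfiable; _∈_; _⊆_)
import Algebra.Definitions.RawMonoid as RawMonoidDefinitions
import Algebra.Properties.Semiring.Exp as Exponentiation
import Algebra.Properties.Semiring.Mult as Multiples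
import Algebra.Properties.Semiring.Sum as Sums
import Data.List.Membership.Setoid as SetoidMembership
import Relation.Binary.Construct.NonStrictToStrict as NonStrictToStrict

-- The library has no real numbers.  They are taken to be a
-- (Dedekind-)complete ordered field, which determines them up to unique
-- isomorphism; cosine is the sum of its power series, and π is twice the
-- smallest positive zero of cosine.

record CompleteOrderedField : Set₁ where
  infix  4 _≤_
  infix  8 _⁻¹

  field
    commutativeRing : CommutativeRing 0ℓ 0ℓ

  open CommutativeRing commutativeRing public

  field
    -- 0# ⁻¹ is unspecified.
    _⁻¹          : Carrier → Carrier
    ⁻¹-cong      : ∀ {x y} → x ≈ y → x ⁻¹ ≈ y ⁻¹
    ⁻¹-inverse   : ∀ {x} → x ≉ 0# → x * x ⁻¹ ≈ 1#
    0≉1          : 0# ≉ 1#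
    _≤_          : Rel Carrier 0ℓ
    isTotalOrder : IsTotalOrder _≈_ _≤_
    +-monoˡ-≤    : ∀ z {x y} → x ≤ y → x + z ≤ y + z
    *-nonNeg     : ∀ {x y} → 0# ≤ x → 0# ≤ y → 0# ≤ x * y

  UpperBound : Pred Carrier 0ℓ → Pred Carrier 0ℓ
  UpperBound P b = ∀ {x} → P x → x ≤ b

  field
    supremum : ∀ (P : Pred Carrier 0ℓ) → Satisfiable P → Satisfiable (UpperBound P) →
               ∃[ l ] UpperBound P l × (∀ {b} → UpperBound P b → l ≤ b)

  open NonStrictToStrict _≈_ _≤_ public using (_<_)
  open Exponentiation semiring public using (_^_)
  open Multiples semiring public using () renaming (_×_ to _×ᵣ_)
  open Sums semiring public using (sum)

  fromℕ : ℕ → Carrier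
  fromℕ k = k ×ᵣ 1#

  _ConvergesTo_ : (ℕ → Carrier) → Carrier → Set
  a ConvergesTo l = ∀ {ε} → 0# < ε →
    ∃[ N ] (∀ {k} → N ℕ.≤ k → l - ε ≤ a k × a k ≤ l + ε)

  cosTerm : Carrier → ℕ → Carrier
  cosTerm x k = (- 1#) ^ k * x ^ (2 ℕ.* k) * fromℕ ((2 ℕ.* k) ℕ.!) ⁻¹

  cosPartialSum : Carrier → ℕ → Carrier
  cosPartialSum x zero    = 0#
  cosPartialSum x (suc k) = cosPartialSum x k + cosTerm x k

  IsCosine : (Carrier → Carrier) → Set
  IsCosine cos = ∀ x → cosPartialSum x ConvergesTo cos x

  IsSmallestPositiveZeroOf : (Carrier → Carrier) → Carrier → Set
  IsSmallestPositiveZeroOf f h =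
    0# < h × f h ≈ 0# × (∀ {x} → 0# < x → x < h → f x ≉ 0#)

record Reals : Set₁ where
  field
    completeOrderedField : CompleteOrderedField

  open CompleteOrderedField completeOrderedField public

  field
    cos      : Carrier → Carrier
    isCosine : IsCosine cos
    π        : Carrier
    π/2-zero : IsSmallestPositiveZeroOf cos (π * fromℕ 2 ⁻¹)

data ℕ∞ : Set where
  finite : ℕ → ℕ∞
  ∞      : ℕ∞

module _ (G : Group 0ℓ 0ℓ) where
  open Group G
  open RawMonoidDefinitions rawMonoid using () renaming (_×_ to _times_)

  HasOrder : Carrier → ℕ∞ → Set
  HasOrder g (finite k) =
    0 ℕ.< k × k times g ≈ ε × (∀ {j} → 0 ℕ.< j → j ℕ.< k → ¬ (j times g ≈ ε))
  HasOrder g ∞          = ∀ {j} → 0 ℕ.< j → ¬ (j times g ≈ ε)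

Word : ℕ → Set
Word n = List (Fin n)

infix 4 _⊢_∼_

-- Equality of words in the monoid ⟨ I ∣ (i j)^m(i,j) = 1 whenever m(i,j) < ∞ ⟩.
-- When m(i,i) = 1 for all i every letter squares to 1, so this monoid is the
-- group with the same presentation.
data _⊢_∼_ {n} (m : Fin n → Fin n → ℕ∞) : Word n → Word n → Set where
  relator : ∀ {i j k} → m i j ≡ finite k →
            m ⊢ List.concat (List.replicate k (i ∷ j ∷ [])) ∼ []
  ∼-refl  : ∀ {u} → m ⊢ u ∼ u
  ∼-sym   : ∀ {u v} → m ⊢ u ∼ v → m ⊢ v ∼ u
  ∼-trans : ∀ {u v w} → m ⊢ u ∼ v → m ⊢ v ∼ w → m ⊢ u ∼ w
  ++-cong : ∀ {u u′ v v′} → m ⊢ u ∼ u′ → m ⊢ v ∼ v′ → m ⊢ u ++ v ∼ u′ ++ v′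

-- The index set I is Fin n.
record CoxeterSystem (n : ℕ) : Set₁ where
  field
    group : Group 0ℓ 0ℓ

  open Group group public

  field
    s           : Fin n → Carrier
    s-injective : Injective _≡_ _≈_ s
    s-order     : ∀ i → HasOrder group (s i) (finite 2)
    m           : Fin n → Fin n → ℕ∞
    m-order     : ∀ i j → HasOrder group (s i ∙ s j) (m i j)

  eval : Word n → Carrier
  eval = foldr (λ i w → s i ∙ w) ε

  field
    word         : Carrier → Word n
    eval-word    : ∀ w → eval (word w) ≈ w
    presentation : ∀ {u v} → eval u ≈ eval v → m ⊢ u ∼ v

record CoxeterElement {n} (C : CoxeterSystem n) : Set where
  open CoxeterSystem C
  field
    element  : Carrier
    ordering : Permutation′ n

  -- i₁, …, iₙ
  indices : List (Fin n)
  indices = List.tabulate (ordering ⟨$⟩ʳ_)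

  -- foldl multiplies on the left by sᵢ₁ first: the product is sᵢₙ ⋯ sᵢ₁.
  field
    factorisation : element ≈ foldl (λ w i → s i ∙ w) ε indices

-- Excluded middle is what makes the toggles total functions: membership in
-- R(ℒ) is undecidable in general.
module Billiards (lem : ExcludedMiddle 0ℓ) (ℝ : Reals)
                 {n : ℕ} (C : CoxeterSystem n) where

  open CoxeterSystem C using (_∙_; ε; s; m; word) renaming
    (Carrier to W; _≈_ to _≈ʷ_; _⁻¹ to _⁻¹ʷ; setoid to W-setoid)
  open SetoidMembership W-setoid using () renaming (_∈_ to _∈ˡ_)
  module R = Reals ℝ
  open R using (_≈_; _+_; _*_; -_; _-_; 0#; 1#; _⁻¹; _≤_; fromℕ; sum; cos; π)

  V : Set
  V = Vector R.Carrier n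

  infix 4 _≈ᵛ_
  _≈ᵛ_ : Rel V 0ℓ
  β ≈ᵛ γ = ∀ i → β i ≈ γ i

  α : Fin n → V
  α i j with i ≟ j
  ... | yes _ = 1#
  ... | no  _ = 0#

  gram : ℕ∞ → R.Carrier
  gram (finite k) = - cos (π * fromℕ k ⁻¹)
  gram ∞          = - 1#

  B : V → V → R.Carrier
  B β γ = sum (λ i → sum (λ j → β i * γ j * gram (m i j)))

  reflect : Fin n → V → V
  reflect i β j = β j - fromℕ 2 * B β (α i) * α i j

  -- W acts through a word spelling w; since the simple reflections satisfy
  -- the defining relations of W, any other spelling gives the same result.
  infixr 8 _·_
  _·_ : W → V → V
  w · β = foldr reflect β (word w)

  Φ : Pred V 0ℓ
  Φ β = ∃[ w ] ∃[ i ] β ≈ᵛ w · α i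

  Φ⁺ : Pred V 0ℓ
  Φ⁺ β = β ∈ Φ × (∀ i → 0# ≤ β i)

  H⁺ : V → Pred W 0ℓ
  H⁺ β w = w · β ∈ Φ⁺

  Convex : Pred W 0ℓ → Set₁
  Convex ℒ = Σ[ 𝒜 ∈ Pred V 0ℓ ] 𝒜 ⊆ Φ × (∀ w → w ∈ ℒ ⇔ (∀ {β} → β ∈ 𝒜 → w ∈ H⁺ β))

  Finite : Pred W 0ℓ → Set
  Finite ℒ = ∃[ ws ] (∀ {w} → w ∈ ℒ → w ∈ˡ ws)

  R⟨_⟩ : Pred W 0ℓ → Pred V 0ℓ
  R⟨ ℒ ⟩ β = β ∈ Φ × ℒ ⊆ H⁺ β

  τ : Pred W 0ℓ → Fin n → W → W
  τ ℒ i u with lem {(u ⁻¹ʷ) · α i ∈ R⟨ ℒ ⟩}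
  ... | yes _ = u
  ... | no  _ = s i ∙ u

  Pro : CoxeterElement C → Pred W 0ℓ → W → W
  Pro c ℒ u = foldl (λ v i → τ ℒ i v) u (CoxeterElement.indices c)

  Pro^ : CoxeterElement C → Pred W 0ℓ → ℕ → W → W
  Pro^ c ℒ K u = fold u (Pro c ℒ) K

  Periodic : CoxeterElement C → Pred W 0ℓ → Pred W 0ℓ
  Periodic c ℒ u = ∃[ K ] 1 ℕ.≤ K × Pro^ c ℒ K u ≈ʷ u

  Heavy : CoxeterElement C → Pred W 0ℓ → Set
  Heavy c ℒ = ∀ u → u ∈ Periodic c ℒ → u ∈ ℒ

  Superheavy : CoxeterElement C → Pred W 0ℓ → Set
  Superheavy c ℒ = ∀ u → ∃[ K ] Pro^ c ℒ K u ∈ ℒ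

{-# OPTIONS --safe #-}

-- If ℒ is superheavy, a periodic orbit enters ℒ and, since toggles preserve a convex set,
-- never leaves it.  If all nonempty finite convex sets are heavy and ℒ is one of them, the
-- orbit of any u is finite, because only finitely many roots can separate one of its members
-- from a fixed x ∈ ℒ; hence it becomes periodic, and so enters ℒ.  For an infinite convex ℒ, a
-- periodic orbit involves finitely many toggles, each decided by at most one element of ℒ, so
-- ℒ can be replaced by the convex hull of finitely many of its elements, which is finite.
--
-- All of this rests on Tits' theorem that every root is nonnegative or nonpositive.  Its
-- dihedral case needs sin (kπ/m) ≥ 0 for k ≤ m, which is derived from the power series of
-- cos through the identity cos (x + y) + cos (x - y) = 2 cos x cos y.

module Submission where

open import Defs
open import Level using (0ℓ)
open import Algebra.Bundles using (CommutativeRing; Group)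
open import Axiom.ExcludedMiddle using (ExcludedMiddle)
open import Data.Empty using (⊥)
open import Data.Fin.Base using (Fin; suc; punchIn; toℕ)
open import Data.Fin.Properties using (_≟_; pigeonhole; punchInᵢ≢i)
open import Data.Integer.Base as ℤ using (ℤ; -[1+_]) renaming (+_ to pos)
open import Data.List.Base as List
  using (List; []; _∷_; _++_; length; foldl; foldr; concat; concatMap; replicate; filter; allFin; cartesianProductWith; initLast; _∷ʳ′_)
open import Data.List.Membership.Propositional as Membership using (find; lose)
open import Data.List.Membership.Propositional.Properties using (∈-allFin; ∈-cartesianProductWith⁺; ∈-filter⁺)
open import Data.List.Relation.Unary.All as All using (All; []; _∷_)
open import Data.List.Relation.Unary.Any as Any using (Any; here; there)
open import Data.Maybe.Base as Maybe using (Maybe)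
open import Data.Nat.Base as ℕ using (ℕ; zero; suc; parity; _!)
open import Data.Nat.GeneralisedArithmetic using (fold-+)
open import Data.Parity.Base as ℙ using (0ℙ)
open import Data.Product.Base using (∃-syntax; ∃₂; _×_; _,_; proj₁; proj₂; map₂)
open import Data.Sum.Base as Sum using (_⊎_; inj₁; inj₂; [_,_]′)
open import Data.Vec.Functional using (removeAt)
open import Function.Base using (_∘_; id)
open import Function.Bundles using (_⇔_; mk⇔; Equivalence)
open import Relation.Binary.Bundles using (Poset)
open import Relation.Binary.Definitions using (tri<; tri≈; tri>)
open import Relation.Binary.PropositionalEquality.Core as ≡ using (_≡_; _≢_)
open import Relation.Binary.Structures using (IsTotalOrder)
open import Relation.Nullary using (¬_; yes; no; contradiction; ¬?)
open import Relation.Nullary.Decidable using (decidable-stable; dec⇒maybe; toSum)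
open import Relation.Unary using (Pred; Satisfiable; _∈_; _∉_; _⊆_)
import Algebra.Definitions.RawMonoid as RawMonoidDefinitions
import Algebra.Properties.CommutativeSemigroup as CommutativeSemigroupProperties
import Algebra.Properties.CommutativeSemiring.Exp as Exponentiation
import Algebra.Properties.Group as GroupProperties
import Algebra.Properties.Ring as RingProperties
import Algebra.Properties.Semiring.Mult as Multiples
import Algebra.Properties.Semiring.Sum as Sums
import Algebra.Solver.Ring
import Algebra.Solver.Ring.AlmostCommutativeRing as ACR
import Data.Integer.Properties as ℤₚ
import Data.List.Membership.Setoid as SetoidMembership
import Data.List.Properties as Listₚ
import Data.List.Relation.Unary.All.Properties as Allₚ
import Data.List.Relation.Unary.Any.Properties as Anyₚ
import Data.Nat.Properties as ℕₚ
import Data.Parity.Properties as Parityₚ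
import Relation.Binary.Reasoning.PartialOrder as PosetReasoning
import Relation.Binary.Reasoning.Setoid as SetoidReasoning

-- Two facts about each pair of simple reflections carry the geometry. The relators act trivially,
-- without which acting through a chosen word would not be an action of `W`; and alternating words
-- shorter than the order send a simple root to a nonnegative combination of two. Both are read off
-- one sequence, `U c`, with `c = cos (π / M)` for a finite label `M` and `c = 1` for the label `∞`:
-- the first from its return to the initial values at `2M`, the second from its sign up to `M`.
-- Since cosine is known only through its series and through π / 2 as its least positive zero, sines
-- are written as `cos (π / 2 - x)`, and positivity before π / 2 comes from a supremum and the
-- product identity, not from a general theory of continuous functions. On the group side all
-- finiteness comes from one count (`close`): a word leading from `x` to `z` need be no longer than
-- any finite list that contains the roots separating them. If one list serves a whole set, the set
-- lies in a finite ball around `x`. This bounds both the hull of finitely many elements and every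
-- orbit.

module IntegerCoefficients (R : CommutativeRing 0ℓ 0ℓ) where
  open CommutativeRing R
  open RingProperties ring
  open Multiples semiring using (×-homo-+; ×1-homo-*) renaming (_×_ to _×ᵣ_)
  open SetoidReasoning setoid

  -- The separate clause for `1` makes `con (pos 1)` denote `1#` itself and `con (pos 2)` denote
  -- `1# + 1#`, so that solver equations match the goals definitionally. By contrast `fromℕ 2`
  -- unfolds to `1# + (1# + 0#)` and is spelled out that way where its value matters.
  ⟦_⟧ℕ : ℕ → Carrier
  ⟦ 0 ⟧ℕ           = 0#
  ⟦ 1 ⟧ℕ           = 1#
  ⟦ suc (suc n) ⟧ℕ = 1# + ⟦ suc n ⟧ℕ

  ⟦_⟧ℤ : ℤ → Carrier
  ⟦ pos n ⟧ℤ    = ⟦ n ⟧ℕ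
  ⟦ -[1+ n ] ⟧ℤ = - ⟦ suc n ⟧ℕ

  ⟦⟧ℕ≈×1 : ∀ n → ⟦ n ⟧ℕ ≈ n ×ᵣ 1#
  ⟦⟧ℕ≈×1 0             = refl
  ⟦⟧ℕ≈×1 1             = sym (+-identityʳ 1#)
  ⟦⟧ℕ≈×1 (suc (suc n)) = +-congˡ (⟦⟧ℕ≈×1 (suc n))

  ⟦⟧ℕ-suc : ∀ n → ⟦ suc n ⟧ℕ ≈ 1# + ⟦ n ⟧ℕ
  ⟦⟧ℕ-suc 0       = sym (+-identityʳ 1#)
  ⟦⟧ℕ-suc (suc n) = refl

  ⟦⟧ℕ-+ : ∀ a b → ⟦ a ℕ.+ b ⟧ℕ ≈ ⟦ a ⟧ℕ + ⟦ b ⟧ℕ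
  ⟦⟧ℕ-+ a b = begin
    ⟦ a ℕ.+ b ⟧ℕ          ≈⟨ ⟦⟧ℕ≈×1 (a ℕ.+ b) ⟩
    (a ℕ.+ b) ×ᵣ 1#       ≈⟨ ×-homo-+ 1# a b ⟩
    a ×ᵣ 1# + b ×ᵣ 1#     ≈⟨ +-cong (⟦⟧ℕ≈×1 a) (⟦⟧ℕ≈×1 b) ⟨
    ⟦ a ⟧ℕ + ⟦ b ⟧ℕ       ∎

  ⟦⟧ℕ-* : ∀ a b → ⟦ a ℕ.* b ⟧ℕ ≈ ⟦ a ⟧ℕ * ⟦ b ⟧ℕ
  ⟦⟧ℕ-* a b = begin
    ⟦ a ℕ.* b ⟧ℕ          ≈⟨ ⟦⟧ℕ≈×1 (a ℕ.* b) ⟩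
    (a ℕ.* b) ×ᵣ 1#       ≈⟨ ×1-homo-* a b ⟩
    (a ×ᵣ 1#) * (b ×ᵣ 1#) ≈⟨ *-cong (⟦⟧ℕ≈×1 a) (⟦⟧ℕ≈×1 b) ⟨
    ⟦ a ⟧ℕ * ⟦ b ⟧ℕ       ∎

  ⟦⟧ℤ-⊖ : ∀ a b → ⟦ a ℤ.⊖ b ⟧ℤ ≈ ⟦ a ⟧ℕ - ⟦ b ⟧ℕ
  ⟦⟧ℤ-⊖ a       zero    = sym (trans (+-congˡ -0#≈0#) (+-identityʳ _))
  ⟦⟧ℤ-⊖ zero    (suc b) = sym (+-identityˡ _)
  ⟦⟧ℤ-⊖ (suc a) (suc b) = begin
    ⟦ suc a ℤ.⊖ suc b ⟧ℤ              ≡⟨ ≡.cong ⟦_⟧ℤ (ℤₚ.[1+m]⊖[1+n]≡m⊖n a b) ⟩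
    ⟦ a ℤ.⊖ b ⟧ℤ                      ≈⟨ ⟦⟧ℤ-⊖ a b ⟩
    ⟦ a ⟧ℕ - ⟦ b ⟧ℕ                   ≈⟨ +-identityˡ _ ⟨
    0# + (⟦ a ⟧ℕ - ⟦ b ⟧ℕ)            ≈⟨ +-congʳ (-‿inverseʳ 1#) ⟨
    1# - 1# + (⟦ a ⟧ℕ - ⟦ b ⟧ℕ)       ≈⟨ interchange 1# (- 1#) ⟦ a ⟧ℕ (- ⟦ b ⟧ℕ) ⟩
    1# + ⟦ a ⟧ℕ + (- 1# - ⟦ b ⟧ℕ)     ≈⟨ +-cong (⟦⟧ℕ-suc a) (trans (-‿cong (⟦⟧ℕ-suc b)) (sym (-‿+-comm 1# ⟦ b ⟧ℕ))) ⟨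
    ⟦ suc a ⟧ℕ - ⟦ suc b ⟧ℕ           ∎
    where open CommutativeSemigroupProperties +-commutativeSemigroup using (interchange)

  ⟦⟧ℤ-neg : ∀ x → ⟦ ℤ.- x ⟧ℤ ≈ - ⟦ x ⟧ℤ
  ⟦⟧ℤ-neg (pos zero)    = sym -0#≈0#
  ⟦⟧ℤ-neg (pos (suc n)) = refl
  ⟦⟧ℤ-neg -[1+ n ]      = sym (-‿involutive _)

  ⟦⟧ℤ-+ : ∀ x y → ⟦ x ℤ.+ y ⟧ℤ ≈ ⟦ x ⟧ℤ + ⟦ y ⟧ℤ
  ⟦⟧ℤ-+ (pos a)  (pos b)  = ⟦⟧ℕ-+ a b
  ⟦⟧ℤ-+ (pos a)  -[1+ b ] = ⟦⟧ℤ-⊖ a (suc b)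
  ⟦⟧ℤ-+ -[1+ a ] (pos b)  = trans (⟦⟧ℤ-⊖ b (suc a)) (+-comm _ _)
  ⟦⟧ℤ-+ -[1+ a ] -[1+ b ] = begin
    - ⟦ suc (suc (a ℕ.+ b)) ⟧ℕ    ≡⟨ ≡.cong (λ k → - ⟦ suc k ⟧ℕ) (ℕₚ.+-suc a b) ⟨
    - ⟦ suc a ℕ.+ suc b ⟧ℕ        ≈⟨ -‿cong (⟦⟧ℕ-+ (suc a) (suc b)) ⟩
    - (⟦ suc a ⟧ℕ + ⟦ suc b ⟧ℕ)   ≈⟨ -‿+-comm _ _ ⟨
    - ⟦ suc a ⟧ℕ - ⟦ suc b ⟧ℕ     ∎

  ⟦⟧ℤ-pos* : ∀ a y → ⟦ pos a ℤ.* y ⟧ℤ ≈ ⟦ a ⟧ℕ * ⟦ y ⟧ℤ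
  ⟦⟧ℤ-pos* a (pos b)  = trans (reflexive (≡.cong ⟦_⟧ℤ (≡.sym (ℤₚ.pos-* a b)))) (⟦⟧ℕ-* a b)
  ⟦⟧ℤ-pos* a -[1+ b ] = begin
    ⟦ pos a ℤ.* -[1+ b ] ⟧ℤ         ≡⟨ ≡.cong ⟦_⟧ℤ (≡.sym (ℤₚ.neg-distribʳ-* (pos a) (pos (suc b)))) ⟩
    ⟦ ℤ.- (pos a ℤ.* pos (suc b)) ⟧ℤ ≈⟨ ⟦⟧ℤ-neg (pos a ℤ.* pos (suc b)) ⟩
    - ⟦ pos a ℤ.* pos (suc b) ⟧ℤ    ≈⟨ -‿cong (⟦⟧ℤ-pos* a (pos (suc b))) ⟩
    - (⟦ a ⟧ℕ * ⟦ suc b ⟧ℕ)         ≈⟨ -‿distribʳ-* _ _ ⟩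
    ⟦ a ⟧ℕ * - ⟦ suc b ⟧ℕ           ∎

  ⟦⟧ℤ-* : ∀ x y → ⟦ x ℤ.* y ⟧ℤ ≈ ⟦ x ⟧ℤ * ⟦ y ⟧ℤ
  ⟦⟧ℤ-* (pos a)  y = ⟦⟧ℤ-pos* a y
  ⟦⟧ℤ-* -[1+ a ] y = begin
    ⟦ -[1+ a ] ℤ.* y ⟧ℤ         ≡⟨ ≡.cong ⟦_⟧ℤ (≡.sym (ℤₚ.neg-distribˡ-* (pos (suc a)) y)) ⟩
    ⟦ ℤ.- (pos (suc a) ℤ.* y) ⟧ℤ ≈⟨ ⟦⟧ℤ-neg (pos (suc a) ℤ.* y) ⟩
    - ⟦ pos (suc a) ℤ.* y ⟧ℤ    ≈⟨ -‿cong (⟦⟧ℤ-pos* (suc a) y) ⟩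
    - (⟦ suc a ⟧ℕ * ⟦ y ⟧ℤ)     ≈⟨ -‿distribˡ-* _ _ ⟩
    - ⟦ suc a ⟧ℕ * ⟦ y ⟧ℤ       ∎

  morphism : ℤ.+-*-rawRing ACR.-Raw-AlmostCommutative⟶ ACR.fromCommutativeRing R
  morphism = record
    { ⟦_⟧    = ⟦_⟧ℤ
    ; +-homo = ⟦⟧ℤ-+
    ; *-homo = ⟦⟧ℤ-*
    ; -‿homo = ⟦⟧ℤ-neg
    ; 0-homo = refl
    ; 1-homo = refl
    }

  _coeff≟_ : ∀ x y → Maybe (⟦ x ⟧ℤ ≈ ⟦ y ⟧ℤ)
  x coeff≟ y = Maybe.map (λ x≡y → reflexive (≡.cong ⟦_⟧ℤ x≡y)) (dec⇒maybe (x ℤₚ.≟ y))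

  open Algebra.Solver.Ring ℤ.+-*-rawRing (ACR.fromCommutativeRing R) morphism _coeff≟_ public
    using (solve; _:=_; _:+_; _:*_; _:-_; :-_; con)

-- Complete ordered fields: inequalities, two-sided bounds, limits.

module OrderedField (lem : ExcludedMiddle 0ℓ) (F : CompleteOrderedField) where
  open CompleteOrderedField F public
  open IntegerCoefficients commutativeRing public
    using (solve; _:=_; _:+_; _:*_; _:-_; :-_; con)
  open IsTotalOrder isTotalOrder public
    using (total; antisym) renaming (trans to ≤-trans; reflexive to ≤-reflexive; refl to ≤-refl)
  open RingProperties ring public using (-0#≈0#; -‿involutive)
  open Multiples semiring public using (×-homo-+; ×1-homo-*)

  poset : Poset 0ℓ 0ℓ 0ℓ
  poset = record { isPartialOrder = IsTotalOrder.isPartialOrder isTotalOrder }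

  open PosetReasoning poset public

  2# : Carrier
  2# = 1# + 1#

  0≤y-x : ∀ {x y} → x ≤ y → 0# ≤ y - x
  0≤y-x {x} {y} x≤y = begin
    0#    ≈⟨ -‿inverseʳ x ⟨
    x - x ≤⟨ +-monoˡ-≤ (- x) x≤y ⟩
    y - x ∎

  -- Turns an inequality into a certificate: a nonnegative `d` together with a ring identity that
  -- the solver can check. Most estimates below take this form.
  ≤-by : ∀ {x y d} → 0# ≤ d → y - x ≈ d → x ≤ y
  ≤-by {x} {y} {d} 0≤d y-x≈d = begin
    x          ≈⟨ +-identityˡ x ⟨
    0# + x     ≤⟨ +-monoˡ-≤ x 0≤d ⟩
    d + x      ≈⟨ +-congʳ y-x≈d ⟨
    y - x + x  ≈⟨ solve 2 (λ x y → y :- x :+ x := y) refl x y ⟩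
    y          ∎

  +-nonNeg : ∀ {x y} → 0# ≤ x → 0# ≤ y → 0# ≤ x + y
  +-nonNeg {x} {y} 0≤x 0≤y = begin
    0#     ≤⟨ 0≤y ⟩
    y      ≈⟨ +-identityˡ y ⟨
    0# + y ≤⟨ +-monoˡ-≤ y 0≤x ⟩
    x + y  ∎

  +-mono-≤ : ∀ {x y z w} → x ≤ y → z ≤ w → x + z ≤ y + w
  +-mono-≤ {x} {y} {z} {w} x≤y z≤w = ≤-by (+-nonNeg (0≤y-x x≤y) (0≤y-x z≤w))
    (solve 4 (λ x y z w → (y :+ w) :- (x :+ z) := (y :- x) :+ (w :- z)) refl x y z w)

  -‿anti-≤ : ∀ {x y} → x ≤ y → - y ≤ - x
  -‿anti-≤ {x} {y} x≤y = ≤-by (0≤y-x x≤y) (solve 2 (λ x y → :- x :- :- y := y :- x) refl x y)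

  *-monoˡ-≤ : ∀ {x y z} → 0# ≤ z → x ≤ y → z * x ≤ z * y
  *-monoˡ-≤ {x} {y} {z} 0≤z x≤y = ≤-by (*-nonNeg 0≤z (0≤y-x x≤y))
    (solve 3 (λ x y z → z :* y :- z :* x := z :* (y :- x)) refl x y z)

  *-mono-≤ : ∀ {x y z w} → 0# ≤ z → 0# ≤ x → x ≤ y → z ≤ w → x * z ≤ y * w
  *-mono-≤ {x} {y} {z} {w} 0≤z 0≤x x≤y z≤w = begin
    x * z ≤⟨ *-monoˡ-≤ 0≤x z≤w ⟩
    x * w ≈⟨ *-comm x w ⟩
    w * x ≤⟨ *-monoˡ-≤ (≤-trans 0≤z z≤w) x≤y ⟩
    w * y ≈⟨ *-comm w y ⟩
    y * w ∎

  nonPos⇒neg-nonNeg : ∀ {x} → x ≤ 0# → 0# ≤ - x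
  nonPos⇒neg-nonNeg x≤0 = ≤-trans (≤-reflexive (sym -0#≈0#)) (-‿anti-≤ x≤0)

  square-nonNeg : ∀ x → 0# ≤ x * x
  square-nonNeg x with total 0# x
  ... | inj₁ 0≤x = *-nonNeg 0≤x 0≤x
  ... | inj₂ x≤0 = ≤-trans (*-nonNeg (nonPos⇒neg-nonNeg x≤0) (nonPos⇒neg-nonNeg x≤0))
    (≤-reflexive (solve 1 (λ x → :- x :* :- x := x :* x) refl x))

  0≤1 : 0# ≤ 1#
  0≤1 = ≤-trans (square-nonNeg 1#) (≤-reflexive (*-identityʳ 1#))

  0<1 : 0# < 1#
  0<1 = 0≤1 , 0≉1

  0≤2 : 0# ≤ 2#
  0≤2 = +-nonNeg 0≤1 0≤1

  ≰⇒> : ∀ {x y} → ¬ (x ≤ y) → y < x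
  ≰⇒> {x} {y} x≰y with total x y
  ... | inj₁ x≤y = contradiction x≤y x≰y
  ... | inj₂ y≤x = y≤x , λ y≈x → x≰y (≤-reflexive (sym y≈x))

  <⇒≱ : ∀ {x y} → x < y → ¬ (y ≤ x)
  <⇒≱ (x≤y , x≉y) y≤x = x≉y (antisym x≤y y≤x)

  ≤-<-connex : ∀ x y → x ≤ y ⊎ y < x
  ≤-<-connex x y with lem {x ≤ y}
  ... | yes x≤y = inj₁ x≤y
  ... | no  x≰y = inj₂ (≰⇒> x≰y)

  <-by : ∀ {x y d} → 0# < d → y - x ≈ d → x < y
  <-by {x} {y} {d} (0≤d , 0≉d) y-x≈d = ≤-by 0≤d y-x≈d , λ x≈y → 0≉d (begin-equality
    0#    ≈⟨ -‿inverseʳ x ⟨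
    x - x ≈⟨ +-congʳ x≈y ⟩
    y - x ≈⟨ y-x≈d ⟩
    d     ∎)

  0<y-x : ∀ {x y} → x < y → 0# < y - x
  0<y-x {x} {y} (x≤y , x≉y) = 0≤y-x x≤y , λ 0≈y-x → x≉y (begin-equality
    x         ≈⟨ +-identityˡ x ⟨
    0# + x    ≈⟨ +-congʳ 0≈y-x ⟩
    y - x + x ≈⟨ solve 2 (λ x y → y :- x :+ x := y) refl x y ⟩
    y         ∎)

  +-pos : ∀ {x y} → 0# < x → 0# ≤ y → 0# < x + y
  +-pos {x} {y} 0<x 0≤y = begin-strict
    0#     <⟨ 0<x ⟩
    x      ≈⟨ +-identityʳ x ⟨
    x + 0# ≤⟨ +-mono-≤ ≤-refl 0≤y ⟩
    x + y  ∎

  x*y≈0⇒y≈0 : ∀ {x y} → x ≉ 0# → x * y ≈ 0# → y ≈ 0#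
  x*y≈0⇒y≈0 {x} {y} x≉0 xy≈0 = begin-equality
    y              ≈⟨ *-identityˡ y ⟨
    1# * y         ≈⟨ *-congʳ (⁻¹-inverse x≉0) ⟨
    x * x ⁻¹ * y   ≈⟨ solve 3 (λ x x' y → x :* x' :* y := x' :* (x :* y)) refl x (x ⁻¹) y ⟩
    x ⁻¹ * (x * y) ≈⟨ *-congˡ xy≈0 ⟩
    x ⁻¹ * 0#      ≈⟨ zeroʳ _ ⟩
    0#             ∎

  *-pos : ∀ {x y} → 0# < x → 0# < y → 0# < x * y
  *-pos (0≤x , 0≉x) (0≤y , 0≉y) = *-nonNeg 0≤x 0≤y ,
    λ 0≈xy → 0≉y (sym (x*y≈0⇒y≈0 (λ x≈0 → 0≉x (sym x≈0)) (sym 0≈xy)))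

  pos⇒≉0 : ∀ {x} → 0# < x → x ≉ 0#
  pos⇒≉0 (_ , 0≉x) x≈0 = 0≉x (sym x≈0)

  *-cancelˡ-nonNeg : ∀ {x y} → 0# < x → 0# ≤ x * y → 0# ≤ y
  *-cancelˡ-nonNeg {x} {y} 0<x 0≤xy with ≤-<-connex 0# y
  ... | inj₁ 0≤y = 0≤y
  ... | inj₂ y<0 = contradiction 0≤xy (<⇒≱ (<-by (*-pos 0<x (0<y-x y<0))
    (solve 2 (λ x y → con (pos 0) :- x :* y := x :* (con (pos 0) :- y)) refl x y)))

  0<2 : 0# < 2#
  0<2 = +-pos 0<1 0≤1

  halve-nonNeg : ∀ {y} → 0# ≤ y + y → 0# ≤ y
  halve-nonNeg {y} 0≤2y = *-cancelˡ-nonNeg 0<2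
    (≤-trans 0≤2y (≤-reflexive (solve 1 (λ y → y :+ y := con (pos 2) :* y) refl y)))

  ⁻¹-nonNeg : ∀ {x} → 0# < x → 0# ≤ x ⁻¹
  ⁻¹-nonNeg {x} 0<x = *-cancelˡ-nonNeg 0<x
    (≤-trans 0≤1 (≤-reflexive (sym (⁻¹-inverse (pos⇒≉0 0<x)))))

  ⁻¹-pos : ∀ {x} → 0# < x → 0# < x ⁻¹
  ⁻¹-pos {x} 0<x = ⁻¹-nonNeg 0<x , λ 0≈x⁻¹ → 0≉1 (begin-equality
    0#       ≈⟨ zeroʳ x ⟨
    x * 0#   ≈⟨ *-congˡ 0≈x⁻¹ ⟩
    x * x ⁻¹ ≈⟨ ⁻¹-inverse (pos⇒≉0 0<x) ⟩
    1#       ∎)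

  fromℕ-nonNeg : ∀ k → 0# ≤ fromℕ k
  fromℕ-nonNeg zero    = ≤-refl
  fromℕ-nonNeg (suc k) = +-nonNeg 0≤1 (fromℕ-nonNeg k)

  fromℕ-pos : ∀ k .{{_ : ℕ.NonZero k}} → 0# < fromℕ k
  fromℕ-pos (suc k) = +-pos 0<1 (fromℕ-nonNeg k)

  fromℕ-+ : ∀ a b → fromℕ (a ℕ.+ b) ≈ fromℕ a + fromℕ b
  fromℕ-+ = ×-homo-+ 1#

  fromℕ-* : ∀ a b → fromℕ (a ℕ.* b) ≈ fromℕ a * fromℕ b
  fromℕ-* = ×1-homo-*

  fromℕ-mono-≤ : ∀ {a b} → a ℕ.≤ b → fromℕ a ≤ fromℕ b
  fromℕ-mono-≤ {b = b} ℕ.z≤n = fromℕ-nonNeg b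
  fromℕ-mono-≤ (ℕ.s≤s a≤b)   = +-mono-≤ ≤-refl (fromℕ-mono-≤ a≤b)

  -- If no natural number bounds `x`, the natural numbers have a supremum `l`; as `k + 1 ≤ l` for
  -- every `k`, already `l - 1` bounds them.
  archimedean : ∀ x → ∃[ k ] x ≤ fromℕ k
  archimedean x with lem {∃[ k ] x ≤ fromℕ k}
  ... | yes bound  = bound
  ... | no  ¬bound = contradiction (isLeast l-1-bound) (<⇒≱ (<-by 0<1
          (solve 1 (λ l → l :- (l :- con (pos 1)) := con (pos 1)) refl l)))
    where
    P : Carrier → Set
    P y = ∃[ k ] y ≈ fromℕ k
    x-bound : UpperBound P x
    x-bound (k , y≈k) = ≤-trans (≤-reflexive y≈k) (proj₁ (≰⇒> (λ x≤k → ¬bound (k , x≤k))))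
    sup = supremum P (0# , 0 , refl) (x , x-bound)
    l = proj₁ sup
    isUpper = proj₁ (proj₂ sup)
    isLeast = proj₂ (proj₂ sup)
    l-1-bound : UpperBound P (l - 1#)
    l-1-bound {y} (k , y≈k) = ≤-by (0≤y-x (isUpper (suc k , refl))) (begin-equality
      l - 1# - y        ≈⟨ +-congˡ (-‿cong y≈k) ⟩
      l - 1# - fromℕ k  ≈⟨ solve 2 (λ l k → l :- con (pos 1) :- k := l :- (con (pos 1) :+ k)) refl l (fromℕ k) ⟩
      l - (1# + fromℕ k) ∎)

  infix 4 ∣_∣≤_

  -- A relation in place of an absolute value function: the rules for sums and products become pairs
  -- of inequalities, with no case split on signs.
  ∣_∣≤_ : Carrier → Carrier → Set
  ∣ x ∣≤ b = - b ≤ x × x ≤ b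

  ∣∣≤-nonNeg : ∀ {x b} → ∣ x ∣≤ b → 0# ≤ b
  ∣∣≤-nonNeg {x} {b} (-b≤x , x≤b) = halve-nonNeg (≤-trans (0≤y-x (≤-trans -b≤x x≤b))
    (≤-reflexive (solve 1 (λ b → b :- :- b := b :+ b) refl b)))

  nonNeg⇒∣∣≤ : ∀ {x} → 0# ≤ x → ∣ x ∣≤ x
  nonNeg⇒∣∣≤ {x} 0≤x = ≤-by (+-nonNeg 0≤x 0≤x) (solve 1 (λ x → x :- :- x := x :+ x) refl x) , ≤-refl

  ∣∣≤-exists : ∀ x → ∃[ b ] ∣ x ∣≤ b
  ∣∣≤-exists x with total 0# x
  ... | inj₁ 0≤x = x , nonNeg⇒∣∣≤ 0≤x
  ... | inj₂ x≤0 = - x , ≤-reflexive (-‿involutive x) , ≤-trans x≤0 (nonPos⇒neg-nonNeg x≤0)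

  ∣∣≤-cong : ∀ {x y b} → x ≈ y → ∣ x ∣≤ b → ∣ y ∣≤ b
  ∣∣≤-cong x≈y (l , u) = ≤-trans l (≤-reflexive x≈y) , ≤-trans (≤-reflexive (sym x≈y)) u

  ∣∣≤-weaken : ∀ {x b c} → b ≤ c → ∣ x ∣≤ b → ∣ x ∣≤ c
  ∣∣≤-weaken b≤c (l , u) = ≤-trans (-‿anti-≤ b≤c) l , ≤-trans u b≤c

  ∣∣≤-0 : ∀ {b} → 0# ≤ b → ∣ 0# ∣≤ b
  ∣∣≤-0 0≤b = ∣∣≤-weaken 0≤b (nonNeg⇒∣∣≤ ≤-refl)

  ∣∣≤-neg : ∀ {x b} → ∣ x ∣≤ b → ∣ - x ∣≤ b
  ∣∣≤-neg {x} {b} (l , u) = -‿anti-≤ u , ≤-trans (-‿anti-≤ l) (≤-reflexive (-‿involutive b))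

  ∣∣≤-+ : ∀ {x y b c} → ∣ x ∣≤ b → ∣ y ∣≤ c → ∣ x + y ∣≤ b + c
  ∣∣≤-+ {b = b} {c} (l , u) (l′ , u′) =
    ≤-trans (≤-reflexive (solve 2 (λ b c → :- (b :+ c) := :- b :+ :- c) refl b c)) (+-mono-≤ l l′) ,
    +-mono-≤ u u′

  -- Twice `b * c + x * y`, and twice `b * c - x * y`, is a sum of two products of the nonnegative
  -- quantities `b ± x` and `c ± y`.
  ∣∣≤-* : ∀ {x y b c} → ∣ x ∣≤ b → ∣ y ∣≤ c → ∣ x * y ∣≤ b * c
  ∣∣≤-* {x} {y} {b} {c} (l , u) (l′ , u′) =
    ≤-by (halve-nonNeg (≤-trans (+-nonNeg (*-nonNeg b-x c-y) (*-nonNeg b+x c+y)) (≤-reflexive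
      (solve 4 (λ x y b c → (b :- x) :* (c :- y) :+ (x :- :- b) :* (y :- :- c) :=
        (x :* y :+ b :* c) :+ (x :* y :+ b :* c)) refl x y b c))))
      (solve 4 (λ x y b c → x :* y :- :- (b :* c) := x :* y :+ b :* c) refl x y b c) ,
    ≤-by (halve-nonNeg (≤-trans (+-nonNeg (*-nonNeg b-x c+y) (*-nonNeg b+x c-y)) (≤-reflexive
      (solve 4 (λ x y b c → (b :- x) :* (y :- :- c) :+ (x :- :- b) :* (c :- y) :=
        (b :* c :- x :* y) :+ (b :* c :- x :* y)) refl x y b c))))
      refl
    where
    b-x = 0≤y-x u
    b+x = 0≤y-x l
    c-y = 0≤y-x u′
    c+y = 0≤y-x l′

  min-pos : ∀ {a b} → 0# < a → 0# < b → ∃[ c ] 0# < c × c ≤ a × c ≤ b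
  min-pos {a} {b} 0<a 0<b with total a b
  ... | inj₁ a≤b = a , 0<a , ≤-refl , a≤b
  ... | inj₂ b≤a = b , 0<b , b≤a , ≤-refl

  arbitrarily-small⇒0 : ∀ {x} → (∀ {ε} → 0# < ε → ∣ x ∣≤ ε) → x ≈ 0#
  arbitrarily-small⇒0 {x} small = antisym
    (below (λ 0<ε → proj₂ (small 0<ε)))
    (≤-by (nonPos⇒neg-nonNeg (below (λ 0<ε → proj₂ (∣∣≤-neg (small 0<ε)))))
      (solve 1 (λ x → x :- con (pos 0) := :- :- x) refl x))
    where
    below : ∀ {y} → (∀ {ε} → 0# < ε → y ≤ ε) → y ≤ 0#
    below {y} y≤ with ≤-<-connex y 0#
    ... | inj₁ y≤0 = y≤0
    ... | inj₂ 0<y = contradiction (y≤ (*-pos 0<y (⁻¹-pos 0<2))) (<⇒≱ (<-by (*-pos 0<y (⁻¹-pos 0<2))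
            (begin-equality
              y - y * 2# ⁻¹                       ≈⟨ +-congʳ (*-identityʳ y) ⟨
              y * 1# - y * 2# ⁻¹                  ≈⟨ +-congʳ (*-congˡ (⁻¹-inverse (pos⇒≉0 0<2))) ⟨
              y * (2# * 2# ⁻¹) - y * 2# ⁻¹        ≈⟨ solve 2 (λ y h → y :* (con (pos 2) :* h) :- y :* h := y :* h) refl y (2# ⁻¹) ⟩
              y * 2# ⁻¹                           ∎)))

  module Limits where
    lim⇒∣∣≤ : ∀ {a l} → a ConvergesTo l → ∀ {ε} → 0# < ε →
              ∃[ N ] (∀ {k} → N ℕ.≤ k → ∣ a k - l ∣≤ ε)
    lim⇒∣∣≤ {a} {l} a→l {ε} 0<ε = map₂ (λ near {k} N≤k →
        ≤-by (0≤y-x (proj₁ (near {k} N≤k))) (solve 3 (λ a l e → a :- l :- :- e := a :- (l :- e)) refl (a k) l ε) ,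
        ≤-by (0≤y-x (proj₂ (near {k} N≤k))) (solve 3 (λ a l e → e :- (a :- l) := (l :+ e) :- a) refl (a k) l ε))
      (a→l 0<ε)

    -- A scale factor c lets a limit be certified by bounds that are only proportional to ε.
    ∣∣≤⇒lim : ∀ {a l} c → 0# < c → (∀ {ε} → 0# < ε → ε ≤ 1# → ∃[ N ] (∀ {k} → N ℕ.≤ k → ∣ a k - l ∣≤ c * ε)) →
              a ConvergesTo l
    ∣∣≤⇒lim {a} {l} c 0<c near {ε} 0<ε =
      let N , near-δ = near 0<δ δ≤1 in N , λ {k} N≤k → convert {k} (∣∣≤-weaken cδ≤ε (near-δ N≤k))
      where
      minimum = min-pos (*-pos 0<ε (⁻¹-pos 0<c)) 0<1
      δ = proj₁ minimum
      0<δ = proj₁ (proj₂ minimum)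
      δ≤ε/c = proj₁ (proj₂ (proj₂ minimum))
      δ≤1 = proj₂ (proj₂ (proj₂ minimum))
      cδ≤ε : c * δ ≤ ε
      cδ≤ε = begin
        c * δ            ≤⟨ *-monoˡ-≤ (proj₁ 0<c) δ≤ε/c ⟩
        c * (ε * c ⁻¹)   ≈⟨ solve 3 (λ c c' e → c :* (e :* c') := e :* (c :* c')) refl c (c ⁻¹) ε ⟩
        ε * (c * c ⁻¹)   ≈⟨ *-congˡ (⁻¹-inverse (pos⇒≉0 0<c)) ⟩
        ε * 1#           ≈⟨ *-identityʳ ε ⟩
        ε                ∎
      convert : ∀ {k} → ∣ a k - l ∣≤ ε → l - ε ≤ a k × a k ≤ l + ε
      convert {k} (lo , hi) =
        ≤-by (0≤y-x lo) (solve 3 (λ a l e → a :- (l :- e) := a :- l :- :- e) refl (a k) l ε) ,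
        ≤-by (0≤y-x hi) (solve 3 (λ a l e → (l :+ e) :- a := e :- (a :- l)) refl (a k) l ε)

    lim-cong : ∀ {a b l m} → (∀ k → a k ≈ b k) → l ≈ m → a ConvergesTo l → b ConvergesTo m
    lim-cong a≈b l≈m a→l 0<ε = map₂ (λ near {k} N≤k →
        (≤-trans (≤-reflexive (+-congʳ (sym l≈m))) (≤-trans (proj₁ (near {k} N≤k)) (≤-reflexive (a≈b k)))) ,
        (≤-trans (≤-reflexive (sym (a≈b k))) (≤-trans (proj₂ (near {k} N≤k)) (≤-reflexive (+-congʳ l≈m)))))
      (a→l 0<ε)

    -- The bound is asked for only from index 1 on, because it will be applied to partial sums of
    -- the cosine series near 1, and the empty sum is 0.
    ∣lim∣≤ : ∀ {a l m b} → a ConvergesTo l → (∀ k → ∣ a (suc k) - m ∣≤ b) → ∀ {ε} → 0# < ε → ∣ l - m ∣≤ b + ε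
    ∣lim∣≤ {a} {l} {m} {b} a→l bounded {ε} 0<ε =
      let N , near = lim⇒∣∣≤ {a} {l} a→l 0<ε in ∣∣≤-cong
        (solve 3 (λ a l m → (a :- m) :+ :- (a :- l) := l :- m) refl (a (suc N)) l m)
        (∣∣≤-+ {a (suc N) - m} { - (a (suc N) - l)} {b} {ε} (bounded N) (∣∣≤-neg (near (ℕₚ.n≤1+n N))))

    halves : ∀ x → x * 2# ⁻¹ + x * 2# ⁻¹ ≈ x
    halves x = begin-equality
      x * 2# ⁻¹ + x * 2# ⁻¹ ≈⟨ solve 2 (λ e h → e :* h :+ e :* h := e :* (con (pos 2) :* h)) refl x (2# ⁻¹) ⟩
      x * (2# * 2# ⁻¹)      ≈⟨ *-congˡ (⁻¹-inverse (pos⇒≉0 0<2)) ⟩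
      x * 1#                ≈⟨ *-identityʳ x ⟩
      x                     ∎

    lim-unique : ∀ {a l m} → a ConvergesTo l → a ConvergesTo m → l ≈ m
    lim-unique {a} {l} {m} a→l a→m = begin-equality
      l         ≈⟨ solve 2 (λ l m → l := m :+ (l :- m)) refl l m ⟩
      m + (l - m) ≈⟨ +-congˡ (arbitrarily-small⇒0 small) ⟩
      m + 0#    ≈⟨ +-identityʳ m ⟩
      m         ∎
      where
      small : ∀ {ε} → 0# < ε → ∣ l - m ∣≤ ε
      small {ε} 0<ε =
        let δ = ε * 2# ⁻¹
            0<δ = *-pos 0<ε (⁻¹-pos 0<2)
            N , near  = lim⇒∣∣≤ {a} {l} a→l 0<δ
            M , near′ = lim⇒∣∣≤ {a} {m} a→m 0<δ
            c = a (N ℕ.⊔ M)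
        in ∣∣≤-weaken (≤-reflexive (halves ε))
          (∣∣≤-cong (solve 3 (λ a l m → :- (a :- l) :+ (a :- m) := l :- m) refl c l m)
            (∣∣≤-+ { - (c - l)} {c - m} {δ} {δ} (∣∣≤-neg (near (ℕₚ.m≤m⊔n N M))) (near′ (ℕₚ.m≤n⊔m N M))))

    lim-+ : ∀ {a b l m} → a ConvergesTo l → b ConvergesTo m → (λ k → a k + b k) ConvergesTo (l + m)
    lim-+ {a} {b} {l} {m} a→l b→m = ∣∣≤⇒lim {λ k → a k + b k} {l + m} 2# 0<2 near
      where
      near : ∀ {ε} → 0# < ε → ε ≤ 1# → ∃[ N ] (∀ {k} → N ℕ.≤ k → ∣ a k + b k - (l + m) ∣≤ 2# * ε)
      near {ε} 0<ε _ =
        let N , nearₐ  = lim⇒∣∣≤ {a} {l} a→l 0<ε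
            M , near_b = lim⇒∣∣≤ {b} {m} b→m 0<ε
        in N ℕ.⊔ M , λ {k} N⊔M≤k →
          ∣∣≤-weaken (≤-reflexive (solve 1 (λ e → e :+ e := con (pos 2) :* e) refl ε))
          (∣∣≤-cong (solve 4 (λ a b l m → (a :- l) :+ (b :- m) := a :+ b :- (l :+ m)) refl (a k) (b k) l m)
          (∣∣≤-+ {a k - l} {b k - m} {ε} {ε}
            (nearₐ (ℕₚ.≤-trans (ℕₚ.m≤m⊔n N M) N⊔M≤k)) (near_b (ℕₚ.≤-trans (ℕₚ.m≤n⊔m N M) N⊔M≤k))))

    -- The error is `(a - l)(b - m) + l (b - m) + m (a - l)`. The condition `ε ≤ 1#` bounds its
    -- quadratic part by `ε`, which gives the factor `1# + (A + B)`.
    lim-* : ∀ {a b l m} → a ConvergesTo l → b ConvergesTo m → (λ k → a k * b k) ConvergesTo (l * m)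
    lim-* {a} {b} {l} {m} a→l b→m =
      ∣∣≤⇒lim {λ k → a k * b k} {l * m} (1# + (A + B)) (+-pos 0<1 (+-nonNeg (∣∣≤-nonNeg ∣l∣≤A) (∣∣≤-nonNeg ∣m∣≤B))) near
      where
      A = proj₁ (∣∣≤-exists l)
      B = proj₁ (∣∣≤-exists m)
      ∣l∣≤A : ∣ l ∣≤ A
      ∣l∣≤A = proj₂ (∣∣≤-exists l)
      ∣m∣≤B : ∣ m ∣≤ B
      ∣m∣≤B = proj₂ (∣∣≤-exists m)
      near : ∀ {ε} → 0# < ε → ε ≤ 1# → ∃[ N ] (∀ {k} → N ℕ.≤ k → ∣ a k * b k - l * m ∣≤ (1# + (A + B)) * ε)
      near {ε} 0<ε ε≤1 =
        let N , nearₐ  = lim⇒∣∣≤ {a} {l} a→l 0<ε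
            M , near_b = lim⇒∣∣≤ {b} {m} b→m 0<ε
        in N ℕ.⊔ M , λ {k} N⊔M≤k →
          let a-l : ∣ a k - l ∣≤ ε
              a-l = nearₐ (ℕₚ.≤-trans (ℕₚ.m≤m⊔n N M) N⊔M≤k)
              b-m : ∣ b k - m ∣≤ ε
              b-m = near_b (ℕₚ.≤-trans (ℕₚ.m≤n⊔m N M) N⊔M≤k)
          in ∣∣≤-weaken (≤-by (*-nonNeg (proj₁ 0<ε) (0≤y-x ε≤1))
            (solve 3 (λ A B e → (con (pos 1) :+ (A :+ B)) :* e :- (e :* e :+ (A :* e :+ B :* e)) := e :* (con (pos 1) :- e)) refl A B ε))
          (∣∣≤-cong (solve 4 (λ a b l m → (a :- l) :* (b :- m) :+ (l :* (b :- m) :+ m :* (a :- l)) := a :* b :- l :* m) refl (a k) (b k) l m)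
          (∣∣≤-+ {(a k - l) * (b k - m)} {_} {ε * ε} (∣∣≤-* a-l b-m)
            (∣∣≤-+ {l * (b k - m)} {_} {A * ε} (∣∣≤-* ∣l∣≤A b-m) (∣∣≤-* ∣m∣≤B a-l))))

-- Cauchy products of series with geometrically decaying terms.

module PowerSeries (lem : ExcludedMiddle 0ℓ) (F : CompleteOrderedField) where
  open OrderedField lem F
  open Limits
  open Exponentiation commutativeSemiring using (^-distrib-*)

  ∑ : (ℕ → Carrier) → ℕ → Carrier
  ∑ f zero    = 0#
  ∑ f (suc N) = ∑ f N + f N

  ∑-cong : ∀ {f g} → (∀ k → f k ≈ g k) → ∀ N → ∑ f N ≈ ∑ g N
  ∑-cong f≈g zero    = refl
  ∑-cong f≈g (suc N) = +-cong (∑-cong f≈g N) (f≈g N)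

  ∑-+ : ∀ f g N → ∑ (λ k → f k + g k) N ≈ ∑ f N + ∑ g N
  ∑-+ f g zero    = sym (+-identityʳ 0#)
  ∑-+ f g (suc N) = trans (+-congʳ (∑-+ f g N))
    (solve 4 (λ a b c d → (a :+ b) :+ (c :+ d) := (a :+ c) :+ (b :+ d)) refl (∑ f N) (∑ g N) (f N) (g N))

  ∑-front : ∀ f N → ∑ f (suc N) ≈ f 0 + ∑ (f ∘ suc) N
  ∑-front f zero    = +-comm 0# (f 0)
  ∑-front f (suc N) = trans (+-congʳ (∑-front f N)) (+-assoc _ _ _)

  -- Recursion shifts the second argument only, so that one step of a convolution of `f` and `g`
  -- leaves, definitionally, a convolution of `f` and `g ∘ suc`.
  antidiagonal : (ℕ → ℕ → Carrier) → ℕ → Carrier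
  antidiagonal φ zero    = φ 0 0
  antidiagonal φ (suc n) = φ (suc n) 0 + antidiagonal (λ a b → φ a (suc b)) n

  antidiagonal-cong : ∀ {φ ψ} n → (∀ a b → a ℕ.+ b ≡ n → φ a b ≈ ψ a b) →
                      antidiagonal φ n ≈ antidiagonal ψ n
  antidiagonal-cong zero    φ≈ψ = φ≈ψ 0 0 ≡.refl
  antidiagonal-cong (suc n) φ≈ψ = +-cong (φ≈ψ (suc n) 0 (ℕₚ.+-identityʳ (suc n)))
    (antidiagonal-cong n λ a b a+b≡n → φ≈ψ a (suc b) (≡.trans (ℕₚ.+-suc a b) (≡.cong suc a+b≡n)))

  antidiagonal-+ : ∀ φ ψ n → antidiagonal (λ a b → φ a b + ψ a b) n ≈ antidiagonal φ n + antidiagonal ψ n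
  antidiagonal-+ φ ψ zero    = refl
  antidiagonal-+ φ ψ (suc n) = trans (+-congˡ (antidiagonal-+ _ _ n))
    (solve 4 (λ a b c d → (a :+ b) :+ (c :+ d) := (a :+ c) :+ (b :+ d)) refl _ _ _ _)

  antidiagonal-* : ∀ z φ n → antidiagonal (λ a b → z * φ a b) n ≈ z * antidiagonal φ n
  antidiagonal-* z φ zero    = refl
  antidiagonal-* z φ (suc n) = trans (+-congˡ (antidiagonal-* z _ n)) (sym (distribˡ z _ _))

  antidiagonal-shiftˡ : ∀ φ n → (∀ b → φ 0 b ≈ 0#) →
                        antidiagonal φ (suc n) ≈ antidiagonal (λ a b → φ (suc a) b) n
  antidiagonal-shiftˡ φ zero    φ0≈0 = trans (+-congˡ (φ0≈0 1)) (+-identityʳ _)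
  antidiagonal-shiftˡ φ (suc n) φ0≈0 = +-congˡ (antidiagonal-shiftˡ (λ a b → φ a (suc b)) n (λ b → φ0≈0 (suc b)))

  convolution : (ℕ → Carrier) → (ℕ → Carrier) → ℕ → Carrier
  convolution f g = antidiagonal (λ a b → f a * g b)

  ∑-convolution-front : ∀ f g N →
    ∑ (convolution f g) (suc N) ≈ ∑ f (suc N) * g 0 + ∑ (convolution f (g ∘ suc)) N
  ∑-convolution-front f g zero    =
    solve 2 (λ a b → con (pos 0) :+ a :* b := (con (pos 0) :+ a) :* b :+ con (pos 0)) refl (f 0) (g 0)
  ∑-convolution-front f g (suc N) = trans (+-congʳ (∑-convolution-front f g N))
    (solve 5 (λ s b t a c → (s :* b :+ t) :+ (a :* b :+ c) := (s :+ a) :* b :+ (t :+ c)) refl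
      (∑ f (suc N)) (g 0) (∑ (convolution f (g ∘ suc)) N) (f (suc N)) (convolution f (g ∘ suc) N))

  ^-nonNeg : ∀ {r} n → 0# ≤ r → 0# ≤ r ^ n
  ^-nonNeg zero    0≤r = 0≤1
  ^-nonNeg (suc n) 0≤r = *-nonNeg 0≤r (^-nonNeg n 0≤r)

  module _ {r} (0≤r : 0# ≤ r) (r≤1 : r ≤ 1#) where

    ^-antitone : ∀ p n → r ^ (p ℕ.+ n) ≤ r ^ n
    ^-antitone zero    n = ≤-refl
    ^-antitone (suc p) n = begin
      r * r ^ (p ℕ.+ n) ≤⟨ *-mono-≤ (^-nonNeg (p ℕ.+ n) 0≤r) 0≤r r≤1 (^-antitone p n) ⟩
      1# * r ^ n        ≈⟨ *-identityˡ _ ⟩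
      r ^ n             ∎

    ∑-tail-bound : ∀ {f K} → 0# ≤ K → (∀ n → ∣ f n ∣≤ K * r ^ n) → ∀ p n →
                   ∣ ∑ f (p ℕ.+ n) - ∑ f n ∣≤ fromℕ p * (K * r ^ n)
    ∑-tail-bound {f} {K} 0≤K f≤ zero    n = ∣∣≤-cong (sym (-‿inverseʳ (∑ f n)))
      (∣∣≤-0 (≤-reflexive (sym (zeroˡ _))))
    ∑-tail-bound {f} {K} 0≤K f≤ (suc p) n = ∣∣≤-weaken
      (≤-reflexive (solve 2 (λ m k → m :* k :+ k := (con (pos 1) :+ m) :* k) refl (fromℕ p) (K * r ^ n)))
      (∣∣≤-cong (solve 3 (λ s t a → (s :- t) :+ a := s :+ a :- t) refl (∑ f (p ℕ.+ n)) (∑ f n) (f (p ℕ.+ n)))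
      (∣∣≤-+ {∑ f (p ℕ.+ n) - ∑ f n} (∑-tail-bound {f} {K} 0≤K f≤ p n)
        (∣∣≤-weaken (*-monoˡ-≤ 0≤K (^-antitone p n)) (f≤ (p ℕ.+ n)))))

    -- Induction on `N`, splitting `g 0` off: what remains is `g 0` times a tail of `f`, and the
    -- same difference for `g ∘ suc`, whose constant is `L * r`. The length `M` must stay fixed
    -- while `N` drops, hence two lengths. The tail is estimated crudely, by number of terms times
    -- largest bound; the resulting polynomial factors are harmless against `r ^ N`.
    cauchy-product-bound : ∀ {f K} → 0# ≤ K → (∀ n → ∣ f n ∣≤ K * r ^ n) →
      ∀ {M N} → N ℕ.≤ M → ∀ {g L} → 0# ≤ L → (∀ n → ∣ g n ∣≤ L * r ^ n) →
      ∣ ∑ f M * ∑ g N - ∑ (convolution f g) N ∣≤ fromℕ N * (fromℕ M * (K * (L * r ^ N)))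
    cauchy-product-bound {f} {K} 0≤K f≤ {M} {zero} _ {g} {L} 0≤L g≤ = ∣∣≤-cong
      (solve 1 (λ s → con (pos 0) := s :* con (pos 0) :- con (pos 0)) refl (∑ f M))
      (∣∣≤-0 (≤-reflexive (sym (zeroˡ _))))
    cauchy-product-bound {f} {K} 0≤K f≤ {M} {suc N} N<M {g} {L} 0≤L g≤ = ∣∣≤-weaken
      (≤-reflexive (solve 6 (λ n m k l r p →
          l :* con (pos 1) :* (m :* (k :* (r :* p))) :+ n :* (m :* (k :* (l :* r :* p)))
            := (con (pos 1) :+ n) :* (m :* (k :* (l :* (r :* p))))) refl
        (fromℕ N) (fromℕ M) K L r (r ^ N)))
      (∣∣≤-cong (begin-equality
          g 0 * (∑ f M - ∑ f (suc N)) + (∑ f M * ∑ (g ∘ suc) N - ∑ (convolution f (g ∘ suc)) N)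
            ≈⟨ solve 5 (λ b s t u v → b :* (s :- t) :+ (s :* u :- v) := s :* (b :+ u) :- (t :* b :+ v)) refl
                 (g 0) (∑ f M) (∑ f (suc N)) (∑ (g ∘ suc) N) (∑ (convolution f (g ∘ suc)) N) ⟩
          ∑ f M * (g 0 + ∑ (g ∘ suc) N) - (∑ f (suc N) * g 0 + ∑ (convolution f (g ∘ suc)) N)
            ≈⟨ +-cong (*-congˡ (∑-front g N)) (-‿cong (∑-convolution-front f g N)) ⟨
          ∑ f M * ∑ g (suc N) - ∑ (convolution f g) (suc N) ∎)
      (∣∣≤-+ {g 0 * (∑ f M - ∑ f (suc N))} {∑ f M * ∑ (g ∘ suc) N - ∑ (convolution f (g ∘ suc)) N}
        (∣∣≤-* {g 0} {∑ f M - ∑ f (suc N)} (g≤ 0) tail)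
        (cauchy-product-bound {f} {K} 0≤K f≤ {M} {N} (ℕₚ.<⇒≤ N<M) {g ∘ suc} {L * r} (*-nonNeg 0≤L 0≤r)
          (λ n → ∣∣≤-weaken (≤-reflexive (sym (*-assoc L r (r ^ n)))) (g≤ (suc n))))))
      where
      p = M ℕ.∸ suc N
      tail : ∣ ∑ f M - ∑ f (suc N) ∣≤ fromℕ M * (K * (r ^ suc N))
      tail = ∣∣≤-weaken (begin
          fromℕ p * (K * r ^ suc N) ≈⟨ *-comm _ _ ⟩
          (K * r ^ suc N) * fromℕ p ≤⟨ *-monoˡ-≤ (*-nonNeg 0≤K (^-nonNeg (suc N) 0≤r)) (fromℕ-mono-≤ (ℕₚ.m∸n≤m M (suc N))) ⟩
          (K * r ^ suc N) * fromℕ M ≈⟨ *-comm _ _ ⟩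
          fromℕ M * (K * r ^ suc N) ∎)
        (≡.subst (λ m → ∣ ∑ f m - ∑ f (suc N) ∣≤ fromℕ p * (K * r ^ suc N)) (ℕₚ.m∸n+n≡m N<M)
          (∑-tail-bound {f} {K} 0≤K f≤ p (suc N)))

  -- The ratio is the cube of `½` because the Cauchy product error at length `k` is at most
  -- `k² K L ⅛^k`, while `k ½^k ≤ 1`: two of the three factors `½^k` absorb `k²`, and the third
  -- leaves the decay `K L / k`.
  ½ ⅛ : Carrier
  ½ = 2# ⁻¹
  ⅛ = ½ * (½ * ½)

  0≤½ : 0# ≤ ½
  0≤½ = ⁻¹-nonNeg 0<2

  2*½≈1 : 2# * ½ ≈ 1#
  2*½≈1 = ⁻¹-inverse (pos⇒≉0 0<2)

  ½≤1 : ½ ≤ 1#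
  ½≤1 = ≤-by 0≤½ (begin-equality
    1# - ½      ≈⟨ +-congʳ 2*½≈1 ⟨
    2# * ½ - ½  ≈⟨ solve 1 (λ h → con (pos 2) :* h :- h := h) refl ½ ⟩
    ½           ∎)

  0<½ : 0# < ½
  0<½ = ⁻¹-pos 0<2

  0<⅛ : 0# < ⅛
  0<⅛ = *-pos 0<½ (*-pos 0<½ 0<½)

  *-≤1 : ∀ {x y} → 0# ≤ x → 0# ≤ y → x ≤ 1# → y ≤ 1# → x * y ≤ 1#
  *-≤1 0≤x 0≤y x≤1 y≤1 = ≤-trans (*-mono-≤ 0≤y 0≤x x≤1 y≤1) (≤-reflexive (*-identityʳ 1#))

  ⅛≤1 : ⅛ ≤ 1#
  ⅛≤1 = *-≤1 0≤½ (*-nonNeg 0≤½ 0≤½) ½≤1 (*-≤1 0≤½ 0≤½ ½≤1 ½≤1)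

  n*½^n≤1 : ∀ n → fromℕ n * ½ ^ n ≤ 1#
  n*½^n≤1 zero    = ≤-trans (≤-reflexive (zeroˡ _)) 0≤1
  n*½^n≤1 (suc n) = begin
    (1# + fromℕ n) * (½ * ½ ^ n)      ≈⟨ solve 3 (λ n h p → (con (pos 1) :+ n) :* (h :* p) := h :* (p :+ n :* p)) refl (fromℕ n) ½ (½ ^ n) ⟩
    ½ * (½ ^ n + fromℕ n * ½ ^ n)     ≤⟨ *-monoˡ-≤ 0≤½ (+-mono-≤ ½^n≤1 (n*½^n≤1 n)) ⟩
    ½ * 2#                            ≈⟨ *-comm ½ 2# ⟩
    2# * ½                            ≈⟨ 2*½≈1 ⟩
    1#                                ∎
    where
    ½^n≤1 : ½ ^ n ≤ 1#
    ½^n≤1 = ≡.subst (λ m → ½ ^ m ≤ 1#) (ℕₚ.+-identityʳ n) (^-antitone 0≤½ ½≤1 n 0)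

  cauchy-product : ∀ {f g K L} → (∀ n → ∣ f n ∣≤ K * ⅛ ^ n) → (∀ n → ∣ g n ∣≤ L * ⅛ ^ n) →
    ∀ {ε} → 0# < ε → ∃[ N ] (∀ {k} → N ℕ.≤ k → ∣ ∑ f k * ∑ g k - ∑ (convolution f g) k ∣≤ ε)
  -- The successor makes `k` nonzero, so that `fromℕ k` can be cancelled from `scaled`.
  cauchy-product {f} {g} {K} {L} f≤ g≤ {ε} 0<ε = suc N₀ , bound
    where
    0≤coefficient : ∀ {h J} → (∀ n → ∣ h n ∣≤ J * ⅛ ^ n) → 0# ≤ J
    0≤coefficient {h} {J} h≤ = ≤-trans (∣∣≤-nonNeg {h 0} (h≤ 0)) (≤-reflexive (*-identityʳ J))
    0≤K = 0≤coefficient {f} f≤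
    0≤L = 0≤coefficient {g} g≤
    KL/ε = archimedean (K * L * ε ⁻¹)
    N₀ = proj₁ KL/ε
    KL≤εN : ∀ {k} → suc N₀ ℕ.≤ k → K * L ≤ ε * fromℕ k
    KL≤εN {k} N₀<k = begin
      K * L                  ≈⟨ *-identityʳ _ ⟨
      K * L * 1#             ≈⟨ *-congˡ (⁻¹-inverse (pos⇒≉0 0<ε)) ⟨
      K * L * (ε * ε ⁻¹)     ≈⟨ solve 3 (λ m e i → m :* (e :* i) := e :* (m :* i)) refl (K * L) ε (ε ⁻¹) ⟩
      ε * (K * L * ε ⁻¹)     ≤⟨ *-monoˡ-≤ (proj₁ 0<ε) (≤-trans (proj₂ KL/ε) (fromℕ-mono-≤ (ℕₚ.<⇒≤ N₀<k))) ⟩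
      ε * fromℕ k            ∎
    bound : ∀ {k} → suc N₀ ℕ.≤ k → ∣ ∑ f k * ∑ g k - ∑ (convolution f g) k ∣≤ ε
    bound {k@(suc _)} N₀<k = ∣∣≤-weaken
      (≤-by (*-cancelˡ-nonNeg (fromℕ-pos k) (≤-trans (0≤y-x scaled) (≤-reflexive
        (solve 3 (λ n a e → n :* e :- n :* a := n :* (e :- a)) refl (fromℕ k) A ε)))) refl)
      (cauchy-product-bound (proj₁ 0<⅛) ⅛≤1 {f} {K} 0≤K f≤ {k} ℕₚ.≤-refl {g} {L} 0≤L g≤)
      where
      A = fromℕ k * (fromℕ k * (K * (L * ⅛ ^ k)))
      u = fromℕ k * ½ ^ k
      0≤u : 0# ≤ u
      0≤u = *-nonNeg (fromℕ-nonNeg k) (^-nonNeg k 0≤½)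
      u≤1 = n*½^n≤1 k
      scaled : fromℕ k * A ≤ fromℕ k * ε
      scaled = begin
        fromℕ k * A
          ≈⟨ *-congˡ (*-congˡ (*-congˡ (*-congˡ (*-congˡ (trans (^-distrib-* ½ (½ * ½) k) (*-congˡ (^-distrib-* ½ ½ k))))))) ⟩
        fromℕ k * (fromℕ k * (fromℕ k * (K * (L * (½ ^ k * (½ ^ k * ½ ^ k))))))
          ≈⟨ solve 4 (λ n K L p → n :* (n :* (n :* (K :* (L :* (p :* (p :* p)))))) :=
               (K :* L) :* ((n :* p) :* ((n :* p) :* (n :* p)))) refl (fromℕ k) K L (½ ^ k) ⟩
        K * L * (u * (u * u)) ≤⟨ *-monoˡ-≤ (*-nonNeg 0≤K 0≤L) (*-≤1 0≤u (*-nonNeg 0≤u 0≤u) u≤1 (*-≤1 0≤u 0≤u u≤1 u≤1)) ⟩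
        K * L * 1#            ≈⟨ *-identityʳ _ ⟩
        K * L                 ≤⟨ KL≤εN N₀<k ⟩
        ε * fromℕ k           ≈⟨ *-comm _ _ ⟩
        fromℕ k * ε           ∎

-- The power series of cosine and its product identity.

module CosineSeries (lem : ExcludedMiddle 0ℓ) (F : CompleteOrderedField) where
  open OrderedField lem F
  open Limits
  open PowerSeries lem F
  open Exponentiation commutativeSemiring using (^-distrib-*; ^-congˡ)

  expTerm : Carrier → ℕ → Carrier
  expTerm x n = x ^ n * fromℕ (n !) ⁻¹

  0<n! : ∀ n → 0# < fromℕ (n !)
  0<n! n = fromℕ-pos (n !) {{n ℕₚ.!≢0}}

  expTerm-cong : ∀ {x y} n → x ≈ y → expTerm x n ≈ expTerm y n
  expTerm-cong n x≈y = *-congʳ (^-congˡ n x≈y)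

  expTerm-suc : ∀ x n → fromℕ (suc n) * expTerm x (suc n) ≈ x * expTerm x n
  expTerm-suc x n = begin-equality
    k * (x * p * G ⁻¹)                 ≈⟨ *-identityʳ _ ⟨
    k * (x * p * G ⁻¹) * 1#            ≈⟨ *-congˡ (⁻¹-inverse (pos⇒≉0 (0<n! n))) ⟨
    k * (x * p * G ⁻¹) * (A * A ⁻¹)    ≈⟨ solve 6 (λ k x p g a i → k :* (x :* p :* g) :* (a :* i) := (k :* a) :* g :* (x :* (p :* i))) refl k x p (G ⁻¹) A (A ⁻¹) ⟩
    (k * A) * G ⁻¹ * (x * (p * A ⁻¹))  ≈⟨ *-congʳ (*-congʳ (fromℕ-* (suc n) (n !))) ⟨
    G * G ⁻¹ * (x * (p * A ⁻¹))        ≈⟨ *-congʳ (⁻¹-inverse (pos⇒≉0 (0<n! (suc n)))) ⟩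
    1# * (x * (p * A ⁻¹))              ≈⟨ *-identityˡ _ ⟩
    x * (p * A ⁻¹)                     ∎
    where
    k = fromℕ (suc n)
    p = x ^ n
    A = fromℕ (n !)
    G = fromℕ (suc n !)

  expTerm-zero : ∀ x → expTerm x 0 ≈ 1#
  expTerm-zero x = begin-equality
    1# * fromℕ 1 ⁻¹      ≈⟨ *-congʳ (+-identityʳ 1#) ⟨
    fromℕ 1 * fromℕ 1 ⁻¹ ≈⟨ ⁻¹-inverse (pos⇒≉0 (0<n! 0)) ⟩
    1#                   ∎

  expTerm-scale : ∀ r x n → expTerm (r * x) n ≈ r ^ n * expTerm x n
  expTerm-scale r x n = trans (*-congʳ (^-distrib-* r x n)) (*-assoc _ _ _)

  fromℕ-suc-cancel : ∀ n {x y} → fromℕ (suc n) * x ≈ fromℕ (suc n) * y → x ≈ y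
  fromℕ-suc-cancel n {x} {y} nx≈ny = begin-equality
    x           ≈⟨ solve 2 (λ x y → x := x :- y :+ y) refl x y ⟩
    x - y + y   ≈⟨ +-congʳ (x*y≈0⇒y≈0 (pos⇒≉0 (fromℕ-pos (suc n))) (begin-equality
      N * (x - y)   ≈⟨ solve 3 (λ n x y → n :* (x :- y) := n :* x :- n :* y) refl N x y ⟩
      N * x - N * y ≈⟨ +-congʳ nx≈ny ⟩
      N * y - N * y ≈⟨ -‿inverseʳ (N * y) ⟩
      0#            ∎)) ⟩
    0# + y      ≈⟨ +-identityˡ y ⟩
    y           ∎
    where N = fromℕ (suc n)

  -- The coefficient form of differentiating `e^x e^y`, which avoids binomial coefficients: multiply
  -- by `suc n = a + b` and distribute. The factor `a` lowers the index of the first term and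
  -- produces `x`, the factor `b` lowers the second and produces `y`, both by `expTerm-suc`;
  -- induction then gives `(x + y) * expTerm (x + y) n`.
  binomial : ∀ x y n → convolution (expTerm x) (expTerm y) n ≈ expTerm (x + y) n
  binomial x y zero    = begin-equality
    expTerm x 0 * expTerm y 0 ≈⟨ *-cong (expTerm-zero x) (expTerm-zero y) ⟩
    1# * 1#                   ≈⟨ *-identityʳ 1# ⟩
    1#                        ≈⟨ expTerm-zero (x + y) ⟨
    expTerm (x + y) 0         ∎
  binomial x y (suc n) = fromℕ-suc-cancel n (begin-equality
    fromℕ (suc n) * antidiagonal φ (suc n)
      ≈⟨ antidiagonal-* (fromℕ (suc n)) φ (suc n) ⟨
    antidiagonal (λ a b → fromℕ (suc n) * φ a b) (suc n)
      ≈⟨ antidiagonal-cong (suc n) (λ a b a+b≡n → trans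
           (*-congʳ (trans (reflexive (≡.cong fromℕ (≡.sym a+b≡n))) (fromℕ-+ a b))) (distribʳ (φ a b) (fromℕ a) (fromℕ b))) ⟩
    antidiagonal (λ a b → fromℕ a * φ a b + fromℕ b * φ a b) (suc n)
      ≈⟨ antidiagonal-+ (λ a b → fromℕ a * φ a b) (λ a b → fromℕ b * φ a b) (suc n) ⟩
    antidiagonal (λ a b → fromℕ a * φ a b) (suc n) + antidiagonal (λ a b → fromℕ b * φ a b) (suc n)
      ≈⟨ +-cong (antidiagonal-shiftˡ (λ a b → fromℕ a * φ a b) n (λ b → zeroˡ _)) (trans (+-congʳ (zeroˡ _)) (+-identityˡ _)) ⟩
    antidiagonal (λ a b → fromℕ (suc a) * φ (suc a) b) n + antidiagonal (λ a b → fromℕ (suc b) * φ a (suc b)) n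
      ≈⟨ +-cong
           (antidiagonal-cong n (λ a b _ → trans (sym (*-assoc _ _ _)) (trans (*-congʳ (expTerm-suc x a)) (*-assoc _ _ _))))
           (antidiagonal-cong n (λ a b _ → trans
             (solve 3 (λ k e f → k :* (e :* f) := e :* (k :* f)) refl (fromℕ (suc b)) (expTerm x a) (expTerm y (suc b)))
             (trans (*-congˡ (expTerm-suc y b))
               (solve 3 (λ e y f → e :* (y :* f) := y :* (e :* f)) refl (expTerm x a) y (expTerm y b))))) ⟩
    antidiagonal (λ a b → x * φ a b) n + antidiagonal (λ a b → y * φ a b) n
      ≈⟨ +-cong (antidiagonal-* x φ n) (antidiagonal-* y φ n) ⟩
    x * antidiagonal φ n + y * antidiagonal φ n
      ≈⟨ distribʳ _ x y ⟨
    (x + y) * antidiagonal φ n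
      ≈⟨ *-congˡ (binomial x y n) ⟩
    (x + y) * expTerm (x + y) n
      ≈⟨ expTerm-suc (x + y) n ⟨
    fromℕ (suc n) * expTerm (x + y) (suc n) ∎)
    where
    φ : ℕ → ℕ → Carrier
    φ a b = expTerm x a * expTerm y b

  initial-bound : ∀ (f : ℕ → Carrier) N → ∃[ K ] (∀ {n} → n ℕ.≤ N → ∣ f n ∣≤ K)
  initial-bound f zero = proj₁ (∣∣≤-exists (f 0)) , λ { ℕ.z≤n → proj₂ (∣∣≤-exists (f 0)) }
  initial-bound f (suc N) = K + L , bound
    where
    K = proj₁ (initial-bound f N)
    L = proj₁ (∣∣≤-exists (f (suc N)))
    ∣f∣≤L : ∣ f (suc N) ∣≤ L
    ∣f∣≤L = proj₂ (∣∣≤-exists (f (suc N)))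
    0≤K : 0# ≤ K
    0≤K = ∣∣≤-nonNeg {f 0} (proj₂ (initial-bound f N) ℕ.z≤n)
    bound : ∀ {n} → n ℕ.≤ suc N → ∣ f n ∣≤ K + L
    bound {n} n≤1+N with ℕₚ.m≤n⇒m<n∨m≡n n≤1+N
    ... | inj₁ (ℕ.s≤s n≤N) = ∣∣≤-weaken (≤-by (∣∣≤-nonNeg {f (suc N)} ∣f∣≤L) (solve 2 (λ k l → k :+ l :- k := l) refl K L))
                               (proj₂ (initial-bound f N) n≤N)
    ... | inj₂ ≡.refl      = ∣∣≤-weaken (≤-by 0≤K (solve 2 (λ k l → k :+ l :- l := k) refl K L)) ∣f∣≤L

  ∣∣≤-cancel : ∀ {k x b} → 0# < k → ∣ k * x ∣≤ k * b → ∣ x ∣≤ b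
  ∣∣≤-cancel {k} {x} {b} 0<k (lo , hi) =
    ≤-by (*-cancelˡ-nonNeg 0<k (≤-trans (0≤y-x lo) (≤-reflexive (solve 3 (λ k x b → k :* x :- :- (k :* b) := k :* (x :- :- b)) refl k x b)))) refl ,
    ≤-by (*-cancelˡ-nonNeg 0<k (≤-trans (0≤y-x hi) (≤-reflexive (solve 3 (λ k x b → k :* b :- k :* x := k :* (b :- x)) refl k x b)))) refl

  -- From an index `N` above the size of `x` on, each step multiplies by `x / (n + 1)`, of size at
  -- most 1, so a bound for the terms up to `N` bounds them all.
  expTerm-bounded : ∀ x → ∃[ K ] (∀ n → ∣ expTerm x n ∣≤ K)
  expTerm-bounded x = K , bounded
    where
    b = proj₁ (∣∣≤-exists x)
    N = proj₁ (archimedean b)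
    K = proj₁ (initial-bound (expTerm x) N)
    beyond : ∀ d → ∣ expTerm x (d ℕ.+ N) ∣≤ K
    beyond zero    = proj₂ (initial-bound (expTerm x) N) ℕₚ.≤-refl
    beyond (suc d) = ∣∣≤-cancel {fromℕ (suc (d ℕ.+ N))} {expTerm x (suc (d ℕ.+ N))} (fromℕ-pos (suc (d ℕ.+ N)))
      (∣∣≤-cong (sym (expTerm-suc x (d ℕ.+ N)))
        (∣∣≤-* {x} {expTerm x (d ℕ.+ N)}
          (∣∣≤-weaken (≤-trans (proj₂ (archimedean b)) (fromℕ-mono-≤ (ℕₚ.≤-trans (ℕₚ.m≤n+m N d) (ℕₚ.n≤1+n _)))) (proj₂ (∣∣≤-exists x)))
          (beyond d)))
    bounded : ∀ n → ∣ expTerm x n ∣≤ K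
    bounded n with ℕₚ.≤-total n N
    ... | inj₁ n≤N = proj₂ (initial-bound (expTerm x) N) n≤N
    ... | inj₂ N≤n = ≡.subst (λ m → ∣ expTerm x m ∣≤ K) (ℕₚ.m∸n+n≡m N≤n) (beyond (n ℕ.∸ N))

  -- The term at `x` is `⅛ ^ n` times the term at `8 x`, and the latter terms are bounded.
  expTerm-geometric : ∀ x → ∃[ K ] (∀ n → ∣ expTerm x n ∣≤ K * ⅛ ^ n)
  expTerm-geometric x = K , λ n → ∣∣≤-weaken (≤-reflexive (*-comm (⅛ ^ n) K))
    (∣∣≤-cong (trans (sym (expTerm-scale ⅛ (⅛ ⁻¹ * x) n)) (expTerm-cong n (trans (sym (*-assoc _ _ _))
        (trans (*-congʳ (⁻¹-inverse (pos⇒≉0 0<⅛))) (*-identityˡ x)))))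
      (∣∣≤-* {⅛ ^ n} (nonNeg⇒∣∣≤ (^-nonNeg n (proj₁ 0<⅛))) (proj₂ (expTerm-bounded (⅛ ⁻¹ * x)) n)))
    where K = proj₁ (expTerm-bounded (⅛ ⁻¹ * x))

  -- ρ n is the real part of iⁿ, so that the cosine series becomes ∑ ρ n xⁿ/n!.
  ρ : ℕ → Carrier
  ρ 0             = 1#
  ρ 1             = 0#
  ρ (suc (suc n)) = - ρ n

  ∣ρ∣≤1 : ∀ n → ∣ ρ n ∣≤ 1#
  ∣ρ∣≤1 0             = nonNeg⇒∣∣≤ 0≤1
  ∣ρ∣≤1 1             = ∣∣≤-0 0≤1
  ∣ρ∣≤1 (suc (suc n)) = ∣∣≤-neg (∣ρ∣≤1 n)

  -- This is `2 Re(i^a) Re(i^b) = Re(i^(a+b)) + Re(i^(a-b))`, where `i^(a-b)` is `(-1)^b i^(a+b)`;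
  -- in this form no subtraction of exponents is needed.
  ρ-product : ∀ a b → ρ a * ρ b + ρ a * ρ b ≈ ρ (a ℕ.+ b) * (1# + (- 1#) ^ b)
  ρ-product a 0 = trans (solve 1 (λ r → r :* con (pos 1) :+ r :* con (pos 1) := r :* (con (pos 1) :+ con (pos 1))) refl (ρ a))
    (*-congʳ (reflexive (≡.cong ρ (≡.sym (ℕₚ.+-identityʳ a)))))
  ρ-product a 1 = solve 2 (λ r s → r :* con (pos 0) :+ r :* con (pos 0) := s :* (con (pos 1) :+ :- con (pos 1) :* con (pos 1))) refl (ρ a) (ρ (a ℕ.+ 1))
  ρ-product a (suc (suc b)) = begin-equality
    ρ a * - ρ b + ρ a * - ρ b
      ≈⟨ solve 2 (λ r s → r :* :- s :+ r :* :- s := :- (r :* s :+ r :* s)) refl (ρ a) (ρ b) ⟩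
    - (ρ a * ρ b + ρ a * ρ b)
      ≈⟨ -‿cong (ρ-product a b) ⟩
    - (ρ (a ℕ.+ b) * (1# + (- 1#) ^ b))
      ≈⟨ solve 2 (λ r p → :- (r :* (con (pos 1) :+ p)) := :- r :* (con (pos 1) :+ :- con (pos 1) :* (:- con (pos 1) :* p))) refl (ρ (a ℕ.+ b)) ((- 1#) ^ b) ⟩
    - ρ (a ℕ.+ b) * (1# + - 1# * (- 1# * (- 1#) ^ b))
      ≡⟨ ≡.cong (λ m → ρ m * (1# + (- 1#) ^ suc (suc b))) (≡.trans (ℕₚ.+-suc a (suc b)) (≡.cong suc (ℕₚ.+-suc a b))) ⟨
    ρ (a ℕ.+ suc (suc b)) * (1# + (- 1#) ^ suc (suc b)) ∎

  cosTerm′ : Carrier → ℕ → Carrier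
  cosTerm′ x n = ρ n * expTerm x n

  expTerm-neg : ∀ y n → expTerm (- y) n ≈ (- 1#) ^ n * expTerm y n
  expTerm-neg y n = trans (expTerm-cong n (solve 1 (λ y → :- y := :- con (pos 1) :* y) refl y)) (expTerm-scale (- 1#) y n)

  -- The sign `(- 1#) ^ b` from `ρ-product` is absorbed by replacing `y` with `- y` in the
  -- exponential term. What is left is `ρ n` times two binomial expansions.
  cosTerm′-product : ∀ x y n →
    convolution (cosTerm′ x) (cosTerm′ y) n + convolution (cosTerm′ x) (cosTerm′ y) n
      ≈ cosTerm′ (x + y) n + cosTerm′ (x - y) n
  cosTerm′-product x y n = begin-equality
    antidiagonal γ n + antidiagonal γ n
      ≈⟨ antidiagonal-+ γ γ n ⟨
    antidiagonal (λ a b → γ a b + γ a b) n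
      ≈⟨ antidiagonal-cong n split ⟩
    antidiagonal (λ a b → ρ n * (e x a * e y b + e x a * e (- y) b)) n
      ≈⟨ antidiagonal-* (ρ n) (λ a b → e x a * e y b + e x a * e (- y) b) n ⟩
    ρ n * antidiagonal (λ a b → e x a * e y b + e x a * e (- y) b) n
      ≈⟨ *-congˡ (antidiagonal-+ (λ a b → e x a * e y b) (λ a b → e x a * e (- y) b) n) ⟩
    ρ n * (convolution (e x) (e y) n + convolution (e x) (e (- y)) n)
      ≈⟨ *-congˡ (+-cong (binomial x y n) (binomial x (- y) n)) ⟩
    ρ n * (e (x + y) n + e (x - y) n)
      ≈⟨ distribˡ (ρ n) _ _ ⟩
    cosTerm′ (x + y) n + cosTerm′ (x - y) n ∎
    where
    e = expTerm
    γ : ℕ → ℕ → Carrier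
    γ a b = cosTerm′ x a * cosTerm′ y b
    split : ∀ a b → a ℕ.+ b ≡ n → γ a b + γ a b ≈ ρ n * (e x a * e y b + e x a * e (- y) b)
    split a b ≡.refl = begin-equality
      γ a b + γ a b
        ≈⟨ solve 4 (λ r s u v → (r :* u) :* (s :* v) :+ (r :* u) :* (s :* v) := (r :* s :+ r :* s) :* (u :* v)) refl (ρ a) (ρ b) (e x a) (e y b) ⟩
      (ρ a * ρ b + ρ a * ρ b) * (e x a * e y b)
        ≈⟨ *-congʳ (ρ-product a b) ⟩
      ρ (a ℕ.+ b) * (1# + (- 1#) ^ b) * (e x a * e y b)
        ≈⟨ solve 4 (λ r p u v → r :* (con (pos 1) :+ p) :* (u :* v) := r :* (u :* v :+ u :* (p :* v))) refl (ρ (a ℕ.+ b)) ((- 1#) ^ b) (e x a) (e y b) ⟩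
      ρ (a ℕ.+ b) * (e x a * e y b + e x a * ((- 1#) ^ b * e y b))
        ≈⟨ *-congˡ (+-congˡ (*-congˡ (expTerm-neg y b))) ⟨
      ρ (a ℕ.+ b) * (e x a * e y b + e x a * e (- y) b) ∎

  cosTerm′-geometric : ∀ x → ∃[ K ] (∀ n → ∣ cosTerm′ x n ∣≤ K * ⅛ ^ n)
  cosTerm′-geometric x = map₂ (λ {K} e≤ n → ∣∣≤-weaken (≤-reflexive (*-identityˡ _)) (∣∣≤-* {ρ n} (∣ρ∣≤1 n) (e≤ n))) (expTerm-geometric x)

  double-suc : ∀ k → 2 ℕ.* suc k ≡ suc (suc (2 ℕ.* k))
  double-suc k = ≡.cong suc (ℕₚ.+-suc k (k ℕ.+ 0))

  ρ-even : ∀ k → ρ (2 ℕ.* k) ≈ (- 1#) ^ k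
  ρ-even zero    = refl
  ρ-even (suc k) = begin-equality
    ρ (2 ℕ.* suc k) ≡⟨ ≡.cong ρ (double-suc k) ⟩
    - ρ (2 ℕ.* k)   ≈⟨ -‿cong (ρ-even k) ⟩
    - (- 1#) ^ k    ≈⟨ solve 1 (λ p → :- p := :- con (pos 1) :* p) refl ((- 1#) ^ k) ⟩
    - 1# * (- 1#) ^ k ∎

  ρ-odd : ∀ k → ρ (suc (2 ℕ.* k)) ≈ 0#
  ρ-odd zero    = refl
  ρ-odd (suc k) = begin-equality
    ρ (suc (2 ℕ.* suc k))    ≡⟨ ≡.cong (ρ ∘ suc) (double-suc k) ⟩
    - ρ (suc (2 ℕ.* k))      ≈⟨ -‿cong (ρ-odd k) ⟩
    - 0#                     ≈⟨ -0#≈0# ⟩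
    0#                       ∎

  cosPartialSum′ : ∀ x k → ∑ (cosTerm′ x) (2 ℕ.* k) ≈ cosPartialSum x k
  cosPartialSum′ x zero    = refl
  cosPartialSum′ x (suc k) = begin-equality
    ∑ c (2 ℕ.* suc k)                                  ≡⟨ ≡.cong (∑ c) (double-suc k) ⟩
    ∑ c (2 ℕ.* k) + c (2 ℕ.* k) + c (suc (2 ℕ.* k))    ≈⟨ +-cong (+-cong (cosPartialSum′ x k)
                                                            (trans (*-congʳ (ρ-even k)) (sym (*-assoc _ _ _)))) (trans (*-congʳ (ρ-odd k)) (zeroˡ _)) ⟩
    cosPartialSum x k + cosTerm x k + 0#               ≈⟨ +-identityʳ _ ⟩
    cosPartialSum x k + cosTerm x k                    ∎
    where c = cosTerm′ x

  cosPartialSum-product : ∀ x y {ε} → 0# < ε → ∃[ N ] (∀ {k} → N ℕ.≤ k →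
    ∣ (cosPartialSum x k * cosPartialSum y k + cosPartialSum x k * cosPartialSum y k)
      - (cosPartialSum (x + y) k + cosPartialSum (x - y) k) ∣≤ 2# * ε)
  cosPartialSum-product x y {ε} 0<ε = N , bound
    where
    C = ∑ ∘ cosTerm′
    near = cauchy-product {cosTerm′ x} {cosTerm′ y} (proj₂ (cosTerm′-geometric x)) (proj₂ (cosTerm′-geometric y)) 0<ε
    N = proj₁ near
    bound : ∀ {k} → N ℕ.≤ k →
      ∣ (cosPartialSum x k * cosPartialSum y k + cosPartialSum x k * cosPartialSum y k)
        - (cosPartialSum (x + y) k + cosPartialSum (x - y) k) ∣≤ 2# * ε
    bound {k} N≤k = ∣∣≤-weaken (≤-reflexive (solve 1 (λ e → e :+ e := con (pos 2) :* e) refl ε))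
      (∣∣≤-cong (begin-equality
          (C x K * C y K - T) + (C x K * C y K - T)
            ≈⟨ solve 3 (λ a b t → (a :* b :- t) :+ (a :* b :- t) := (a :* b :+ a :* b) :- (t :+ t)) refl (C x K) (C y K) T ⟩
          (C x K * C y K + C x K * C y K) - (T + T)
            ≈⟨ +-cong (+-cong (*-cong (cosPartialSum′ x k) (cosPartialSum′ y k)) (*-cong (cosPartialSum′ x k) (cosPartialSum′ y k)))
                 (-‿cong (begin-equality
                   T + T                                           ≈⟨ ∑-+ γ γ K ⟨
                   ∑ (λ n → γ n + γ n) K                           ≈⟨ ∑-cong (cosTerm′-product x y) K ⟩
                   ∑ (λ n → cosTerm′ (x + y) n + cosTerm′ (x - y) n) K ≈⟨ ∑-+ (cosTerm′ (x + y)) (cosTerm′ (x - y)) K ⟩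
                   C (x + y) K + C (x - y) K                       ≈⟨ +-cong (cosPartialSum′ (x + y) k) (cosPartialSum′ (x - y) k) ⟩
                   cosPartialSum (x + y) k + cosPartialSum (x - y) k ∎)) ⟩
          (cosPartialSum x k * cosPartialSum y k + cosPartialSum x k * cosPartialSum y k)
            - (cosPartialSum (x + y) k + cosPartialSum (x - y) k) ∎)
        (∣∣≤-+ {C x K * C y K - T} d d))
      where
      K = 2 ℕ.* k
      γ = convolution (cosTerm′ x) (cosTerm′ y)
      T = ∑ γ K
      d : ∣ C x K * C y K - T ∣≤ ε
      d = proj₂ near (ℕₚ.≤-trans N≤k (ℕₚ.m≤m+n k (k ℕ.+ 0)))

  expTerm-smallness : ∀ {s x} → 0# ≤ s → ∣ x ∣≤ s → ∀ n → ∣ expTerm x n ∣≤ s ^ n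
  expTerm-smallness {s} {x} 0≤s ∣x∣≤s zero = ∣∣≤-cong (sym (expTerm-zero x)) (nonNeg⇒∣∣≤ 0≤1)
  expTerm-smallness {s} {x} 0≤s ∣x∣≤s (suc n) = ∣∣≤-cancel {fromℕ (suc n)} {expTerm x (suc n)} (fromℕ-pos (suc n))
    (∣∣≤-cong (sym (expTerm-suc x n)) (∣∣≤-weaken s^1+n≤ (∣∣≤-* {x} ∣x∣≤s (expTerm-smallness 0≤s ∣x∣≤s n))))
    where
    s^1+n≤ : s * s ^ n ≤ fromℕ (suc n) * (s * s ^ n)
    s^1+n≤ = ≤-by (*-nonNeg (fromℕ-nonNeg n) (^-nonNeg (suc n) 0≤s))
      (solve 2 (λ k p → (con (pos 1) :+ k) :* p :- p := k :* p) refl (fromℕ n) (s ^ suc n))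

  -- Beyond the leading 1 the terms are dominated by powers of `s`. For `s ≤ ½` their sum
  -- telescopes, since `s^m ≤ 2 (s^m - s^(m+1))`.
  cosPartialSum-near-1 : ∀ {s x} → 0# ≤ s → s ≤ ½ → ∣ x ∣≤ s → ∀ k → ∣ cosPartialSum x (suc k) - 1# ∣≤ 2# * s
  cosPartialSum-near-1 {s} {x} 0≤s s≤½ ∣x∣≤s k = ∣∣≤-weaken
    (≤-by (*-nonNeg 0≤2 (^-nonNeg (suc m) 0≤s)) (solve 2 (λ s p → con (pos 2) :* s :- con (pos 2) :* (s :- p) := con (pos 2) :* p) refl s (s ^ suc m)))
    (∣∣≤-cong (+-congʳ (trans (reflexive (≡.cong (∑ c) (≡.sym (double-suc k)))) (cosPartialSum′ x (suc k)))) (partial m))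
    where
    c = cosTerm′ x
    m = suc (2 ℕ.* k)
    partial : ∀ m → ∣ ∑ c (suc m) - 1# ∣≤ 2# * (s - s ^ suc m)
    partial zero = ∣∣≤-cong (begin-equality
        0#                              ≈⟨ -‿inverseʳ 1# ⟨
        1# - 1#                         ≈⟨ +-congʳ (trans (+-identityˡ _) (trans (*-identityˡ _) (expTerm-zero x))) ⟨
        0# + 1# * expTerm x 0 - 1#      ∎)
      (∣∣≤-0 (≤-reflexive (solve 1 (λ s → con (pos 0) := con (pos 2) :* (s :- s :* con (pos 1))) refl s)))
    partial (suc m) = ∣∣≤-weaken
      (≤-by (*-nonNeg (*-nonNeg 0≤2 (0≤y-x s≤½)) (^-nonNeg (suc m) 0≤s)) (begin-equality
          2# * (s - s * s ^ suc m) - (2# * (s - s ^ suc m) + s ^ suc m)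
            ≈⟨ solve 2 (λ s p → con (pos 2) :* (s :- s :* p) :- (con (pos 2) :* (s :- p) :+ p) := con (pos 1) :* p :- con (pos 2) :* s :* p) refl s (s ^ suc m) ⟩
          1# * s ^ suc m - 2# * s * s ^ suc m
            ≈⟨ +-congʳ (*-congʳ 2*½≈1) ⟨
          2# * ½ * s ^ suc m - 2# * s * s ^ suc m
            ≈⟨ solve 3 (λ h s p → con (pos 2) :* h :* p :- con (pos 2) :* s :* p := con (pos 2) :* (h :- s) :* p) refl ½ s (s ^ suc m) ⟩
          2# * (½ - s) * s ^ suc m ∎))
      (∣∣≤-cong (solve 3 (λ a b o → (a :- o) :+ b := a :+ b :- o) refl (∑ c (suc m)) (c (suc m)) 1#)
      (∣∣≤-+ {∑ c (suc m) - 1#} {c (suc m)} (partial m)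
        (∣∣≤-weaken (≤-reflexive (*-identityˡ _)) (∣∣≤-* {ρ (suc m)} (∣ρ∣≤1 (suc m)) (expTerm-smallness 0≤s ∣x∣≤s (suc m))))))

-- Chebyshev polynomials of the second kind.

module Chebyshev (lem : ExcludedMiddle 0ℓ) (F : CompleteOrderedField) where
  open OrderedField lem F

  -- Chebyshev polynomials of the second kind, shifted: sin θ · U (cos θ) k = sin (k θ).
  U : Carrier → ℕ → Carrier
  U c 0             = 0#
  U c 1             = 1#
  U c (suc (suc k)) = c * U c (suc k) + c * U c (suc k) - U c k

  -- At `c = 1` the recursion has the solution `U c k = k`. This is the case of the label `∞`.
  U-1-nonNeg : ∀ {c} k → c ≈ 1# → 0# ≤ U c k
  U-1-nonNeg {c} k c≈1 = ≤-trans (fromℕ-nonNeg k) (≤-reflexive (sym (proj₁ (U≈ k))))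
    where
    U≈ : ∀ k → U c k ≈ fromℕ k × U c (suc k) ≈ fromℕ (suc k)
    U≈ zero    = refl , sym (+-identityʳ 1#)
    U≈ (suc k) = proj₂ (U≈ k) , (begin-equality
      c * U c (suc k) + c * U c (suc k) - U c k
        ≈⟨ +-cong (+-cong (*-cong c≈1 (proj₂ (U≈ k))) (*-cong c≈1 (proj₂ (U≈ k)))) (-‿cong (proj₁ (U≈ k))) ⟩
      1# * (1# + fromℕ k) + 1# * (1# + fromℕ k) - fromℕ k
        ≈⟨ solve 1 (λ k → con (pos 1) :* (con (pos 1) :+ k) :+ con (pos 1) :* (con (pos 1) :+ k) :- k := con (pos 1) :+ (con (pos 1) :+ k)) refl (fromℕ k) ⟩
      1# + (1# + fromℕ k) ∎)

-- Signs of cosine up to π / 2, and sines of multiples of π / M.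

module Trigonometry (lem : ExcludedMiddle 0ℓ) (ℝ : Reals) where
  open Reals ℝ using (completeOrderedField; cos; isCosine; π; π/2-zero) public
  open OrderedField lem completeOrderedField
  open Limits
  open PowerSeries lem completeOrderedField using (½; ½≤1; 0≤½; ⅛; 0<⅛; 2*½≈1)
  open CosineSeries lem completeOrderedField
  open Chebyshev lem completeOrderedField

  cosPartialSum-cong : ∀ {x y} → x ≈ y → ∀ k → cosPartialSum x k ≈ cosPartialSum y k
  cosPartialSum-cong x≈y zero    = refl
  cosPartialSum-cong x≈y (suc k) = +-cong (cosPartialSum-cong x≈y k) (*-congʳ (*-congˡ (^-congˡ (2 ℕ.* k) x≈y)))
    where open Exponentiation commutativeSemiring using (^-congˡ)

  cos-cong : ∀ {x y} → x ≈ y → cos x ≈ cos y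
  cos-cong {x} {y} x≈y = lim-unique {cosPartialSum y}
    (lim-cong {cosPartialSum x} {cosPartialSum y} {cos x} {cos x} (cosPartialSum-cong x≈y) refl (isCosine x)) (isCosine y)

  -- The sequence of doubled products of partial sums has the right side as limit. It differs from
  -- the sum of the partial sums at `x + y` and `x - y` by a null sequence, so the left side is its
  -- limit as well.
  cos-product : ∀ x y → cos (x + y) + cos (x - y) ≈ cos x * cos y + cos x * cos y
  cos-product x y = lim-unique {a} limit₁ limit₂
    where
    P = cosPartialSum
    a b : ℕ → Carrier
    a k = P x k * P y k + P x k * P y k
    b k = P (x + y) k + P (x - y) k
    product : (λ k → P x k * P y k) ConvergesTo (cos x * cos y)
    product = lim-* {P x} {P y} (isCosine x) (isCosine y)
    limit₂ : a ConvergesTo (cos x * cos y + cos x * cos y)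
    limit₂ = lim-+ {λ k → P x k * P y k} {λ k → P x k * P y k} product product
    difference : (λ k → a k - b k) ConvergesTo 0#
    difference = ∣∣≤⇒lim {λ k → a k - b k} {0#} 2# 0<2 λ 0<ε _ →
      map₂ (λ near N≤k → ∣∣≤-cong (sym (trans (+-congˡ -0#≈0#) (+-identityʳ _))) (near N≤k)) (cosPartialSum-product x y 0<ε)
    limit₁ : a ConvergesTo (cos (x + y) + cos (x - y))
    limit₁ = lim-cong {λ k → b k + (a k - b k)} {a} {cos (x + y) + cos (x - y) + 0#}
      (λ k → solve 2 (λ a b → b :+ (a :- b) := a) refl (a k) (b k)) (+-identityʳ _)
      (lim-+ {b} {λ k → a k - b k} (lim-+ {P (x + y)} {P (x - y)} (isCosine (x + y)) (isCosine (x - y))) difference)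

  cos-near-1 : ∀ {s x} → 0# ≤ s → s ≤ ½ → ∣ x ∣≤ s → ∀ {ε} → 0# < ε → ∣ cos x - 1# ∣≤ 2# * s + ε
  cos-near-1 {s} {x} 0≤s s≤½ ∣x∣≤s = ∣lim∣≤ {cosPartialSum x} {cos x} {1#} (isCosine x) (cosPartialSum-near-1 0≤s s≤½ ∣x∣≤s)

  cos-0 : cos 0# ≈ 1#
  cos-0 = begin-equality
    cos 0#             ≈⟨ solve 1 (λ c → c := (c :- con (pos 1)) :+ con (pos 1)) refl (cos 0#) ⟩
    cos 0# - 1# + 1#   ≈⟨ +-congʳ (arbitrarily-small⇒0 λ {ε} 0<ε → ∣∣≤-weaken (≤-reflexive (trans (+-congʳ (zeroʳ 2#)) (+-identityˡ ε)))
                            (cos-near-1 ≤-refl 0≤½ (∣∣≤-0 ≤-refl) 0<ε)) ⟩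
    0# + 1#            ≈⟨ +-identityˡ 1# ⟩
    1#                 ∎

  cos-neg : ∀ x → cos (- x) ≈ cos x
  cos-neg x = begin-equality
    cos (- x)                                        ≈⟨ cos-cong (+-identityˡ (- x)) ⟨
    cos (0# - x)                                     ≈⟨ solve 2 (λ p q → q := (p :+ q) :- p) refl (cos (0# + x)) (cos (0# - x)) ⟩
    cos (0# + x) + cos (0# - x) - cos (0# + x)       ≈⟨ +-cong (cos-product 0# x) (-‿cong (cos-cong (+-identityˡ x))) ⟩
    cos 0# * cos x + cos 0# * cos x - cos x          ≈⟨ +-congʳ (+-cong (*-congʳ cos-0) (*-congʳ cos-0)) ⟩
    1# * cos x + 1# * cos x - cos x                  ≈⟨ solve 1 (λ c → con (pos 1) :* c :+ con (pos 1) :* c :- c := c) refl (cos x) ⟩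
    cos x                                            ∎

  cos-double : ∀ x → cos (x + x) ≈ cos x * cos x + cos x * cos x - 1#
  cos-double x = begin-equality
    cos (x + x)                                ≈⟨ solve 2 (λ p q → p := (p :+ q) :- q) refl (cos (x + x)) (cos (x - x)) ⟩
    cos (x + x) + cos (x - x) - cos (x - x)    ≈⟨ +-cong (cos-product x x) (-‿cong (trans (cos-cong (-‿inverseʳ x)) cos-0)) ⟩
    cos x * cos x + cos x * cos x - 1#         ∎

  cos-sum-product : ∀ z t → cos (z + t) * cos (z - t) ≈ cos z * cos z + cos t * cos t - 1#
  cos-sum-product z t = begin-equality
    p * q                               ≈⟨ halves (p * q) ⟨
    p * q * ½ + p * q * ½               ≈⟨ distribʳ ½ _ _ ⟨
    (p * q + p * q) * ½                 ≈⟨ *-congʳ (cos-product (z + t) (z - t)) ⟨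
    (cos ((z + t) + (z - t)) + cos ((z + t) - (z - t))) * ½
      ≈⟨ *-congʳ (+-cong (cos-cong (solve 2 (λ z t → (z :+ t) :+ (z :- t) := z :+ z) refl z t)) (cos-cong (solve 2 (λ z t → (z :+ t) :- (z :- t) := t :+ t) refl z t))) ⟩
    (cos (z + z) + cos (t + t)) * ½     ≈⟨ *-congʳ (+-cong (cos-double z) (cos-double t)) ⟩
    (cos z * cos z + cos z * cos z - 1# + (cos t * cos t + cos t * cos t - 1#)) * ½
      ≈⟨ solve 3 (λ z t h → (z :+ z :- con (pos 1) :+ (t :+ t :- con (pos 1))) :* h :=
           (z :+ t :- con (pos 1)) :* h :+ (z :+ t :- con (pos 1)) :* h) refl (cos z * cos z) (cos t * cos t) ½ ⟩
    D * ½ + D * ½                       ≈⟨ halves D ⟩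
    D                                   ∎
    where
    p = cos (z + t)
    q = cos (z - t)
    D = cos z * cos z + cos t * cos t - 1#

  pos-cong : ∀ {x y} → x ≈ y → 0# < x → 0# < y
  pos-cong x≈y (0≤x , 0≉x) = ≤-trans 0≤x (≤-reflexive x≈y) , λ 0≈y → 0≉x (trans 0≈y (sym x≈y))

  -- If `p ≤ 0`, a positive sum forces `q ≥ 0`, and then the product is not positive. It is applied
  -- with `p` and `q` the cosines of `z + t` and `z - t`, or their negatives, so that both signs are
  -- settled together.
  sum-product-pos : ∀ {p q} → 0# < p + q → 0# < p * q → 0# < p × 0# < q
  sum-product-pos {p} {q} 0<p+q 0<pq = first 0<p+q 0<pq ,
    first (pos-cong (+-comm p q) 0<p+q) (pos-cong (*-comm p q) 0<pq)
    where
    first : ∀ {p q} → 0# < p + q → 0# < p * q → 0# < p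
    first {p} {q} 0<p+q 0<pq with ≤-<-connex p 0#
    ... | inj₂ 0<p = 0<p
    ... | inj₁ p≤0 = contradiction
      (≤-by (*-nonNeg (nonPos⇒neg-nonNeg p≤0) (≤-by (+-nonNeg (proj₁ 0<p+q) (nonPos⇒neg-nonNeg p≤0))
          (solve 2 (λ p q → q :- con (pos 0) := p :+ q :+ :- p) refl p q)))
        (solve 2 (λ p q → con (pos 0) :- p :* q := :- p :* q) refl p q))
      (<⇒≱ 0<pq)

  8⅛≈1 : (2# * (2# * 2#)) * ⅛ ≈ 1#
  8⅛≈1 = begin-equality
    (2# * (2# * 2#)) * (½ * (½ * ½))     ≈⟨ solve 2 (λ t h → (t :* (t :* t)) :* (h :* (h :* h)) := (t :* h) :* ((t :* h) :* (t :* h))) refl 2# ½ ⟩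
    (2# * ½) * ((2# * ½) * (2# * ½))     ≈⟨ *-cong 2*½≈1 (*-cong 2*½≈1 2*½≈1) ⟩
    1# * (1# * 1#)                       ≈⟨ trans (*-identityˡ _) (*-identityˡ 1#) ⟩
    1#                                   ∎

  -- The product cos (z + t) cos (z - t) = cos² z + cos² t - 1 and the sum 2 cos z cos t are
  -- both controlled by cos t alone, so continuity of cos at 0 suffices to keep signs.
  near-zero : ∀ {q} → 0# < q → ∃[ δ ] 0# < δ × (∀ {t} → 0# ≤ t → t ≤ δ →
              0# < cos t × 0# < q + cos t * cos t - 1#)
  near-zero {q} 0<q = s , 0<s , near
    where
    -- The bound `cos t ≥ 1 - 3s` gives `cos² t ≥ 1 - 6s`, so `8s ≤ 1` and `8s ≤ q` leave room for
    -- both strict inequalities.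
    minimum = min-pos 0<⅛ (*-pos 0<⅛ 0<q)
    s = proj₁ minimum
    0<s = proj₁ (proj₂ minimum)
    s≤⅛ = proj₁ (proj₂ (proj₂ minimum))
    s≤⅛q = proj₂ (proj₂ (proj₂ minimum))
    8s : ∀ {q} → s ≤ ⅛ * q → (2# * (2# * 2#)) * s ≤ q
    8s {q} s≤⅛q = begin
      (2# * (2# * 2#)) * s        ≤⟨ *-monoˡ-≤ (*-nonNeg 0≤2 (*-nonNeg 0≤2 0≤2)) s≤⅛q ⟩
      (2# * (2# * 2#)) * (⅛ * q)  ≈⟨ *-assoc _ _ _ ⟨
      (2# * (2# * 2#)) * ⅛ * q    ≈⟨ *-congʳ 8⅛≈1 ⟩
      1# * q                      ≈⟨ *-identityˡ q ⟩
      q                           ∎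
    8s≤1 = 8s (≤-trans s≤⅛ (≤-reflexive (sym (*-identityʳ ⅛))))
    8s≤q = 8s s≤⅛q
    0≤s = proj₁ 0<s
    s≤½ : s ≤ ½
    s≤½ = ≤-trans s≤⅛ (≤-trans (*-monoˡ-≤ 0≤½ (≤-trans (*-mono-≤ 0≤½ 0≤½ ½≤1 ½≤1) (≤-reflexive (*-identityʳ 1#)))) (≤-reflexive (*-identityʳ ½)))
    near : ∀ {t} → 0# ≤ t → t ≤ s → 0# < cos t × 0# < q + cos t * cos t - 1#
    near {t} 0≤t t≤s =
      <-by (+-pos 0<s (+-nonNeg 1-3s≤cos (+-nonNeg (0≤y-x 8s≤1) (+-nonNeg 0≤s (+-nonNeg 0≤s (+-nonNeg 0≤s 0≤s))))))
        (solve 2 (λ c s → c :- con (pos 0) :=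
          s :+ ((c :- con (pos 1) :- :- (con (pos 2) :* s :+ s)) :+ ((con (pos 1) :- (con (pos 2) :* (con (pos 2) :* con (pos 2))) :* s) :+ (s :+ (s :+ (s :+ s)))))) refl (cos t) s) ,
      <-by (+-pos 0<s (+-nonNeg (square-nonNeg (cos t - 1#)) (+-nonNeg 1-3s≤cos (+-nonNeg 1-3s≤cos (+-nonNeg (0≤y-x 8s≤q) 0≤s)))))
        (solve 3 (λ q c s → (q :+ c :* c :- con (pos 1)) :- con (pos 0) :=
          s :+ ((c :- con (pos 1)) :* (c :- con (pos 1)) :+ ((c :- con (pos 1) :- :- (con (pos 2) :* s :+ s)) :+ ((c :- con (pos 1) :- :- (con (pos 2) :* s :+ s)) :+ ((q :- (con (pos 2) :* (con (pos 2) :* con (pos 2))) :* s) :+ s))))) refl q (cos t) s)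
      where
      1-3s≤cos : 0# ≤ cos t - 1# - - (2# * s + s)
      1-3s≤cos = 0≤y-x (proj₁ (cos-near-1 0≤s s≤½ (∣∣≤-weaken t≤s (nonNeg⇒∣∣≤ 0≤t)) 0<s))

  nonZero⇒square-pos : ∀ {x} → x ≉ 0# → 0# < x * x
  nonZero⇒square-pos {x} x≉0 = square-nonNeg x , λ 0≈xx → x≉0 (x*y≈0⇒y≈0 x≉0 (sym 0≈xx))

  cos-pos-near : ∀ {z} → 0# < cos z → ∃[ δ ] 0# < δ × (∀ {t} → 0# ≤ t → t ≤ δ → 0# < cos (z + t))
  cos-pos-near {z} 0<cz = map₂ (λ (0<δ , near) → 0<δ , λ {t} 0≤t t≤δ →
      let 0<ct , 0<D = near 0≤t t≤δ
          0<cc = *-pos 0<cz 0<ct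
      in proj₁ (sum-product-pos
        (pos-cong (sym (cos-product z t)) (+-pos 0<cc (proj₁ 0<cc)))
        (pos-cong (sym (cos-sum-product z t)) 0<D)))
    (near-zero (nonZero⇒square-pos (pos⇒≉0 0<cz)))

  cos-neg-near : ∀ {z} → cos z < 0# → ∃[ δ ] 0# < δ × (∀ {t} → 0# ≤ t → t ≤ δ → cos (z - t) < 0#)
  cos-neg-near {z} cz<0 = map₂ (λ (0<δ , near) → 0<δ , λ {t} 0≤t t≤δ →
      let 0<ct , 0<D = near 0≤t t≤δ
          0<cc = *-pos (0<y-x cz<0) 0<ct
      in <-by (proj₂ (sum-product-pos { - cos (z + t)} { - cos (z - t)}
        (pos-cong (begin-equality
          (0# - cos z) * cos t + (0# - cos z) * cos t ≈⟨ solve 2 (λ p q → (con (pos 0) :- p) :* q :+ (con (pos 0) :- p) :* q := :- (p :* q :+ p :* q)) refl (cos z) (cos t) ⟩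
          - (cos z * cos t + cos z * cos t)       ≈⟨ -‿cong (cos-product z t) ⟨
          - (cos (z + t) + cos (z - t))           ≈⟨ solve 2 (λ p q → :- (p :+ q) := :- p :- q) refl (cos (z + t)) (cos (z - t)) ⟩
          - cos (z + t) - cos (z - t)             ∎) (+-pos 0<cc (proj₁ 0<cc)))
        (pos-cong (begin-equality
          cos z * cos z + cos t * cos t - 1#      ≈⟨ cos-sum-product z t ⟨
          cos (z + t) * cos (z - t)               ≈⟨ solve 2 (λ p q → p :* q := :- p :* :- q) refl (cos (z + t)) (cos (z - t)) ⟩
          - cos (z + t) * - cos (z - t)           ∎) 0<D)))
        (+-identityˡ _))
    (near-zero (nonZero⇒square-pos (λ cz≈0 → proj₂ cz<0 cz≈0)))

  h : Carrier
  h = π * fromℕ 2 ⁻¹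

  0<h : 0# < h
  0<h = proj₁ π/2-zero

  cos-h : cos h ≈ 0#
  cos-h = proj₁ (proj₂ π/2-zero)

  PositiveUpTo : Carrier → Set
  PositiveUpTo y = 0# ≤ y × (∀ {t} → 0# ≤ t → t ≤ y → 0# < cos t)

  0∈PositiveUpTo : PositiveUpTo 0#
  0∈PositiveUpTo = ≤-refl , λ 0≤t t≤0 → pos-cong (trans (sym cos-0) (cos-cong (antisym 0≤t t≤0))) 0<1

  -- A supremum of an initial interval on which cos is positive would be a zero of cos:
  -- at a point where cos ≠ 0, the sign persists nearby.
  PositiveUpTo-supremum : ∀ {z} → UpperBound PositiveUpTo z → (∀ {b} → UpperBound PositiveUpTo b → z ≤ b) →
                          ¬ (z < h)
  PositiveUpTo-supremum {z} isUpper isLeast z<h = by-sign (≤-<-connex (cos z) 0#)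
    where
    0≤z : 0# ≤ z
    0≤z = isUpper {0#} 0∈PositiveUpTo
    cos-z≉0 : cos z ≉ 0#
    cos-z≉0 cz≈0 = proj₂ (proj₂ π/2-zero)
      (0≤z , λ 0≈z → 0≉1 (trans (sym cz≈0) (trans (cos-cong (sym 0≈z)) cos-0))) z<h cz≈0
    positive : ∃[ δ ] 0# < δ × (∀ {t} → 0# ≤ t → t ≤ δ → 0# < cos (z + t)) → ⊥
    positive (δ , 0<δ , near) = <⇒≱ (<-by 0<δ (solve 2 (λ y d → y :+ d :- y := d) refl z δ))
        (isUpper {z + δ} (+-nonNeg 0≤z (proj₁ 0<δ) , beyond))
      where
      beyond′ : ∀ {t} → t ≤ z + δ → 0# ≤ t - z → 0# < cos t
      beyond′ {t} t≤z+δ 0≤t-z = pos-cong (cos-cong (solve 2 (λ t z → z :+ (t :- z) := t) refl t z))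
        (near 0≤t-z (≤-by (0≤y-x t≤z+δ) (solve 3 (λ d t z → d :- (t :- z) := z :+ d :- t) refl δ t z)))
      beyond : ∀ {t} → 0# ≤ t → t ≤ z + δ → 0# < cos t
      beyond {t} 0≤t t≤z+δ with lem {∃[ y ] PositiveUpTo y × t ≤ y}
      ... | yes (y , Py , t≤y) = proj₂ Py 0≤t t≤y
      -- Every member of `PositiveUpTo` lies below `t`, so `z ≤ t`, and `t` falls into the range of
      -- local positivity.
      ... | no  t-above = beyond′ t≤z+δ (0≤y-x (isLeast {t} λ {y} Py → proj₁ (≰⇒> {t} {y} (λ t≤y → t-above (y , Py , t≤y)))))
    negative : ∃[ δ ] 0# < δ × (∀ {t} → 0# ≤ t → t ≤ δ → cos (z - t) < 0#) → ⊥
    negative (δ , 0<δ , near) = <⇒≱ (<-by 0<δ (solve 2 (λ z d → z :- (z :- d) := d) refl z δ)) (isLeast {z - δ} z-δ-bound)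
      where
      cos<0 : ∀ {y} → y ≤ z → z - δ ≤ y → cos y < 0#
      cos<0 {y} y≤z z-δ≤y = <-by
        (0<y-x (near {z - y} (0≤y-x y≤z) (≤-by (0≤y-x z-δ≤y) (solve 3 (λ d y z → d :- (z :- y) := y :- (z :- d)) refl δ y z))))
        (+-congˡ (-‿cong (cos-cong (solve 2 (λ y z → y := z :- (z :- y)) refl y z))))
      z-δ-bound : UpperBound PositiveUpTo (z - δ)
      z-δ-bound {y} Py = [ id , (λ z-δ<y → contradiction (proj₁ (proj₂ Py (proj₁ Py) ≤-refl))
        (<⇒≱ (cos<0 (isUpper {y} Py) (proj₁ z-δ<y)))) ]′ (≤-<-connex y (z - δ))
    by-sign : cos z ≤ 0# ⊎ 0# < cos z → ⊥
    by-sign (inj₁ cz≤0) = negative (cos-neg-near (cz≤0 , cos-z≉0))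
    by-sign (inj₂ 0<cz) = positive (cos-pos-near 0<cz)

  -- If `cos x` were not positive, `x` would bound all intervals of positivity, and their supremum
  -- would lie before `h`, which `PositiveUpTo-supremum` excludes.
  cos-pos-before-h : ∀ {x} → 0# ≤ x → x < h → 0# < cos x
  cos-pos-before-h {x} 0≤x x<h = [ (λ cx≤0 → contradiction (z<h cx≤0) (not-z<h cx≤0)) , id ]′ (≤-<-connex (cos x) 0#)
    where
    x-bound : cos x ≤ 0# → UpperBound PositiveUpTo x
    x-bound cx≤0 {y} Py = [ id , (λ x<y → contradiction cx≤0 (<⇒≱ (proj₂ Py 0≤x (proj₁ x<y)))) ]′ (≤-<-connex y x)
    sup : cos x ≤ 0# → _
    sup cx≤0 = supremum PositiveUpTo (0# , 0∈PositiveUpTo) (x , x-bound cx≤0)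
    not-z<h : ∀ cx≤0 → ¬ (proj₁ (sup cx≤0) < h)
    not-z<h cx≤0 = PositiveUpTo-supremum (proj₁ (proj₂ (sup cx≤0))) (proj₂ (proj₂ (sup cx≤0)))
    z<h : ∀ cx≤0 → proj₁ (sup cx≤0) < h
    z<h cx≤0 = begin-strict
      proj₁ (sup cx≤0) ≤⟨ proj₂ (proj₂ (sup cx≤0)) (x-bound cx≤0) ⟩
      x                <⟨ x<h ⟩
      h                ∎

  cos-nonNeg-[0,h] : ∀ {x} → 0# ≤ x → x ≤ h → 0# ≤ cos x
  cos-nonNeg-[0,h] {x} 0≤x x≤h with lem {x ≈ h}
  ... | yes x≈h = ≤-reflexive (sym (trans (cos-cong x≈h) cos-h))
  ... | no  x≉h = proj₁ (cos-pos-before-h 0≤x (x≤h , x≉h))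

  cos-nonNeg : ∀ {x} → ∣ x ∣≤ h → 0# ≤ cos x
  cos-nonNeg {x} (-h≤x , x≤h) with total 0# x
  ... | inj₁ 0≤x = cos-nonNeg-[0,h] 0≤x x≤h
  ... | inj₂ x≤0 = ≤-trans
    (cos-nonNeg-[0,h] (nonPos⇒neg-nonNeg x≤0) (≤-trans (-‿anti-≤ -h≤x) (≤-reflexive (-‿involutive h))))
    (≤-reflexive (cos-neg x))

  cos-antiperiodic : ∀ x → cos (x + (h + h)) ≈ - cos x
  cos-antiperiodic x = begin-equality
    cos (x + (h + h))
      ≈⟨ solve 2 (λ p q → p := (p :+ q) :- q) refl (cos (x + (h + h))) (cos x) ⟩
    cos (x + (h + h)) + cos x - cos x
      ≈⟨ +-congʳ (+-cong (cos-cong (solve 2 (λ x h → x :+ (h :+ h) := (x :+ h) :+ h) refl x h)) (cos-cong (solve 2 (λ x h → x := (x :+ h) :- h) refl x h))) ⟩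
    cos ((x + h) + h) + cos ((x + h) - h) - cos x
      ≈⟨ +-congʳ (trans (cos-product (x + h) h) (+-cong (*-congˡ cos-h) (*-congˡ cos-h))) ⟩
    cos (x + h) * 0# + cos (x + h) * 0# - cos x
      ≈⟨ solve 2 (λ p q → p :* con (pos 0) :+ p :* con (pos 0) :- q := :- q) refl (cos (x + h)) (cos x) ⟩
    - cos x ∎

  h+h≈π : h + h ≈ π
  h+h≈π = begin-equality
    π * fromℕ 2 ⁻¹ + π * fromℕ 2 ⁻¹ ≈⟨ solve 2 (λ p i → p :* i :+ p :* i := p :* ((con (pos 1) :+ (con (pos 1) :+ con (pos 0))) :* i)) refl π (fromℕ 2 ⁻¹) ⟩
    π * (fromℕ 2 * fromℕ 2 ⁻¹)      ≈⟨ *-congˡ (⁻¹-inverse (pos⇒≉0 (fromℕ-pos 2))) ⟩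
    π * 1#                          ≈⟨ *-identityʳ π ⟩
    π                               ∎

  cos-π : cos π ≈ - 1#
  cos-π = begin-equality
    cos π              ≈⟨ cos-cong (trans (+-identityˡ _) h+h≈π) ⟨
    cos (0# + (h + h)) ≈⟨ cos-antiperiodic 0# ⟩
    - cos 0#           ≈⟨ -‿cong cos-0 ⟩
    - 1#               ∎

  module Angle (M : ℕ) (2≤M : 2 ℕ.≤ M) where
    instance
      M≢0 : ℕ.NonZero M
      M≢0 = ℕ.>-nonZero (ℕₚ.≤-trans (ℕ.s≤s ℕ.z≤n) 2≤M)

    θ c : Carrier
    θ = π * fromℕ M ⁻¹
    c = cos θ

    Mθ≈2h : fromℕ M * θ ≈ h + h
    Mθ≈2h = begin-equality
      fromℕ M * (π * fromℕ M ⁻¹) ≈⟨ solve 3 (λ m p i → m :* (p :* i) := p :* (m :* i)) refl (fromℕ M) π (fromℕ M ⁻¹) ⟩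
      π * (fromℕ M * fromℕ M ⁻¹) ≈⟨ *-congˡ (⁻¹-inverse (pos⇒≉0 (fromℕ-pos M))) ⟩
      π * 1#                     ≈⟨ *-identityʳ π ⟩
      π                          ≈⟨ h+h≈π ⟨
      h + h                      ∎

    0<θ : 0# < θ
    0<θ = *-pos (pos-cong h+h≈π (+-pos 0<h (proj₁ 0<h))) (⁻¹-pos (fromℕ-pos M))

    θ≤h : θ ≤ h
    θ≤h = ≤-by (*-cancelˡ-nonNeg (fromℕ-pos M) (≤-trans (0≤y-x Mθ≤Mh)
        (≤-reflexive (solve 3 (λ m h t → m :* h :- m :* t := m :* (h :- t)) refl (fromℕ M) h θ)))) refl
      where
      Mθ≤Mh : fromℕ M * θ ≤ fromℕ M * h
      Mθ≤Mh = begin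
        fromℕ M * θ  ≈⟨ Mθ≈2h ⟩
        h + h        ≈⟨ solve 1 (λ h → h :+ h := h :* (con (pos 1) :+ (con (pos 1) :+ con (pos 0)))) refl h ⟩
        h * fromℕ 2  ≤⟨ *-monoˡ-≤ (proj₁ 0<h) (fromℕ-mono-≤ 2≤M) ⟩
        h * fromℕ M  ≈⟨ *-comm h _ ⟩
        fromℕ M * h  ∎

    -- `sin (k θ)` as a shifted cosine. Values at consecutive `k` differ by `θ` in the argument, so
    -- `cos-product` yields the recursion of `U`.
    sine : ℕ → Carrier
    sine k = cos (h - fromℕ k * θ)

    sine-0 : sine 0 ≈ 0#
    sine-0 = trans (cos-cong (solve 2 (λ h t → h :- con (pos 0) :* t := h) refl h θ)) cos-h

    sine-suc-suc : ∀ k → sine (suc (suc k)) ≈ c * sine (suc k) + c * sine (suc k) - sine k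
    sine-suc-suc k = begin-equality
      sine (suc (suc k))
        ≈⟨ solve 2 (λ p q → q := (p :+ q) :- p) refl (sine k) (sine (suc (suc k))) ⟩
      sine k + sine (suc (suc k)) - sine k
        ≈⟨ +-congʳ (+-cong
             (cos-cong (solve 3 (λ h k t → h :- k :* t := (h :- (con (pos 1) :+ k) :* t) :+ t) refl h (fromℕ k) θ))
             (cos-cong (solve 3 (λ h k t → h :- (con (pos 1) :+ (con (pos 1) :+ k)) :* t := (h :- (con (pos 1) :+ k) :* t) :- t) refl h (fromℕ k) θ))) ⟩
      cos (h - fromℕ (suc k) * θ + θ) + cos (h - fromℕ (suc k) * θ - θ) - sine k
        ≈⟨ +-congʳ (cos-product (h - fromℕ (suc k) * θ) θ) ⟩
      sine (suc k) * c + sine (suc k) * c - sine k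
        ≈⟨ +-congʳ (+-cong (*-comm _ _) (*-comm _ _)) ⟩
      c * sine (suc k) + c * sine (suc k) - sine k ∎

    sine≈U : ∀ k → sine k ≈ U c k * sine 1 × sine (suc k) ≈ U c (suc k) * sine 1
    sine≈U zero    = trans sine-0 (sym (zeroˡ _)) , sym (*-identityˡ _)
    sine≈U (suc k) = proj₂ (sine≈U k) , (begin-equality
      sine (suc (suc k))
        ≈⟨ sine-suc-suc k ⟩
      c * sine (suc k) + c * sine (suc k) - sine k
        ≈⟨ +-cong (+-cong (*-congˡ (proj₂ (sine≈U k))) (*-congˡ (proj₂ (sine≈U k)))) (-‿cong (proj₁ (sine≈U k))) ⟩
      c * (U c (suc k) * sine 1) + c * (U c (suc k) * sine 1) - U c k * sine 1
        ≈⟨ solve 4 (λ c v w s → c :* (v :* s) :+ c :* (v :* s) :- w :* s := (c :* v :+ c :* v :- w) :* s) refl c (U c (suc k)) (U c k) (sine 1) ⟩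
      U c (suc (suc k)) * sine 1 ∎)

    0<sine-1 : 0# < sine 1
    0<sine-1 = pos-cong (cos-cong (solve 2 (λ h t → h :- t := h :- (con (pos 1) :+ con (pos 0)) :* t) refl h θ))
      (cos-pos-before-h (0≤y-x θ≤h) (<-by 0<θ (solve 2 (λ h t → h :- (h :- t) := t) refl h θ)))

    sine-nonNeg : ∀ {k} → k ℕ.≤ M → 0# ≤ sine k
    sine-nonNeg {k} k≤M = cos-nonNeg
      ( ≤-by (0≤y-x kθ≤2h) (solve 2 (λ h x → (h :- x) :- :- h := (h :+ h) :- x) refl h (fromℕ k * θ))
      , ≤-by (*-nonNeg (fromℕ-nonNeg k) (proj₁ 0<θ)) (solve 2 (λ h x → h :- (h :- x) := x) refl h (fromℕ k * θ)))
      where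
      kθ≤2h : fromℕ k * θ ≤ h + h
      kθ≤2h = begin
        fromℕ k * θ ≈⟨ *-comm _ _ ⟩
        θ * fromℕ k ≤⟨ *-monoˡ-≤ (proj₁ 0<θ) (fromℕ-mono-≤ k≤M) ⟩
        θ * fromℕ M ≈⟨ *-comm _ _ ⟩
        fromℕ M * θ ≈⟨ Mθ≈2h ⟩
        h + h       ∎

    U-nonNeg : ∀ {k} → k ℕ.≤ M → 0# ≤ U c k
    U-nonNeg {k} k≤M = *-cancelˡ-nonNeg 0<sine-1
      (≤-trans (sine-nonNeg k≤M) (≤-reflexive (trans (proj₁ (sine≈U k)) (*-comm _ _))))

    sine-antiperiodic : ∀ k → sine (M ℕ.+ k) ≈ - sine k
    sine-antiperiodic k = begin-equality
      cos (h - fromℕ (M ℕ.+ k) * θ)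
        ≈⟨ cos-cong (begin-equality
             h - fromℕ (M ℕ.+ k) * θ               ≈⟨ +-congˡ (-‿cong (*-congʳ (fromℕ-+ M k))) ⟩
             h - (fromℕ M + fromℕ k) * θ           ≈⟨ solve 4 (λ h m k t → h :- (m :+ k) :* t := h :- k :* t :- m :* t) refl h (fromℕ M) (fromℕ k) θ ⟩
             h - fromℕ k * θ - fromℕ M * θ         ≈⟨ +-congˡ (-‿cong Mθ≈2h) ⟩
             h - fromℕ k * θ - (h + h)             ∎) ⟩
      cos (x - (h + h))              ≈⟨ -‿involutive _ ⟨
      - - cos (x - (h + h))          ≈⟨ -‿cong (cos-antiperiodic (x - (h + h))) ⟨
      - cos (x - (h + h) + (h + h))  ≈⟨ -‿cong (cos-cong (solve 2 (λ x h → x :- h :+ h := x) refl x (h + h))) ⟩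
      - cos x                        ∎
      where x = h - fromℕ k * θ

    U-cancel : ∀ {k v} → U c k * sine 1 ≈ v * sine 1 → U c k ≈ v
    U-cancel {k} {v} eq = begin-equality
      U c k          ≈⟨ solve 2 (λ a b → a := (a :- b) :+ b) refl (U c k) v ⟩
      U c k - v + v  ≈⟨ +-congʳ (x*y≈0⇒y≈0 (pos⇒≉0 0<sine-1) (begin-equality
        sine 1 * (U c k - v)          ≈⟨ solve 3 (λ s a b → s :* (a :- b) := a :* s :- b :* s) refl (sine 1) (U c k) v ⟩
        U c k * sine 1 - v * sine 1   ≈⟨ +-congʳ eq ⟩
        v * sine 1 - v * sine 1       ≈⟨ -‿inverseʳ _ ⟩
        0#                            ∎)) ⟩
      0# + v         ≈⟨ +-identityˡ v ⟩
      v              ∎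

    -- Together with `U-2M+1`: after `2M` steps, a full turn, the sequence is back at its initial
    -- values 0 and 1. This is what makes the relator of `i` and `j` act trivially.
    U-2M : U c (M ℕ.+ M) ≈ 0#
    U-2M = U-cancel {M ℕ.+ M} (begin-equality
      U c (M ℕ.+ M) * sine 1   ≈⟨ proj₁ (sine≈U (M ℕ.+ M)) ⟨
      sine (M ℕ.+ M)           ≈⟨ sine-antiperiodic M ⟩
      - sine M                 ≡⟨ ≡.cong (λ k → - sine k) (ℕₚ.+-identityʳ M) ⟨
      - sine (M ℕ.+ 0)         ≈⟨ -‿cong (sine-antiperiodic 0) ⟩
      - - sine 0               ≈⟨ -‿involutive _ ⟩
      sine 0                   ≈⟨ sine-0 ⟩
      0#                       ≈⟨ zeroˡ _ ⟨
      0# * sine 1              ∎)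

    U-2M+1 : U c (suc (M ℕ.+ M)) ≈ 1#
    U-2M+1 = U-cancel {suc (M ℕ.+ M)} (begin-equality
      U c (suc (M ℕ.+ M)) * sine 1   ≈⟨ proj₂ (sine≈U (M ℕ.+ M)) ⟨
      sine (suc (M ℕ.+ M))           ≡⟨ ≡.cong sine (ℕₚ.+-suc M M) ⟨
      sine (M ℕ.+ suc M)             ≈⟨ sine-antiperiodic (suc M) ⟩
      - sine (suc M)                 ≡⟨ ≡.cong (λ k → - sine k) (ℕₚ.+-comm M 1) ⟨
      - sine (M ℕ.+ 1)               ≈⟨ -‿cong (sine-antiperiodic 1) ⟩
      - - sine 1                     ≈⟨ -‿involutive _ ⟩
      sine 1                         ≈⟨ *-identityˡ _ ⟨
      1# * sine 1                    ∎)

    -- If `c * c` were 1, the double angle formula at `h - θ` would make `sin² θ = 1 - c²` vanish,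
    -- although `sin θ` is positive. The number `1 - c²` is also the Gram determinant of the two
    -- simple roots.
    c²≉1 : c * c ≉ 1#
    c²≉1 cc≈1 = proj₂ (*-pos 0<sine-1 0<sine-1) (sym (begin-equality
      sine 1 * sine 1
        ≈⟨ *-cong (cos-cong 1θ) (cos-cong 1θ) ⟩
      cos (h - θ) * cos (h - θ)
        ≈⟨ halves _ ⟨
      s * ½ + s * ½
        ≈⟨ solve 2 (λ s h → s :* h :+ s :* h := ((s :+ s :- con (pos 1)) :+ con (pos 1)) :* h) refl s ½ ⟩
      (s + s - 1# + 1#) * ½
        ≈⟨ *-congʳ (+-congʳ (cos-double (h - θ))) ⟨
      (cos ((h - θ) + (h - θ)) + 1#) * ½
        ≈⟨ *-congʳ (+-congʳ (cos-cong (solve 2 (λ h t → (h :- t) :+ (h :- t) := :- (t :+ t) :+ (h :+ h)) refl h θ))) ⟩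
      (cos (- (θ + θ) + (h + h)) + 1#) * ½
        ≈⟨ *-congʳ (+-congʳ (trans (cos-antiperiodic (- (θ + θ))) (-‿cong (trans (cos-neg (θ + θ)) (cos-double θ))))) ⟩
      (- (c * c + c * c - 1#) + 1#) * ½
        ≈⟨ *-congʳ (+-congʳ (-‿cong (+-congʳ (+-cong cc≈1 cc≈1)))) ⟩
      (- (1# + 1# - 1#) + 1#) * ½
        ≈⟨ solve 1 (λ h → (:- (con (pos 1) :+ con (pos 1) :- con (pos 1)) :+ con (pos 1)) :* h := con (pos 0)) refl ½ ⟩
      0# ∎))
      where
      s = cos (h - θ) * cos (h - θ)
      1θ : h - fromℕ 1 * θ ≈ h - θ
      1θ = solve 2 (λ h t → h :- (con (pos 1) :+ con (pos 0)) :* t := h :- t) refl h θ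

-- Orders of group elements.

module Orders (G : Group 0ℓ 0ℓ) where
  open Group G
  open GroupProperties G
  open RawMonoidDefinitions rawMonoid using () renaming (_×_ to _times_)
  open SetoidReasoning setoid

  order-unique : ∀ {g h k l} → (∀ j → j times g ≈ ε → j times h ≈ ε) → (∀ j → j times h ≈ ε → j times g ≈ ε) →
                 HasOrder G g k → HasOrder G h l → k ≡ l
  order-unique {k = finite k} {finite l} g⇒h h⇒g (0<k , g^k , g-least) (0<l , h^l , h-least) with ℕₚ.<-cmp k l
  ... | tri< k<l _ _ = contradiction (g⇒h k g^k) (h-least 0<k k<l)
  ... | tri≈ _ k≡l _ = ≡.cong finite k≡l
  ... | tri> _ _ l<k = contradiction (h⇒g l h^l) (g-least 0<l l<k)
  order-unique {k = finite k} {∞} g⇒h h⇒g (0<k , g^k , _) h-free = contradiction (g⇒h k g^k) (h-free 0<k)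
  order-unique {k = ∞} {finite l} g⇒h h⇒g g-free (0<l , h^l , _) = contradiction (h⇒g l h^l) (g-free 0<l)
  order-unique {k = ∞} {∞} _ _ _ _ = ≡.refl

  times-slide : ∀ a b l → b ∙ l times (a ∙ b) ≈ l times (b ∙ a) ∙ b
  times-slide a b zero    = trans (identityʳ b) (sym (identityˡ b))
  times-slide a b (suc l) = begin
    b ∙ ((a ∙ b) ∙ l times (a ∙ b))   ≈⟨ ∙-congˡ (assoc a b _) ⟩
    b ∙ (a ∙ (b ∙ l times (a ∙ b)))   ≈⟨ assoc b a _ ⟨
    (b ∙ a) ∙ (b ∙ l times (a ∙ b))   ≈⟨ ∙-congˡ (times-slide a b l) ⟩
    (b ∙ a) ∙ (l times (b ∙ a) ∙ b)   ≈⟨ assoc (b ∙ a) _ b ⟨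
    ((b ∙ a) ∙ l times (b ∙ a)) ∙ b   ∎

  times-swap : ∀ a b l → l times (a ∙ b) ≈ ε → l times (b ∙ a) ≈ ε
  times-swap a b l ab^l≈ε = ∙-cancelʳ b _ _ (begin
    l times (b ∙ a) ∙ b  ≈⟨ times-slide a b l ⟨
    b ∙ l times (a ∙ b)  ≈⟨ ∙-congˡ ab^l≈ε ⟩
    b ∙ ε                ≈⟨ identityʳ b ⟩
    b                    ≈⟨ identityˡ b ⟨
    ε ∙ b                ∎)

  order-of-ε : HasOrder G ε (finite 1)
  order-of-ε = ℕ.s≤s ℕ.z≤n , identityˡ ε , λ { {suc _} _ (ℕ.s≤s ()) }

  times-cong : ∀ {g h} → g ≈ h → ∀ l → l times g ≈ l times h
  times-cong g≈h zero    = refl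
  times-cong g≈h (suc l) = ∙-cong g≈h (times-cong g≈h l)

-- Words, parity, reduced words and alternating words.

module CoxeterWords (lem : ExcludedMiddle 0ℓ) {n} (C : CoxeterSystem n) where
  open CoxeterSystem C
  open Orders group
  open RawMonoidDefinitions rawMonoid using () renaming (_×_ to _times_)

  infix 4 _∼_
  _∼_ : Word n → Word n → Set
  u ∼ v = m ⊢ u ∼ v

  s² : ∀ i → s i ∙ s i ≈ ε
  s² i = trans (∙-congˡ (sym (identityʳ (s i)))) (proj₁ (proj₂ (s-order i)))

  -- The system specifies `m` only through orders of products, so the usual shape of a Coxeter
  -- matrix (this lemma and the next two) has to be read off from uniqueness of orders and
  -- injectivity of `s`.
  m-diag : ∀ i → m i i ≡ finite 1
  m-diag i = order-unique (λ j eq → trans (times-cong (sym (s² i)) j) eq) (λ j eq → trans (times-cong (s² i) j) eq)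
    (m-order i i) order-of-ε

  m-sym : ∀ i j → m i j ≡ m j i
  m-sym i j = order-unique (times-swap (s i) (s j)) (times-swap (s j) (s i)) (m-order i j) (m-order j i)

  m-offdiag : ∀ {i j k} → i ≢ j → m i j ≡ finite k → 2 ℕ.≤ k
  m-offdiag {i} {j} i≢j mij≡k with m i j | m-order i j
  m-offdiag i≢j ≡.refl | finite (suc (suc _)) | _ = ℕ.s≤s (ℕ.s≤s ℕ.z≤n)
  m-offdiag {i} {j} i≢j ≡.refl | finite 1 | _ , sisj≈ε , _ = contradiction
    (s-injective (trans (inverseʳ-unique (s i) (s i) (s² i)) (sym (inverseʳ-unique (s i) (s j) (trans (sym (identityʳ _)) sisj≈ε)))))
    i≢j
    where
    open GroupProperties group

  eval-++ : ∀ u v → eval (u ++ v) ≈ eval u ∙ eval v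
  eval-++ []      v = sym (identityˡ _)
  eval-++ (i ∷ u) v = trans (∙-congˡ (eval-++ u v)) (sym (assoc _ _ _))

  eval-relator : ∀ i j k → eval (concat (replicate k (i ∷ j ∷ []))) ≈ k times (s i ∙ s j)
  eval-relator i j zero    = refl
  eval-relator i j (suc k) = trans (∙-congˡ (∙-congˡ (eval-relator i j k))) (sym (assoc _ _ _))

  ∼⇒eval : ∀ {u v} → u ∼ v → eval u ≈ eval v
  ∼⇒eval (relator {i} {j} {k} mij≡k) = trans (eval-relator i j k)
    (proj₁ (proj₂ (≡.subst (HasOrder group (s i ∙ s j)) mij≡k (m-order i j))))
  ∼⇒eval ∼-refl          = refl
  ∼⇒eval (∼-sym p)       = sym (∼⇒eval p)
  ∼⇒eval (∼-trans p q)   = trans (∼⇒eval p) (∼⇒eval q)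
  ∼⇒eval (++-cong {u} {u′} {v} {v′} p q) = trans (eval-++ u v) (trans (∙-cong (∼⇒eval p) (∼⇒eval q)) (sym (eval-++ u′ v′)))

  ≡⇒∼ : ∀ {u v} → u ≡ v → u ∼ v
  ≡⇒∼ ≡.refl = ∼-refl

  cancel : ∀ i u → i ∷ i ∷ u ∼ u
  cancel i u = ++-cong {v = u} (relator (m-diag i)) ∼-refl

  ++-cancel : ∀ u i v → u ++ i ∷ i ∷ v ∼ u ++ v
  ++-cancel u i v = ++-cong {u = u} ∼-refl (cancel i v)

  ∷ʳ-cancel : ∀ u i → (u ++ i ∷ []) ++ i ∷ [] ∼ u
  ∷ʳ-cancel u i = ∼-trans (≡⇒∼ (Listₚ.++-assoc u _ _)) (∼-trans (++-cancel u i []) (≡⇒∼ (Listₚ.++-identityʳ u)))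

  length-∷ʳ : ∀ (u : Word n) {i} → length (u ++ i ∷ []) ≡ suc (length u)
  length-∷ʳ u = ≡.trans (Listₚ.length-++ u) (ℕₚ.+-comm (length u) 1)

  parity-++ : ∀ (u v : Word n) → parity (length (u ++ v)) ≡ parity (length u) ℙ.+ parity (length v)
  parity-++ u v = ≡.trans (≡.cong parity (Listₚ.length-++ u)) (Parityₚ.+-homo-+ (length u) (length v))

  -- Relators have even length. Hence appending a letter always changes the least length of a
  -- spelling.
  parity-∼ : ∀ {u v} → u ∼ v → parity (length u) ≡ parity (length v)
  parity-∼ (relator {i} {j} {k} _) = even k
    where
    even : ∀ k → parity (length (concat (replicate k (i ∷ j ∷ [])))) ≡ 0ℙ
    even zero    = ≡.refl
    even (suc k) = even k
  parity-∼ ∼-refl        = ≡.refl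
  parity-∼ (∼-sym p)     = ≡.sym (parity-∼ p)
  parity-∼ (∼-trans p q) = ≡.trans (parity-∼ p) (parity-∼ q)
  parity-∼ (++-cong {u} {u′} {v} {v′} p q) =
    ≡.trans (parity-++ u v) (≡.trans (≡.cong₂ ℙ._+_ (parity-∼ p) (parity-∼ q)) (≡.sym (parity-++ u′ v′)))

  Reduced : Word n → Set
  Reduced u = ∀ v → v ∼ u → length u ℕ.≤ length v

  ¬reduced⇒shorter : ∀ {u} → ¬ Reduced u → ∃[ v ] v ∼ u × length v ℕ.< length u
  ¬reduced⇒shorter {u} ¬red with lem {∃[ v ] v ∼ u × length v ℕ.< length u}
  ... | yes shorter = shorter
  ... | no  none    = contradiction (λ v v∼u → ℕₚ.≮⇒≥ (λ v<u → none (v , v∼u , v<u))) ¬red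

  reduce : ∀ u → ∃[ v ] v ∼ u × Reduced v
  reduce u = go (length u) u ℕₚ.≤-refl
    where
    go : ∀ N u → length u ℕ.≤ N → ∃[ v ] v ∼ u × Reduced v
    go N u u≤N with lem {Reduced u}
    ... | yes red = u , ∼-refl , red
    ... | no ¬red with N | ¬reduced⇒shorter {u} ¬red
    ...   | zero  | v , _ , v<u = contradiction (ℕₚ.<-≤-trans v<u u≤N) λ ()
    ...   | suc N | v , v∼u , v<u with go N v (ℕ.s≤s⁻¹ (ℕₚ.≤-trans v<u u≤N))
    ...     | w , w∼v , red = w , ∼-trans w∼v v∼u , red

  -- A spelling `v` of `u i` shorter than that word is at most as long as `u`, and not equally long
  -- by parity; appending `i` once more turns it into a spelling of `u`.
  reduced-or-descent : ∀ u i → Reduced (u ++ i ∷ []) ⊎ (∃[ v ] v ++ i ∷ [] ∼ u × suc (length v) ℕ.≤ length u)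
  reduced-or-descent u i with lem {Reduced (u ++ i ∷ [])}
  ... | yes red = inj₁ red
  ... | no ¬red with ¬reduced⇒shorter ¬red
  ...   | v , v∼ui , v<ui = inj₂ (v , ∼-trans (++-cong v∼ui ∼-refl) (∷ʳ-cancel u i) ,
            ℕₚ.≤∧≢⇒< (ℕ.s≤s⁻¹ (ℕₚ.≤-trans v<ui (ℕₚ.≤-reflexive (length-∷ʳ u)))) different)
    where
    different : length v ≢ length u
    different v≡u = Parityₚ.p≢p⁻¹ (parity (suc (length u))) (≡.trans
      (≡.trans (≡.cong parity (≡.sym (length-∷ʳ u))) (≡.trans (≡.sym (parity-∼ v∼ui)) (≡.cong parity v≡u)))
      (≡.sym (Parityₚ.suc-homo-⁻¹ (length u))))

  reduced-prefix : ∀ u {i} → Reduced (u ++ i ∷ []) → Reduced u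
  reduced-prefix u {i} red v v∼u = ℕ.s≤s⁻¹ (≡.subst₂ ℕ._≤_ (length-∷ʳ u) (length-∷ʳ v) (red (v ++ i ∷ []) (++-cong v∼u ∼-refl)))

  reduced-resp : ∀ {u v} → v ∼ u → length v ℕ.≤ length u → Reduced u → Reduced v
  reduced-resp v∼u v≤u red w w∼v = ℕₚ.≤-trans v≤u (red w (∼-trans w∼v v∼u))

  inverse-word : ∀ u → ∃[ v ] length v ≡ length u × v ++ u ∼ []
  inverse-word []      = [] , ≡.refl , ∼-refl
  inverse-word (i ∷ u) with inverse-word u
  ... | v , v≡u , vu∼[] = v ++ i ∷ [] , ≡.trans (length-∷ʳ v) (≡.cong suc v≡u) ,
    ∼-trans (≡⇒∼ (Listₚ.++-assoc v _ _)) (∼-trans (++-cancel v i u) vu∼[])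

  letter : Fin n → Fin n → ℕ → Fin n
  letter j i zero    = j
  letter j i (suc k) = letter i j k

  letter-cases : ∀ j i k → letter j i k ≡ j ⊎ letter j i k ≡ i
  letter-cases j i zero    = inj₁ ≡.refl
  letter-cases j i (suc k) = [ inj₂ , inj₁ ]′ (letter-cases i j k)

  -- Letters are indexed from the right, so that the word ends in j and grows on the left.
  alternating : Fin n → Fin n → ℕ → Word n
  alternating j i zero    = []
  alternating j i (suc k) = letter j i k ∷ alternating j i k

  length-alternating : ∀ j i k → length (alternating j i k) ≡ k
  length-alternating j i zero    = ≡.refl
  length-alternating j i (suc k) = ≡.cong suc (length-alternating j i k)

  alternating-∷ʳ : ∀ j i k → alternating j i k ++ i ∷ [] ≡ alternating i j (suc k)
  alternating-∷ʳ j i zero    = ≡.refl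
  alternating-∷ʳ j i (suc k) = ≡.cong (letter j i k ∷_) (alternating-∷ʳ j i k)

  alternating-+ : ∀ j i p q → ∃[ u ] length u ≡ p × alternating j i (p ℕ.+ q) ≡ u ++ alternating j i q
  alternating-+ j i zero    q = [] , ≡.refl , ≡.refl
  alternating-+ j i (suc p) q with alternating-+ j i p q
  ... | u , u≡p , eq = letter j i (p ℕ.+ q) ∷ u , ≡.cong suc u≡p , ≡.cong (_ ∷_) eq

  letter-even : ∀ j i k → letter j i (k ℕ.+ k) ≡ j
  letter-even j i zero    = ≡.refl
  letter-even j i (suc k) = ≡.trans (≡.cong (letter i j) (ℕₚ.+-suc k k)) (letter-even j i k)

  alternating-even : ∀ j i k → alternating j i (k ℕ.+ k) ≡ concat (replicate k (i ∷ j ∷ []))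
  alternating-even j i zero    = ≡.refl
  alternating-even j i (suc k) = ≡.trans (≡.cong (alternating j i ∘ suc) (ℕₚ.+-suc k k))
    (≡.cong₂ _∷_ (letter-even i j k) (≡.cong₂ _∷_ (letter-even j i k) (alternating-even j i k)))

  alternating-relator : ∀ {j i M} → m i j ≡ finite M → alternating j i (M ℕ.+ M) ∼ []
  alternating-relator {j} {i} {M} mij≡M = ∼-trans (≡⇒∼ (alternating-even j i M)) (relator mij≡M)

  -- The whole word has at least `M + 1` letters. Its last `M + 1` letters complete the `M - 1`
  -- letters `q` to the relator of length `2M`, so they may be replaced by an inverse of `q`, two
  -- letters shorter.
  alternating-too-long : ∀ {j i M k} → m i j ≡ finite M → 1 ℕ.≤ M → M ℕ.≤ k →
                         ∃[ z ] z ∼ alternating j i k ++ i ∷ [] × suc (length z) ℕ.≤ k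
  alternating-too-long {j} {i} {suc M} {k} mij≡M _ M<k
    with alternating-+ i j (k ℕ.∸ suc M) (suc (suc M)) | alternating-+ i j M (suc (suc M))
  ... | p , p≡ , split-p | q , q≡ , split-q with inverse-word q
  ...   | r , r≡q , rq∼[] = p ++ r ,
      ∼-trans (++-cong {u = p} ∼-refl (∼-sym tail∼r))
        (≡⇒∼ (≡.trans (≡.sym split-p) (≡.trans (≡.cong (alternating i j) length≡) (≡.sym (alternating-∷ʳ j i k))))) ,
      ℕₚ.≤-reflexive (≡.trans (≡.cong suc (≡.trans (Listₚ.length-++ p) (≡.cong₂ ℕ._+_ p≡ (≡.trans r≡q q≡))))
        (≡.trans (≡.sym (ℕₚ.+-suc (k ℕ.∸ suc M) M)) (ℕₚ.m∸n+n≡m M<k)))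
    where
    tail = alternating i j (suc (suc M))
    length≡ : k ℕ.∸ suc M ℕ.+ suc (suc M) ≡ suc k
    length≡ = ≡.trans (ℕₚ.+-suc (k ℕ.∸ suc M) (suc M)) (≡.cong suc (ℕₚ.m∸n+n≡m M<k))
    q-tail∼[] : q ++ tail ∼ []
    q-tail∼[] = ∼-trans (≡⇒∼ (≡.trans (≡.sym split-q) (≡.cong (alternating i j) (ℕₚ.+-suc M (suc M)))))
      (alternating-relator (≡.trans (m-sym j i) mij≡M))
    tail∼r : tail ∼ r
    tail∼r = ∼-trans (++-cong (∼-sym rq∼[]) ∼-refl) (∼-trans (≡⇒∼ (Listₚ.++-assoc r q tail))
      (∼-trans (++-cong {u = r} ∼-refl q-tail∼[]) (≡⇒∼ (Listₚ.++-identityʳ r))))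

  -- Otherwise `alternating-too-long` would spell `u i` with fewer letters. The bound keeps the
  -- Chebyshev indices in the range where the values are nonnegative.
  alternating-short : ∀ {u i j} → i ≢ j → Reduced (u ++ i ∷ []) → ∀ v k → v ++ alternating j i k ∼ u → length v ℕ.+ k ℕ.≤ length u →
                      ∀ {M} → m i j ≡ finite M → suc k ℕ.≤ M
  alternating-short {u} {i} {j} i≢j red v k v-alt∼u len {M} mij≡M = ℕₚ.≰⇒> λ M≤k →
    let z , z∼ , z<k = alternating-too-long {j} {i} mij≡M (ℕₚ.≤-trans (ℕ.s≤s ℕ.z≤n) (m-offdiag i≢j mij≡M)) M≤k
        vz∼ui = ∼-trans (++-cong {u = v} ∼-refl z∼) (∼-trans (≡⇒∼ (≡.sym (Listₚ.++-assoc v _ _))) (++-cong v-alt∼u ∼-refl))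
    in ℕₚ.<-irrefl ≡.refl (begin-strict
      length u                <⟨ ℕₚ.n<1+n _ ⟩
      suc (length u)          ≡⟨ length-∷ʳ u ⟨
      length (u ++ i ∷ [])    ≤⟨ red (v ++ z) vz∼ui ⟩
      length (v ++ z)         ≡⟨ Listₚ.length-++ v ⟩
      length v ℕ.+ length z   ≤⟨ ℕₚ.+-monoʳ-≤ (length v) (ℕₚ.<⇒≤ z<k) ⟩
      length v ℕ.+ k          ≤⟨ len ⟩
      length u                ∎)
    where open ℕₚ.≤-Reasoning

  -- If `v` could be spelled with the first letter of the alternating part at its end, the two
  -- copies would cancel and shorten the reduced word `u`.
  no-descent : ∀ {u i j} → Reduced (u ++ i ∷ []) → ∀ v k → v ++ alternating j i (suc k) ∼ u → length v ℕ.+ suc k ℕ.≤ length u →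
               ∀ w → w ++ letter j i k ∷ [] ∼ v → ¬ (suc (length w) ℕ.≤ length v)
  no-descent {u} {i} {j} red v k v-alt∼u len w wx∼v w<v = ℕₚ.<-irrefl ≡.refl (begin-strict
    length u                                       ≤⟨ reduced-prefix u red (w ++ alternating j i k) w-alt∼u ⟩
    length (w ++ alternating j i k)                ≡⟨ Listₚ.length-++ w ⟩
    length w ℕ.+ length (alternating j i k)        ≡⟨ ≡.cong (length w ℕ.+_) (length-alternating j i k) ⟩
    length w ℕ.+ k                                 <⟨ ℕₚ.+-mono-<-≤ w<v (ℕₚ.n≤1+n k) ⟩
    length v ℕ.+ suc k                             ≤⟨ len ⟩
    length u                                       ∎)
    where
    open ℕₚ.≤-Reasoning
    x = letter j i k
    w-alt∼u : w ++ alternating j i k ∼ u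
    w-alt∼u = ∼-trans (∼-sym (++-cancel w x (alternating j i k)))
      (∼-trans (≡⇒∼ (≡.sym (Listₚ.++-assoc w (x ∷ []) (x ∷ alternating j i k))))
        (∼-trans (++-cong wx∼v ∼-refl) v-alt∼u))

-- The geometric representation and its dihedral planes.

module Representation (lem : ExcludedMiddle 0ℓ) (ℝ : Reals) {n} (C : CoxeterSystem n) where
  open Billiards lem ℝ C using (V; _≈ᵛ_; α; gram; B; reflect)
  open CoxeterSystem C using (m)
  open CoxeterWords lem C hiding (cancel)
  open Trigonometry lem ℝ using (completeOrderedField; cos; π; cos-π; cos-cong; module Angle)
  open OrderedField lem completeOrderedField
  open Chebyshev lem completeOrderedField
  open Sums semiring using (sum-cong-≋; ∑-distrib-+; ∑-comm; *-distribˡ-sum; sum-remove; sum-replicate-zero)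

  ≈ᵛ-refl : ∀ {β} → β ≈ᵛ β
  ≈ᵛ-refl i = refl

  ≈ᵛ-sym : ∀ {β γ} → β ≈ᵛ γ → γ ≈ᵛ β
  ≈ᵛ-sym β≈γ i = sym (β≈γ i)

  ≈ᵛ-trans : ∀ {β γ δ} → β ≈ᵛ γ → γ ≈ᵛ δ → β ≈ᵛ δ
  ≈ᵛ-trans β≈γ γ≈δ i = trans (β≈γ i) (γ≈δ i)

  combination : Carrier → V → Carrier → V → V
  combination x β y γ i = x * β i + y * γ i

  sum-combination : ∀ {k} x (f : Fin k → Carrier) y g → sum (λ i → x * f i + y * g i) ≈ x * sum f + y * sum g
  sum-combination x f y g = trans (∑-distrib-+ (λ i → x * f i) (λ i → y * g i))
    (+-cong (sym (*-distribˡ-sum x f)) (sym (*-distribˡ-sum y g)))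

  sum-single : ∀ {k} (f : Fin k → Carrier) i → (∀ j → j ≢ i → f j ≈ 0#) → sum f ≈ f i
  sum-single {suc k} f i f≈0 = begin-equality
    sum f                          ≈⟨ sum-remove f ⟩
    f i + sum (removeAt f i)       ≈⟨ +-congˡ (sum-cong-≋ (λ j → f≈0 (punchIn i j) (punchInᵢ≢i i j))) ⟩
    f i + sum {k} (λ _ → 0#)       ≈⟨ +-congˡ (sum-replicate-zero k) ⟩
    f i + 0#                       ≈⟨ +-identityʳ (f i) ⟩
    f i                            ∎

  α-diag : ∀ i → α i i ≈ 1#
  α-diag i with i ≟ i
  ... | yes _   = refl
  ... | no  i≢i = contradiction ≡.refl i≢i

  α-offdiag : ∀ {i j} → j ≢ i → α i j ≈ 0#
  α-offdiag {i} {j} j≢i with i ≟ j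
  ... | yes i≡j = contradiction (≡.sym i≡j) j≢i
  ... | no  _   = refl

  gram-sym : ∀ i j → gram (m i j) ≈ gram (m j i)
  gram-sym i j = reflexive (≡.cong gram (m-sym i j))

  gram-diag : ∀ i → gram (m i i) ≈ 1#
  gram-diag i = begin-equality
    gram (m i i)               ≡⟨ ≡.cong gram (m-diag i) ⟩
    - cos (π * fromℕ 1 ⁻¹)     ≈⟨ -‿cong (cos-cong π/1≈π) ⟩
    - cos π                    ≈⟨ -‿cong cos-π ⟩
    - - 1#                     ≈⟨ -‿involutive 1# ⟩
    1#                         ∎
    where
    π/1≈π : π * fromℕ 1 ⁻¹ ≈ π
    π/1≈π = begin-equality
      π * fromℕ 1 ⁻¹             ≈⟨ *-congˡ (*-identityˡ _) ⟨
      π * (1# * fromℕ 1 ⁻¹)      ≈⟨ *-congˡ (*-congʳ (+-identityʳ 1#)) ⟨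
      π * (fromℕ 1 * fromℕ 1 ⁻¹) ≈⟨ *-congˡ (⁻¹-inverse (pos⇒≉0 (fromℕ-pos 1))) ⟩
      π * 1#                     ≈⟨ *-identityʳ π ⟩
      π                          ∎

  B-cong : ∀ {β β′ γ γ′} → β ≈ᵛ β′ → γ ≈ᵛ γ′ → B β γ ≈ B β′ γ′
  B-cong β≈β′ γ≈γ′ = sum-cong-≋ λ i → sum-cong-≋ λ j → *-congʳ (*-cong (β≈β′ i) (γ≈γ′ j))

  B-sym : ∀ β γ → B β γ ≈ B γ β
  B-sym β γ = trans (∑-comm (λ i j → β i * γ j * gram (m i j)))
    (sum-cong-≋ λ j → sum-cong-≋ λ i → *-cong (*-comm (β i) (γ j)) (gram-sym i j))

  B-combination : ∀ x β y γ δ → B (combination x β y γ) δ ≈ x * B β δ + y * B γ δ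
  B-combination x β y γ δ = begin-equality
    sum (λ i → sum (λ j → (x * β i + y * γ i) * δ j * gram (m i j)))
      ≈⟨ sum-cong-≋ (λ i → sum-cong-≋ λ j →
           solve 6 (λ x b y c d g → (x :* b :+ y :* c) :* d :* g := x :* (b :* d :* g) :+ y :* (c :* d :* g)) refl
             x (β i) y (γ i) (δ j) (gram (m i j))) ⟩
    sum (λ i → sum (λ j → x * (β i * δ j * gram (m i j)) + y * (γ i * δ j * gram (m i j))))
      ≈⟨ sum-cong-≋ (λ i → sum-combination x (λ j → β i * δ j * gram (m i j)) y (λ j → γ i * δ j * gram (m i j))) ⟩
    sum (λ i → x * sum (λ j → β i * δ j * gram (m i j)) + y * sum (λ j → γ i * δ j * gram (m i j)))
      ≈⟨ sum-combination x (λ i → sum (λ j → β i * δ j * gram (m i j))) y (λ i → sum (λ j → γ i * δ j * gram (m i j))) ⟩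
    x * B β δ + y * B γ δ ∎

  B-α-α : ∀ i j → B (α i) (α j) ≈ gram (m i j)
  B-α-α i j = begin-equality
    sum (λ a → sum (λ b → α i a * α j b * gram (m a b)))
      ≈⟨ sum-cong-≋ (λ a → sum-single (λ b → α i a * α j b * gram (m a b)) j
           (λ b b≢j → trans (*-congʳ (trans (*-congˡ (α-offdiag b≢j)) (zeroʳ _))) (zeroˡ _))) ⟩
    sum (λ a → α i a * α j j * gram (m a j))
      ≈⟨ sum-single (λ a → α i a * α j j * gram (m a j)) i
           (λ a a≢i → trans (*-congʳ (trans (*-congʳ (α-offdiag a≢i)) (zeroˡ _))) (zeroˡ _)) ⟩
    α i i * α j j * gram (m i j)
      ≈⟨ *-congʳ (trans (*-cong (α-diag i) (α-diag j)) (*-identityʳ 1#)) ⟩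
    1# * gram (m i j)
      ≈⟨ *-identityˡ _ ⟩
    gram (m i j) ∎

  B-α-self : ∀ i → B (α i) (α i) ≈ 1#
  B-α-self i = trans (B-α-α i i) (gram-diag i)

  reflect≈combination : ∀ i β → reflect i β ≈ᵛ combination 1# β (- (fromℕ 2 * B β (α i))) (α i)
  reflect≈combination i β j = solve 3 (λ b t a → b :- t :* a := con (pos 1) :* b :+ :- t :* a) refl (β j) (fromℕ 2 * B β (α i)) (α i j)

  B-reflect : ∀ i β γ → B (reflect i β) γ ≈ B β γ - fromℕ 2 * B β (α i) * B (α i) γ
  B-reflect i β γ = begin-equality
    B (reflect i β) γ
      ≈⟨ B-cong (reflect≈combination i β) ≈ᵛ-refl ⟩
    B (combination 1# β (- (fromℕ 2 * B β (α i))) (α i)) γ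
      ≈⟨ B-combination 1# β (- (fromℕ 2 * B β (α i))) (α i) γ ⟩
    1# * B β γ + - (fromℕ 2 * B β (α i)) * B (α i) γ
      ≈⟨ solve 3 (λ b t a → con (pos 1) :* b :+ :- t :* a := b :- t :* a) refl (B β γ) (fromℕ 2 * B β (α i)) (B (α i) γ) ⟩
    B β γ - fromℕ 2 * B β (α i) * B (α i) γ ∎

  reflect-cong : ∀ i {β γ} → β ≈ᵛ γ → reflect i β ≈ᵛ reflect i γ
  reflect-cong i β≈γ j = +-cong (β≈γ j) (-‿cong (*-congʳ (*-congˡ (B-cong β≈γ (≈ᵛ-refl {α i})))))

  reflect-combination : ∀ i x β y γ → reflect i (combination x β y γ) ≈ᵛ combination x (reflect i β) y (reflect i γ)
  reflect-combination i x β y γ j = trans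
    (+-congˡ (-‿cong (*-congʳ (*-congˡ (B-combination x β y γ (α i))))))
    (solve 8 (λ x b y c t p q a → x :* b :+ y :* c :- t :* (x :* p :+ y :* q) :* a :=
        x :* (b :- t :* p :* a) :+ y :* (c :- t :* q :* a)) refl
      x (β j) y (γ j) (fromℕ 2) (B β (α i)) (B γ (α i)) (α i j))

  B-reflect-α : ∀ i β → B (reflect i β) (α i) ≈ - B β (α i)
  B-reflect-α i β = trans (B-reflect i β (α i)) (trans (+-congˡ (-‿cong (*-congˡ (B-α-self i))))
    (solve 1 (λ b → b :- (con (pos 1) :+ (con (pos 1) :+ con (pos 0))) :* b :* con (pos 1) := :- b) refl (B β (α i))))

  reflect-α : ∀ i → reflect i (α i) ≈ᵛ λ j → - α i j
  reflect-α i j = trans (+-congˡ (-‿cong (*-congʳ (*-congˡ (B-α-self i)))))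
    (solve 1 (λ a → a :- (con (pos 1) :+ (con (pos 1) :+ con (pos 0))) :* con (pos 1) :* a := :- a) refl (α i j))

  reflect-involutive : ∀ i β → reflect i (reflect i β) ≈ᵛ β
  reflect-involutive i β j = trans (+-congˡ (-‿cong (*-congʳ (*-congˡ (B-reflect-α i β)))))
    (solve 4 (λ b t p a → b :- t :* p :* a :- t :* (:- p) :* a := b) refl (β j) (fromℕ 2) (B β (α i)) (α i j))

  reflect-isometry : ∀ i β → B (reflect i β) (reflect i β) ≈ B β β
  reflect-isometry i β = begin-equality
    B sβ sβ
      ≈⟨ B-reflect i β sβ ⟩
    B β sβ - fromℕ 2 * p * B (α i) sβ
      ≈⟨ +-cong (trans (B-sym β sβ) (B-reflect i β β))
           (-‿cong (*-congˡ (trans (B-sym (α i) sβ) (B-reflect-α i β)))) ⟩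
    B β β - fromℕ 2 * p * B (α i) β - fromℕ 2 * p * - p
      ≈⟨ +-congʳ (+-congˡ (-‿cong (*-congˡ (B-sym (α i) β)))) ⟩
    B β β - fromℕ 2 * p * p - fromℕ 2 * p * - p
      ≈⟨ solve 3 (λ q t p → q :- t :* p :* p :- t :* p :* :- p := q) refl (B β β) (fromℕ 2) p ⟩
    B β β ∎
    where
    sβ = reflect i β
    p = B β (α i)

  -- Words act before the group does: only `act-∼` shows that the result depends on the group
  -- element alone.
  act : Word n → V → V
  act u β = foldr reflect β u

  act-cong : ∀ u {β γ} → β ≈ᵛ γ → act u β ≈ᵛ act u γ
  act-cong []      β≈γ = β≈γ
  act-cong (i ∷ u) β≈γ = reflect-cong i (act-cong u β≈γ)

  act-++ : ∀ u v β → act (u ++ v) β ≡ act u (act v β)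
  act-++ u v β = Listₚ.foldr-++ reflect β u v

  act-combination : ∀ u x β y γ → act u (combination x β y γ) ≈ᵛ combination x (act u β) y (act u γ)
  act-combination []      x β y γ = ≈ᵛ-refl
  act-combination (i ∷ u) x β y γ = ≈ᵛ-trans (reflect-cong i (act-combination u x β y γ))
    (reflect-combination i x (act u β) y (act u γ))

  act-neg : ∀ u β → act u (λ j → - β j) ≈ᵛ λ j → - act u β j
  act-neg u β = ≈ᵛ-trans (act-cong u (λ j → neg≈ (β j))) (≈ᵛ-trans (act-combination u (- 1#) β 0# β) (λ j → sym (neg≈ (act u β j))))
    where
    neg≈ : ∀ x → - x ≈ - 1# * x + 0# * x
    neg≈ x = solve 1 (λ x → :- x := :- con (pos 1) :* x :+ con (pos 0) :* x) refl x

  act-isometry : ∀ u β → B (act u β) (act u β) ≈ B β β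
  act-isometry []      β = refl
  act-isometry (i ∷ u) β = trans (reflect-isometry i (act u β)) (act-isometry u β)

  module Dihedral {c} (i j : Fin n) (gram≈-c : gram (m i j) ≈ - c) where

    gram-letter : ∀ k → gram (m (letter j i k) (letter i j k)) ≈ - c
    gram-letter zero          = trans (gram-sym j i) gram≈-c
    gram-letter (suc zero)    = gram≈-c
    gram-letter (suc (suc k)) = gram-letter k

    module _ (β : V) where
      μ : ℕ → V
      μ k = act (alternating j i k) β

      E F : ℕ → Carrier
      E k = B (μ k) (α (letter j i k))
      F k = B (μ k) (α (letter i j k))

      -- `E` pairs with the simple root of the next letter, `F` with the other one. Since the
      -- letters alternate, each reflection sends `(E , F)` to `(F + 2c E , - E)`; the powers of
      -- this matrix have entries in `U c`.
      E-F : ∀ k → E k ≈ U c (suc k) * E 0 + U c k * F 0 ×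
                  F k ≈ - U c k * E 0 + (U c (suc k) - (c + c) * U c k) * F 0
      E-F zero = solve 2 (λ e f → e := con (pos 1) :* e :+ con (pos 0) :* f) refl (E 0) (F 0) ,
        solve 3 (λ c e f → f := :- con (pos 0) :* e :+ (con (pos 1) :- (c :+ c) :* con (pos 0)) :* f) refl c (E 0) (F 0)
      E-F (suc k) = (begin-equality
          E (suc k)
            ≈⟨ B-reflect (letter j i k) (μ k) (α (letter i j k)) ⟩
          F k - fromℕ 2 * E k * B (α (letter j i k)) (α (letter i j k))
            ≈⟨ +-congˡ (-‿cong (*-congˡ (trans (B-α-α (letter j i k) (letter i j k)) (gram-letter k)))) ⟩
          F k - fromℕ 2 * E k * - c
            ≈⟨ +-cong (proj₂ (E-F k)) (-‿cong (*-congʳ (*-congˡ (proj₁ (E-F k))))) ⟩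
          - u₀ * E 0 + (u₁ - (c + c) * u₀) * F 0 - fromℕ 2 * (u₁ * E 0 + u₀ * F 0) * - c
            ≈⟨ solve 5 (λ c u₀ u₁ e f → :- u₀ :* e :+ (u₁ :- (c :+ c) :* u₀) :* f :- (con (pos 1) :+ (con (pos 1) :+ con (pos 0))) :* (u₁ :* e :+ u₀ :* f) :* :- c
                 := (c :* u₁ :+ c :* u₁ :- u₀) :* e :+ u₁ :* f) refl c u₀ u₁ (E 0) (F 0) ⟩
          U c (suc (suc k)) * E 0 + u₁ * F 0 ∎) ,
        (begin-equality
          F (suc k)
            ≈⟨ B-reflect-α (letter j i k) (μ k) ⟩
          - E k
            ≈⟨ -‿cong (proj₁ (E-F k)) ⟩
          - (u₁ * E 0 + u₀ * F 0)
            ≈⟨ solve 5 (λ c u₀ u₁ e f → :- (u₁ :* e :+ u₀ :* f) :=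
                 :- u₁ :* e :+ ((c :* u₁ :+ c :* u₁ :- u₀) :- (c :+ c) :* u₁) :* f) refl c u₀ u₁ (E 0) (F 0) ⟩
          - u₁ * E 0 + (U c (suc (suc k)) - (c + c) * u₁) * F 0 ∎)
        where
        u₀ = U c k
        u₁ = U c (suc k)

      displacement : ∀ k → ∃₂ λ x y → μ k ≈ᵛ λ l → β l + (x * α i l + y * α j l)
      displacement zero = 0# , 0# , λ l → solve 3 (λ b p q → b := b :+ (con (pos 0) :* p :+ con (pos 0) :* q)) refl (β l) (α i l) (α j l)
      displacement (suc k) with letter-cases j i k | displacement k
      ... | inj₁ ≡j | x , y , μ≈ = x , y - t , λ l → trans (+-cong (μ≈ l) (-‿cong (*-congˡ (reflexive (≡.cong (λ a → α a l) ≡j)))))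
          (solve 6 (λ b x p y t q → b :+ (x :* p :+ y :* q) :- t :* q := b :+ (x :* p :+ (y :- t) :* q)) refl (β l) x (α i l) y t (α j l))
        where t = fromℕ 2 * E k
      ... | inj₂ ≡i | x , y , μ≈ = x - t , y , λ l → trans (+-cong (μ≈ l) (-‿cong (*-congˡ (reflexive (≡.cong (λ a → α a l) ≡i)))))
          (solve 6 (λ b x p y t q → b :+ (x :* p :+ y :* q) :- t :* p := b :+ ((x :- t) :* p :+ y :* q)) refl (β l) x (α i l) y t (α j l))
        where t = fromℕ 2 * E k

      B-displacement : ∀ {k x y} → μ k ≈ᵛ (λ l → β l + (x * α i l + y * α j l)) → ∀ γ →
                       B (μ k) γ ≈ B β γ + (x * B (α i) γ + y * B (α j) γ)
      B-displacement {k} {x} {y} μ≈ γ = begin-equality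
        B (μ k) γ
          ≈⟨ B-cong {μ k} (λ l → trans (μ≈ l) (sym (+-cong (*-identityˡ (β l)) (*-identityˡ _)))) (≈ᵛ-refl {γ}) ⟩
        B (combination 1# β 1# (combination x (α i) y (α j))) γ
          ≈⟨ B-combination 1# β 1# (combination x (α i) y (α j)) γ ⟩
        1# * B β γ + 1# * B (combination x (α i) y (α j)) γ
          ≈⟨ +-cong (*-identityˡ _) (trans (*-identityˡ _) (B-combination x (α i) y (α j) γ)) ⟩
        B β γ + (x * B (α i) γ + y * B (α j) γ) ∎

      -- The displacement is orthogonal to α i and α j, whose Gram determinant 1 - c² is nonzero.
      rotation-trivial : ∀ {M} → U c (M ℕ.+ M) ≈ 0# → U c (suc (M ℕ.+ M)) ≈ 1# → c * c ≉ 1# → μ (M ℕ.+ M) ≈ᵛ β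
      rotation-trivial {M} U≈0 U≈1 c²≉1 = conclusion (displacement (M ℕ.+ M))
        where
        K = M ℕ.+ M
        E-period : B (μ K) (α j) ≈ B β (α j)
        E-period = begin-equality
          B (μ K) (α j)                   ≡⟨ ≡.cong (λ a → B (μ K) (α a)) (letter-even j i M) ⟨
          E K                             ≈⟨ proj₁ (E-F K) ⟩
          U c (suc K) * E 0 + U c K * F 0 ≈⟨ +-cong (*-congʳ U≈1) (*-congʳ U≈0) ⟩
          1# * E 0 + 0# * F 0             ≈⟨ solve 2 (λ e f → con (pos 1) :* e :+ con (pos 0) :* f := e) refl (E 0) (F 0) ⟩
          E 0                             ∎
        F-period : B (μ K) (α i) ≈ B β (α i)
        F-period = begin-equality
          B (μ K) (α i)                   ≡⟨ ≡.cong (λ a → B (μ K) (α a)) (letter-even i j M) ⟨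
          F K                             ≈⟨ proj₂ (E-F K) ⟩
          - U c K * E 0 + (U c (suc K) - (c + c) * U c K) * F 0
            ≈⟨ +-cong (*-congʳ (-‿cong U≈0)) (*-congʳ (+-cong U≈1 (-‿cong (*-congˡ U≈0)))) ⟩
          - 0# * E 0 + (1# - (c + c) * 0#) * F 0
            ≈⟨ solve 3 (λ c e f → :- con (pos 0) :* e :+ (con (pos 1) :- (c :+ c) :* con (pos 0)) :* f := f) refl c (E 0) (F 0) ⟩
          F 0                             ∎
        conclusion : (∃₂ λ x y → μ K ≈ᵛ λ l → β l + (x * α i l + y * α j l)) → μ K ≈ᵛ β
        conclusion (x , y , μ≈) l = trans (μ≈ l) (trans (+-congˡ (+-cong (trans (*-congʳ x≈0) (zeroˡ _)) (trans (*-congʳ y≈0) (zeroˡ _))))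
            (solve 1 (λ b → b :+ (con (pos 0) :+ con (pos 0)) := b) refl (β l)))
          where
          orthogonal : ∀ {γ} → B (μ K) γ ≈ B β γ → x * B (α i) γ + y * B (α j) γ ≈ 0#
          orthogonal {γ} Bμ≈Bβ = begin-equality
            D                    ≈⟨ solve 2 (λ b d → d := (b :+ d) :- b) refl (B β γ) D ⟩
            B β γ + D - B β γ    ≈⟨ +-congʳ (B-displacement {K} μ≈ γ) ⟨
            B (μ K) γ - B β γ    ≈⟨ +-congʳ Bμ≈Bβ ⟩
            B β γ - B β γ        ≈⟨ -‿inverseʳ _ ⟩
            0#                   ∎
            where D = x * B (α i) γ + y * B (α j) γ
          y-cx≈0 : x * - c + y * 1# ≈ 0#
          y-cx≈0 = trans (sym (+-cong (*-congˡ (trans (B-α-α i j) gram≈-c)) (*-congˡ (B-α-self j)))) (orthogonal E-period)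
          x-cy≈0 : x * 1# + y * - c ≈ 0#
          x-cy≈0 = trans (sym (+-cong (*-congˡ (B-α-self i)) (*-congˡ (trans (B-α-α j i) (trans (gram-sym j i) gram≈-c))))) (orthogonal F-period)
          1-c²≉0 : 1# - c * c ≉ 0#
          1-c²≉0 1-c²≈0 = c²≉1 (begin-equality
            c * c                   ≈⟨ solve 1 (λ c → c :* c := con (pos 1) :- (con (pos 1) :- c :* c)) refl c ⟩
            1# - (1# - c * c)       ≈⟨ +-congˡ (-‿cong 1-c²≈0) ⟩
            1# - 0#                 ≈⟨ solve 0 (con (pos 1) :- con (pos 0) := con (pos 1)) refl ⟩
            1#                      ∎)
          x≈0 : x ≈ 0#
          x≈0 = x*y≈0⇒y≈0 1-c²≉0 (begin-equality
            (1# - c * c) * x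
              ≈⟨ solve 3 (λ c x y → (con (pos 1) :- c :* c) :* x := (x :* con (pos 1) :+ y :* :- c) :+ c :* (x :* :- c :+ y :* con (pos 1))) refl c x y ⟩
            (x * 1# + y * - c) + c * (x * - c + y * 1#)
              ≈⟨ +-cong x-cy≈0 (*-congˡ y-cx≈0) ⟩
            0# + c * 0#
              ≈⟨ solve 1 (λ c → con (pos 0) :+ c :* con (pos 0) := con (pos 0)) refl c ⟩
            0# ∎)
          y≈0 : y ≈ 0#
          y≈0 = x*y≈0⇒y≈0 1-c²≉0 (begin-equality
            (1# - c * c) * y
              ≈⟨ solve 3 (λ c x y → (con (pos 1) :- c :* c) :* y := (x :* :- c :+ y :* con (pos 1)) :+ c :* (x :* con (pos 1) :+ y :* :- c)) refl c x y ⟩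
            (x * - c + y * 1#) + c * (x * 1# + y * - c)
              ≈⟨ +-cong y-cx≈0 (*-congˡ x-cy≈0) ⟩
            0# + c * 0#
              ≈⟨ solve 1 (λ c → con (pos 0) :+ c :* con (pos 0) := con (pos 0)) refl c ⟩
            0# ∎)

    -- In the plane of `α i` and `α j` the coordinates are consecutive Chebyshev values, so
    -- positivity of the image of `α i` is positivity of these values.
    alternating-α : ∀ k → act (alternating j i k) (α i) ≈ᵛ combination (U c k) (α (letter j i k)) (U c (suc k)) (α (letter i j k))
    alternating-α zero    l = solve 2 (λ a b → a := con (pos 0) :* b :+ con (pos 1) :* a) refl (α i l) (α j l)
    alternating-α (suc k) l = begin-equality
      reflect a (act (alternating j i k) (α i)) l
        ≈⟨ reflect-cong a (alternating-α k) l ⟩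
      reflect a (combination u₀ (α a) u₁ (α b)) l
        ≈⟨ reflect-combination a u₀ (α a) u₁ (α b) l ⟩
      u₀ * reflect a (α a) l + u₁ * (α b l - fromℕ 2 * B (α b) (α a) * α a l)
        ≈⟨ +-cong (*-congˡ (reflect-α a l)) (*-congˡ (+-congˡ (-‿cong (*-congʳ (*-congˡ
             (trans (B-sym (α b) (α a)) (trans (B-α-α a b) (gram-letter k)))))))) ⟩
      u₀ * - α a l + u₁ * (α b l - fromℕ 2 * - c * α a l)
        ≈⟨ solve 5 (λ u₀ u₁ c p q → u₀ :* :- p :+ u₁ :* (q :- (con (pos 1) :+ (con (pos 1) :+ con (pos 0))) :* :- c :* p)
             := u₁ :* q :+ (c :* u₁ :+ c :* u₁ :- u₀) :* p) refl u₀ u₁ c (α a l) (α b l) ⟩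
      u₁ * α b l + U c (suc (suc k)) * α a l ∎
      where
      a = letter j i k
      b = letter i j k
      u₀ = U c k
      u₁ = U c (suc k)

  act-relator : ∀ {i j k} → m i j ≡ finite k → ∀ β → act (concat (replicate k (i ∷ j ∷ []))) β ≈ᵛ β
  act-relator {i} {j} {k} mij≡k β with i ≟ j
  ... | yes ≡.refl = involutions k
    where
    involutions : ∀ k → act (concat (replicate k (i ∷ i ∷ []))) β ≈ᵛ β
    involutions zero    = ≈ᵛ-refl
    involutions (suc k) = ≈ᵛ-trans (reflect-involutive i _) (involutions k)
  ... | no i≢j = ≡.subst (λ u → act u β ≈ᵛ β) (alternating-even j i k)
    (Dihedral.rotation-trivial {c} i j (reflexive (≡.cong gram mij≡k)) β {k} U-2M U-2M+1 c²≉1)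
    where open Angle k (m-offdiag i≢j mij≡k)

  act-∼ : ∀ {u v} → u ∼ v → ∀ β → act u β ≈ᵛ act v β
  act-∼ (relator mij≡k) β = act-relator mij≡k β
  act-∼ ∼-refl          β = ≈ᵛ-refl
  act-∼ (∼-sym p)       β = ≈ᵛ-sym (act-∼ p β)
  act-∼ (∼-trans p q)   β = ≈ᵛ-trans (act-∼ p β) (act-∼ q β)
  act-∼ (++-cong {u} {u′} {v} {v′} p q) β =
    ≡.subst₂ _≈ᵛ_ (≡.sym (act-++ u v β)) (≡.sym (act-++ u′ v′ β))
      (≈ᵛ-trans (act-cong u (act-∼ q β)) (act-∼ p (act v′ β)))

  -- Treats finite and infinite labels alike. The condition on `k` is vacuous for `∞`, where `c = 1`
  -- and all values are nonnegative.
  dihedral-U-nonNeg : ∀ {i j} → i ≢ j → ∃[ c ] gram (m i j) ≈ - c ×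
             (∀ {k} → (∀ {M} → m i j ≡ finite M → k ℕ.≤ M) → 0# ≤ U c k)
  dihedral-U-nonNeg {i} {j} i≢j with m i j in mij
  ... | finite M = c , refl , λ k≤ → U-nonNeg (k≤ ≡.refl)
    where open Angle M (m-offdiag i≢j mij)
  ... | ∞        = 1# , refl , λ {k} _ → U-1-nonNeg k refl

  NonNeg : V → Set
  NonNeg β = ∀ i → 0# ≤ β i

  NonNeg-cong : ∀ {β γ} → β ≈ᵛ γ → NonNeg β → NonNeg γ
  NonNeg-cong β≈γ 0≤β i = ≤-trans (0≤β i) (≤-reflexive (β≈γ i))

  NonNeg-combination : ∀ {x β y γ} → 0# ≤ x → NonNeg β → 0# ≤ y → NonNeg γ → NonNeg (combination x β y γ)
  NonNeg-combination 0≤x 0≤β 0≤y 0≤γ i = +-nonNeg (*-nonNeg 0≤x (0≤β i)) (*-nonNeg 0≤y (0≤γ i))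

  NonNeg-α : ∀ i → NonNeg (α i)
  NonNeg-α i j with i ≟ j
  ... | yes _ = 0≤1
  ... | no  _ = ≤-refl

-- Tits' theorem on the signs of roots.

module RootSigns (lem : ExcludedMiddle 0ℓ) (ℝ : Reals) {n} (C : CoxeterSystem n) where
  open Billiards lem ℝ C using (V; _≈ᵛ_; α; B)
  open CoxeterSystem C using (m)
  open CoxeterWords lem C
  open Representation lem ℝ C
  open Reals ℝ using (completeOrderedField)
  open OrderedField lem completeOrderedField
  open Chebyshev lem completeOrderedField

  PositiveBelow : ℕ → Set
  PositiveBelow N = ∀ u i → length u ℕ.< N → Reduced (u ++ i ∷ []) → NonNeg (act u (α i))

  -- Write u = v · (alternating word in i and j ending in j) with v as short as possible.
  -- Then v α i and v α j are nonnegative by induction, and the dihedral coefficients are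
  -- values of Chebyshev polynomials in the range where these are nonnegative.
  module Step {u i j} (i≢j : i ≢ j) (red : Reduced (u ++ i ∷ [])) (below : PositiveBelow (length u)) where

    -- `N` only bounds the recursion. The first letter of the alternating part cannot end `v`; if
    -- the other of the two letters can, it moves from `v` into the alternating part.
    positive : ∀ N v k → length v ℕ.≤ N → v ++ alternating j i (suc k) ∼ u → length v ℕ.+ suc k ℕ.≤ length u →
               NonNeg (act u (α i))
    positive N v k v≤N v-alt∼u len with reduced-or-descent v (letter i j k) | reduced-or-descent v (letter j i k)
    positive N v k v≤N v-alt∼u len | _ | inj₂ (w , wx∼v , w<v) = contradiction w<v (no-descent red v k v-alt∼u len w wx∼v)
    positive zero    v k v≤N v-alt∼u len | inj₂ (w , wx∼v , w<v) | inj₁ _ = contradiction (ℕₚ.≤-trans w<v v≤N) λ ()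
    positive (suc N) v k v≤N v-alt∼u len | inj₂ (w , wx∼v , w<v) | inj₁ _ =
      positive N w (suc k) (ℕ.s≤s⁻¹ (ℕₚ.≤-trans w<v v≤N))
        (∼-trans (≡⇒∼ (≡.sym (Listₚ.++-assoc w (letter i j k ∷ []) _))) (∼-trans (++-cong wx∼v ∼-refl) v-alt∼u))
        (ℕₚ.≤-trans (ℕₚ.≤-reflexive (ℕₚ.+-suc (length w) (suc k))) (ℕₚ.≤-trans (ℕₚ.+-monoˡ-≤ (suc k) w<v) len))
    positive N v k v≤N v-alt∼u len | inj₁ red-y | inj₁ red-x = NonNeg-cong (≈ᵛ-sym u-α) combined
      where
      v<u : length v ℕ.< length u
      v<u = ℕₚ.≤-trans (ℕₚ.≤-trans (ℕₚ.≤-reflexive (ℕₚ.+-comm 1 (length v))) (ℕₚ.+-monoʳ-≤ (length v) (ℕ.s≤s ℕ.z≤n))) len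
      c = proj₁ (dihedral-U-nonNeg i≢j)
      gram≈-c = proj₁ (proj₂ (dihedral-U-nonNeg i≢j))
      nonNeg = proj₂ (proj₂ (dihedral-U-nonNeg i≢j))
      short : ∀ {M} → m i j ≡ finite M → suc (suc k) ℕ.≤ M
      short = alternating-short i≢j red v (suc k) v-alt∼u len
      vy = act v (α (letter i j k))
      vx = act v (α (letter j i k))
      u-α : act u (α i) ≈ᵛ combination (U c (suc k)) vy (U c (suc (suc k))) vx
      u-α = ≈ᵛ-trans (act-∼ (∼-sym v-alt∼u) (α i))
        (≡.subst (_≈ᵛ combination (U c (suc k)) vy (U c (suc (suc k))) vx) (≡.sym (act-++ v (alternating j i (suc k)) (α i)))
          (≈ᵛ-trans (act-cong v (Dihedral.alternating-α {c} i j gram≈-c (suc k)))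
            (act-combination v (U c (suc k)) _ (U c (suc (suc k))) _)))
      combined : NonNeg (combination (U c (suc k)) vy (U c (suc (suc k))) vx)
      combined = NonNeg-combination
        (nonNeg {suc k} (λ eq → ℕₚ.<⇒≤ (short eq))) (below v (letter i j k) v<u red-y)
        (nonNeg {suc (suc k)} short) (below v (letter j i k) v<u red-x)

  positive-below : ∀ N → PositiveBelow N
  positive-below (suc N) u i (ℕ.s≤s u≤N) red with initLast u
  ... | []       = NonNeg-α i
  -- The last letter alone is the alternating word of length one, whence `k = 0`.
  ... | v ∷ʳ′ j  = Step.positive {v ++ j ∷ []} {i} {j} i≢j red below (length v) v 0 ℕₚ.≤-refl ∼-refl
                     (ℕₚ.≤-reflexive (≡.sym (Listₚ.length-++ v)))
    where
    i≢j : i ≢ j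
    i≢j ≡.refl = ℕₚ.<⇒≱ (ℕₚ.≤-trans (ℕₚ.n≤1+n _) (ℕₚ.≤-reflexive (≡.sym (≡.trans (length-∷ʳ (v ++ i ∷ [])) (≡.cong suc (length-∷ʳ v))))))
      (red v (∼-sym (∷ʳ-cancel v i)))
    below : PositiveBelow (length (v ++ j ∷ []))
    below w l w<u = positive-below N w l (ℕₚ.<-≤-trans w<u u≤N)

  reduced⇒nonNeg : ∀ {u i} → Reduced (u ++ i ∷ []) → NonNeg (act u (α i))
  reduced⇒nonNeg {u} {i} = positive-below (suc (length u)) u i ℕₚ.≤-refl

  NonPos : V → Set
  NonPos β = ∀ i → β i ≤ 0#

  act-∷ʳ-α : ∀ u i → act (u ++ i ∷ []) (α i) ≈ᵛ λ l → - act u (α i) l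
  act-∷ʳ-α u i = ≡.subst (_≈ᵛ λ l → - act u (α i) l) (≡.sym (act-++ u (i ∷ []) (α i)))
    (≈ᵛ-trans (act-cong u (reflect-α i)) (act-neg u (α i)))

  NonNeg⇒neg-NonPos : ∀ {β γ} → γ ≈ᵛ (λ l → - β l) → NonNeg β → NonPos γ
  NonNeg⇒neg-NonPos γ≈-β 0≤β l = ≤-trans (≤-reflexive (γ≈-β l)) (≤-trans (-‿anti-≤ (0≤β l)) (≤-reflexive -0#≈0#))

  reduced⇒nonPos : ∀ {u i} → Reduced (u ++ i ∷ []) → NonPos (act (u ++ i ∷ []) (α i))
  reduced⇒nonPos {u} {i} red = NonNeg⇒neg-NonPos (act-∷ʳ-α u i) (reduced⇒nonNeg red)

  -- Let `v` be a reduced spelling of `u`. Either `v i` is reduced and the root is nonnegative, or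
  -- `v` can be rewritten to end in `i`, and removing that letter changes the sign.
  root-sign : ∀ u i → NonNeg (act u (α i)) ⊎ NonPos (act u (α i))
  root-sign u i with reduce u
  ... | v , v∼u , red with reduced-or-descent v i
  ...   | inj₁ red-vi = inj₁ (NonNeg-cong (act-∼ v∼u (α i)) (reduced⇒nonNeg red-vi))
  ...   | inj₂ (w , wi∼v , w<v) = inj₂ λ l → ≤-trans
            (≤-reflexive (act-∼ (∼-trans (∼-sym v∼u) (∼-sym wi∼v)) (α i) l))
            (reduced⇒nonPos (reduced-resp wi∼v (ℕₚ.≤-trans (ℕₚ.≤-reflexive (length-∷ʳ w)) w<v) red) l)

  -- A vector with both signs is zero, but `B` takes the value 1 on a root; so the two cases of
  -- `root-sign` exclude each other.
  unit-not-NonNeg-NonPos : ∀ {β} → B β β ≈ 1# → NonNeg β → ¬ NonPos β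
  unit-not-NonNeg-NonPos {β} Bββ≈1 0≤β β≤0 = 0≉1 (begin-equality
    0#                               ≈⟨ solve 1 (λ b → con (pos 0) := con (pos 0) :* b :+ con (pos 0) :* b) refl (B β β) ⟩
    0# * B β β + 0# * B β β          ≈⟨ B-combination 0# β 0# β β ⟨
    B (combination 0# β 0# β) β      ≈⟨ B-cong (λ l → trans (solve 1 (λ b → con (pos 0) :* b :+ con (pos 0) :* b := con (pos 0)) refl (β l)) (antisym (0≤β l) (β≤0 l))) (≈ᵛ-refl {β}) ⟩
    B β β                            ≈⟨ Bββ≈1 ⟩
    1#                               ∎)

-- Half-spaces, walls and distances in the group.

module Roots (lem : ExcludedMiddle 0ℓ) (ℝ : Reals) {n} (C : CoxeterSystem n) where
  open Billiards lem ℝ C hiding (module R)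
  open CoxeterSystem C using (_∙_; ε; s; word; eval; eval-word; presentation; group; ∙-cong; ∙-congˡ; ∙-congʳ; assoc; identityˡ; identityʳ; inverseˡ; inverseʳ)
    renaming (Carrier to W; _≈_ to _≈ʷ_; _⁻¹ to _⁻¹ʷ; setoid to W-setoid; refl to ≈ʷ-refl; sym to ≈ʷ-sym; trans to ≈ʷ-trans)
  open GroupProperties group using (//-rightDividesˡ)
  open CoxeterWords lem C
  open Representation lem ℝ C
  open RootSigns lem ℝ C
  open Reals ℝ using (completeOrderedField)
  open OrderedField lem completeOrderedField

  -- The presentation turns equality in `W` into `∼`, under which the action is invariant. So any
  -- spelling may replace the chosen one.
  act≈· : ∀ {u w} → eval u ≈ʷ w → ∀ β → act u β ≈ᵛ w · β
  act≈· {u} {w} u≈w = act-∼ {u} {word w} (presentation {u} {word w} (≈ʷ-trans u≈w (≈ʷ-sym (eval-word w))))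

  ·-congʳ : ∀ w {β γ} → β ≈ᵛ γ → w · β ≈ᵛ w · γ
  ·-congʳ w = act-cong (word w)

  ·-congˡ : ∀ {w w′} → w ≈ʷ w′ → ∀ β → w · β ≈ᵛ w′ · β
  ·-congˡ {w} {w′} w≈w′ = act≈· {word w} {w′} (≈ʷ-trans (eval-word w) w≈w′)

  ·-∙ : ∀ w w′ β → (w ∙ w′) · β ≈ᵛ w · (w′ · β)
  ·-∙ w w′ β = ≡.subst ((w ∙ w′) · β ≈ᵛ_) (act-++ (word w) (word w′) β)
    (≈ᵛ-sym (act≈· {word w ++ word w′} {w ∙ w′} (≈ʷ-trans (eval-++ (word w) (word w′)) (∙-cong (eval-word w) (eval-word w′))) β))

  ·-ε : ∀ β → ε · β ≈ᵛ β
  ·-ε β = ≈ᵛ-sym (act≈· {[]} {ε} ≈ʷ-refl β)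

  ·-s : ∀ i w β → (s i ∙ w) · β ≈ᵛ reflect i (w · β)
  ·-s i w β = ≈ᵛ-sym (act≈· {i ∷ word w} {s i ∙ w} (∙-congˡ (eval-word w)) β)

  ⁻¹-·-· : ∀ w β → (w ⁻¹ʷ) · (w · β) ≈ᵛ β
  ⁻¹-·-· w β = ≈ᵛ-trans (≈ᵛ-sym (·-∙ (w ⁻¹ʷ) w β)) (≈ᵛ-trans (·-congˡ (inverseˡ w) β) (·-ε β))

  ·-⁻¹-· : ∀ w β → w · (w ⁻¹ʷ) · β ≈ᵛ β
  ·-⁻¹-· w β = ≈ᵛ-trans (≈ᵛ-sym (·-∙ w (w ⁻¹ʷ) β)) (≈ᵛ-trans (·-congˡ (inverseʳ w) β) (·-ε β))

  ·-neg : ∀ w β → w · (λ j → - β j) ≈ᵛ λ j → - (w · β) j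
  ·-neg w = act-neg (word w)

  Φ-cong : ∀ {β γ} → β ≈ᵛ γ → β ∈ Φ → γ ∈ Φ
  Φ-cong β≈γ (w , i , β≈) = w , i , ≈ᵛ-trans (≈ᵛ-sym β≈γ) β≈

  Φ-· : ∀ w {β} → β ∈ Φ → w · β ∈ Φ
  Φ-· w (w′ , i , β≈) = w ∙ w′ , i , ≈ᵛ-trans (·-congʳ w β≈) (≈ᵛ-sym (·-∙ w w′ (α i)))

  α∈Φ : ∀ i → α i ∈ Φ
  α∈Φ i = ε , i , ≈ᵛ-sym (·-ε (α i))

  Φ-reflect : ∀ i {β} → β ∈ Φ → reflect i β ∈ Φ
  Φ-reflect i {β} β∈Φ = Φ-cong (≈ᵛ-trans (·-s i ε β) (reflect-cong i (·-ε β))) (Φ-· (s i ∙ ε) β∈Φ)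

  α∈Φ⁺ : ∀ i → α i ∈ Φ⁺
  α∈Φ⁺ i = α∈Φ i , NonNeg-α i

  Φ⁺-cong : ∀ {β γ} → β ≈ᵛ γ → β ∈ Φ⁺ → γ ∈ Φ⁺
  Φ⁺-cong β≈γ (β∈Φ , 0≤β) = Φ-cong β≈γ β∈Φ , NonNeg-cong β≈γ 0≤β

  Φ-sign : ∀ {β} → β ∈ Φ → NonNeg β ⊎ NonPos β
  Φ-sign (w , i , β≈) = Sum.map (NonNeg-cong (≈ᵛ-sym β≈)) (λ ≤0 l → ≤-trans (≤-reflexive (β≈ l)) (≤0 l)) (root-sign (word w) i)

  Φ-unit : ∀ {β} → β ∈ Φ → B β β ≈ 1#
  Φ-unit (w , i , β≈) = trans (B-cong β≈ β≈) (trans (act-isometry (word w) (α i)) (B-α-self i))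

  ∉Φ⁺⇒NonPos : ∀ {β} → β ∈ Φ → β ∉ Φ⁺ → NonPos β
  ∉Φ⁺⇒NonPos β∈Φ β∉Φ⁺ = [ (λ 0≤β → contradiction (β∈Φ , 0≤β) β∉Φ⁺) , id ]′ (Φ-sign β∈Φ)

  NonPos⇒∉Φ⁺ : ∀ {β} → NonPos β → β ∉ Φ⁺
  NonPos⇒∉Φ⁺ β≤0 (β∈Φ , 0≤β) = unit-not-NonNeg-NonPos (Φ-unit β∈Φ) 0≤β β≤0

  -α∉Φ⁺ : ∀ i → (λ j → - α i j) ∉ Φ⁺
  -α∉Φ⁺ i = NonPos⇒∉Φ⁺ (NonNeg⇒neg-NonPos ≈ᵛ-refl (NonNeg-α i))

  -- Only the i-th coordinate changes under s i, so β is a multiple of α i, and both are unit vectors.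
  reflect-leaves-Φ⁺ : ∀ {i β} → β ∈ Φ⁺ → reflect i β ∉ Φ⁺ → β ≈ᵛ α i
  reflect-leaves-Φ⁺ {i} {β} (β∈Φ , 0≤β) sβ∉Φ⁺ j = trans (β≈βᵢα j) (trans (*-congʳ βᵢ≈1) (*-identityˡ (α i j)))
    where
    sβ≤0 : NonPos (reflect i β)
    sβ≤0 = ∉Φ⁺⇒NonPos (Φ-reflect i β∈Φ) sβ∉Φ⁺
    x = β i
    t = fromℕ 2 * B β (α i)
    off : ∀ {j} → j ≢ i → β j ≈ 0#
    off {j} j≢i = antisym (≤-trans (≤-reflexive (sym fixed)) (sβ≤0 j)) (0≤β j)
      where
      fixed : β j - t * α i j ≈ β j
      fixed = trans (+-congˡ (-‿cong (*-congˡ (α-offdiag j≢i)))) (solve 2 (λ b t → b :- t :* con (pos 0) := b) refl (β j) t)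
    β≈βᵢα : β ≈ᵛ λ j → x * α i j
    β≈βᵢα j with j ≟ i
    ... | yes ≡.refl = sym (trans (*-congˡ (α-diag i)) (*-identityʳ x))
    ... | no  j≢i    = trans (off j≢i) (sym (trans (*-congˡ (α-offdiag j≢i)) (zeroʳ x)))
    xx≈1 : x * x ≈ 1#
    xx≈1 = begin-equality
      x * x                                       ≈⟨ solve 1 (λ x → x :* x := x :* (x :* con (pos 1) :+ con (pos 0) :* con (pos 1)) :+ con (pos 0) :* (x :* con (pos 1) :+ con (pos 0) :* con (pos 1))) refl x ⟩
      x * (x * 1# + 0# * 1#) + 0# * (x * 1# + 0# * 1#)
        ≈⟨ +-cong (*-congˡ αγ) (*-congˡ αγ) ⟨
      x * B (α i) γ + 0# * B (α i) γ              ≈⟨ B-combination x (α i) 0# (α i) γ ⟨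
      B γ γ                                       ≈⟨ B-cong γ≈β γ≈β ⟩
      B β β                                       ≈⟨ Φ-unit β∈Φ ⟩
      1#                                          ∎
      where
      γ = combination x (α i) 0# (α i)
      γ≈β : γ ≈ᵛ β
      γ≈β j = trans (solve 2 (λ x a → x :* a :+ con (pos 0) :* a := x :* a) refl x (α i j)) (sym (β≈βᵢα j))
      αγ : B (α i) γ ≈ x * 1# + 0# * 1#
      αγ = trans (B-sym (α i) γ) (trans (B-combination x (α i) 0# (α i) (α i)) (+-cong (*-congˡ (B-α-self i)) (*-congˡ (B-α-self i))))
    βᵢ≈1 : x ≈ 1#
    βᵢ≈1 = begin-equality
      x               ≈⟨ solve 1 (λ x → x := (x :- con (pos 1)) :+ con (pos 1)) refl x ⟩
      x - 1# + 1#     ≈⟨ +-congʳ (x*y≈0⇒y≈0 (pos⇒≉0 (+-pos 0<1 (0≤β i))) (begin-equality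
        (1# + x) * (x - 1#)  ≈⟨ solve 1 (λ x → (con (pos 1) :+ x) :* (x :- con (pos 1)) := x :* x :- con (pos 1)) refl x ⟩
        x * x - 1#           ≈⟨ +-congʳ xx≈1 ⟩
        1# - 1#              ≈⟨ -‿inverseʳ 1# ⟩
        0#                   ∎)) ⟩
      0# + 1#         ≈⟨ +-identityˡ 1# ⟩
      1#              ∎

  H⁺-congˡ : ∀ {β γ w} → β ≈ᵛ γ → w ∈ H⁺ β → w ∈ H⁺ γ
  H⁺-congˡ {w = w} β≈γ = Φ⁺-cong (·-congʳ w β≈γ)

  H⁺-congʳ : ∀ {β w w′} → w ≈ʷ w′ → w ∈ H⁺ β → w′ ∈ H⁺ β
  H⁺-congʳ {β} w≈w′ = Φ⁺-cong (·-congˡ w≈w′ β)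

  -- The reflection `s i` makes no positive root but `α i` negative, so `u · β` must be `α i`: a
  -- step from `u` to `s i ∙ u` leaves just one half-space.
  crossing : ∀ {β i u} → u ∈ H⁺ β → s i ∙ u ∉ H⁺ β → β ≈ᵛ (u ⁻¹ʷ) · α i
  crossing {β} {i} {u} u∈ su∉ = ≈ᵛ-trans (≈ᵛ-sym (⁻¹-·-· u β))
    (·-congʳ (u ⁻¹ʷ) (reflect-leaves-Φ⁺ {i} {u · β} u∈ (su∉ ∘ Φ⁺-cong (≈ᵛ-sym (·-s i u β)))))

  -- The last letter of a reduced spelling serves.
  descent : ∀ {w} → ¬ (w ≈ʷ ε) → ∃[ i ] w · α i ∉ Φ⁺
  descent {w} w≉ε with reduce (word w)
  ... | v , v∼w , red with initLast v
  ...   | []      = contradiction (≈ʷ-trans (≈ʷ-sym (eval-word w)) (≈ʷ-sym (∼⇒eval v∼w))) w≉ε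
  ...   | u ∷ʳ′ i = i , NonPos⇒∉Φ⁺ λ l → ≤-trans (≤-reflexive (sym (act-∼ v∼w (α i) l))) (reduced⇒nonPos red l)

  crossings : Word n → W → List V
  crossings []      x = []
  crossings (i ∷ u) x = ((eval u ∙ x) ⁻¹ʷ) · α i ∷ crossings u x

  separated⇒crossing : ∀ u {x β} → x ∈ H⁺ β → eval u ∙ x ∉ H⁺ β → Any (β ≈ᵛ_) (crossings u x)
  separated⇒crossing []      {x} x∈ ux∉ = contradiction (H⁺-congʳ (≈ʷ-sym (identityˡ x)) x∈) ux∉
  separated⇒crossing (i ∷ u) {x} {β} x∈ iux∉ with lem {eval u ∙ x ∈ H⁺ β}
  ... | yes ux∈ = here (crossing ux∈ (iux∉ ∘ H⁺-congʳ (≈ʷ-sym (assoc (s i) (eval u) x))))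
  ... | no  ux∉ = there (separated⇒crossing u x∈ ux∉)

  -- Walls along one walk from `x` to `z`. The walk need not be shortest, so roots that do not
  -- separate may occur; what matters is that a finite list contains all that do.
  separators : W → W → List V
  separators x z = crossings (word (z ∙ x ⁻¹ʷ)) x

  separated⇒separator : ∀ {x z β} → x ∈ H⁺ β → z ∉ H⁺ β → Any (β ≈ᵛ_) (separators x z)
  separated⇒separator {x} {z} x∈ z∉ = separated⇒crossing (word (z ∙ x ⁻¹ʷ)) x∈
    (z∉ ∘ H⁺-congʳ (≈ʷ-trans (∙-congʳ (eval-word _)) (//-rightDividesˡ x z)))

  -- A descent `i` of `z ∙ x ⁻¹ʷ` supplies a separating root `β = x⁻¹ α i`. Moving from `x` to
  -- `s i ∙ x` disposes of `β` and creates no new separator, so the list loses an entry with each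
  -- letter of the word.
  close : ∀ N D {x z} → length D ℕ.≤ N → (∀ {β} → β ∈ Φ → x ∈ H⁺ β → z ∉ H⁺ β → Any (β ≈ᵛ_) D) →
          ∃[ u ] length u ℕ.≤ N × z ≈ʷ eval u ∙ x
  close N D {x} {z} D≤N separated with lem {z ≈ʷ x}
  ... | yes z≈x = [] , ℕ.z≤n , ≈ʷ-trans z≈x (≈ʷ-sym (identityˡ x))
  ... | no  z≉x = step N D≤N
    where
    y = z ∙ x ⁻¹ʷ
    y≉ε : ¬ (y ≈ʷ ε)
    y≉ε y≈ε = z≉x (≈ʷ-trans (≈ʷ-sym (//-rightDividesˡ x z)) (≈ʷ-trans (∙-congʳ y≈ε) (identityˡ x)))
    i = proj₁ (descent y≉ε)
    yα∉Φ⁺ : y · α i ∉ Φ⁺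
    yα∉Φ⁺ = proj₂ (descent y≉ε)
    β = (x ⁻¹ʷ) · α i
    xβ≈α : x · β ≈ᵛ α i
    xβ≈α = ·-⁻¹-· x (α i)
    β∈D : Any (β ≈ᵛ_) D
    β∈D = separated (Φ-· (x ⁻¹ʷ) (α∈Φ i)) (Φ⁺-cong (≈ᵛ-sym xβ≈α) (α∈Φ⁺ i))
      (yα∉Φ⁺ ∘ Φ⁺-cong (≈ᵛ-sym (·-∙ z (x ⁻¹ʷ) (α i))))
    other? : ∀ γ → _
    other? γ = ¬? (lem {β ≈ᵛ γ})
    D′ = filter other? D
    D′<D : length D′ ℕ.< length D
    D′<D = Listₚ.filter-notAll other? D (Any.map (λ β≈γ ¬β≈γ → ¬β≈γ β≈γ) β∈D)
    separated′ : ∀ {γ} → γ ∈ Φ → s i ∙ x ∈ H⁺ γ → z ∉ H⁺ γ → Any (γ ≈ᵛ_) D′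
    separated′ {γ} γ∈Φ sx∈ z∉ with lem {x ∈ H⁺ γ}
    -- `γ` is not `β`, since `s i ∙ x` sends `β` to the negative vector `- α i`; so its entry
    -- survives the filter.
    ... | yes x∈ = let δ , δ∈D , γ≈δ = find (separated γ∈Φ x∈ z∉) in
      lose (∈-filter⁺ other? δ∈D λ β≈δ → -α∉Φ⁺ i (Φ⁺-cong
        (≈ᵛ-trans (·-s i x γ) (≈ᵛ-trans (reflect-cong i (≈ᵛ-trans (·-congʳ x (≈ᵛ-trans γ≈δ (≈ᵛ-sym β≈δ))) xβ≈α)) (reflect-α i)))
        sx∈)) γ≈δ
    -- Here `γ` is `- β`, which `z` sends to `- (y · α i)`. This is nonnegative because `i` is a
    -- descent of `y`.
    ... | no  x∉ = contradiction z∈ z∉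
      where
      sxγ≈α : reflect i (x · γ) ≈ᵛ α i
      sxγ≈α = reflect-leaves-Φ⁺ {i} {reflect i (x · γ)} (Φ⁺-cong (·-s i x γ) sx∈) (x∉ ∘ Φ⁺-cong (reflect-involutive i (x · γ)))
      xγ≈-α : x · γ ≈ᵛ λ j → - α i j
      xγ≈-α = ≈ᵛ-trans (≈ᵛ-sym (reflect-involutive i (x · γ))) (≈ᵛ-trans (reflect-cong i sxγ≈α) (reflect-α i))
      zγ≈ : z · γ ≈ᵛ λ j → - (y · α i) j
      zγ≈ = ≈ᵛ-trans (·-congˡ (≈ʷ-sym (//-rightDividesˡ x z)) γ)
        (≈ᵛ-trans (·-∙ y x γ) (≈ᵛ-trans (·-congʳ y xγ≈-α) (·-neg y (α i))))
      z∈ : z ∈ H⁺ γ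
      z∈ = Φ-· z γ∈Φ , λ j → ≤-trans
        (nonPos⇒neg-nonNeg (∉Φ⁺⇒NonPos (Φ-· y (α∈Φ i)) yα∉Φ⁺ j)) (≤-reflexive (sym (zγ≈ j)))
    step : ∀ N → length D ℕ.≤ N → ∃[ u ] length u ℕ.≤ N × z ≈ʷ eval u ∙ x
    step zero    D≤0   = contradiction (ℕₚ.<-≤-trans D′<D D≤0) λ ()
    step (suc N) D≤1+N =
      let u , u≤N , z≈usx = close N D′ {s i ∙ x} (ℕ.s≤s⁻¹ (ℕₚ.<-≤-trans D′<D D≤1+N)) separated′
      in u ++ i ∷ [] , ℕₚ.≤-trans (ℕₚ.≤-reflexive (length-∷ʳ u)) (ℕ.s≤s u≤N) ,
        ≈ʷ-trans z≈usx (≈ʷ-trans (≈ʷ-sym (assoc _ _ _)) (∙-congʳ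
          (≈ʷ-sym (≈ʷ-trans (eval-++ u (i ∷ [])) (∙-congˡ (identityʳ (s i)))))))

  words : ℕ → List (Word n)
  words zero    = [] ∷ []
  words (suc N) = [] ∷ cartesianProductWith _∷_ (allFin n) (words N)

  ∈-words : ∀ {N} u → length u ℕ.≤ N → u Membership.∈ words N
  ∈-words {zero}  []      _           = here ≡.refl
  ∈-words {suc N} []      _           = here ≡.refl
  ∈-words {suc N} (i ∷ u) (ℕ.s≤s u≤N) = there (∈-cartesianProductWith⁺ _∷_ (∈-allFin i) (∈-words u u≤N))

  open SetoidMembership W-setoid using () renaming (_∈_ to _∈ˡ_)

  ball : ℕ → W → List W
  ball N x = List.map (λ u → eval u ∙ x) (words N)

  -- Turns finiteness of a set of roots into finiteness in `W`: a list `D` chosen independently of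
  -- `z` confines all such `z` to one ball.
  ∈-ball : ∀ D {x z} → (∀ {β} → β ∈ Φ → x ∈ H⁺ β → z ∉ H⁺ β → Any (β ≈ᵛ_) D) → z ∈ˡ ball (length D) x
  ∈-ball D separated = let u , u≤N , z≈ux = close (length D) D ℕₚ.≤-refl separated in
    Anyₚ.map⁺ (lose (∈-words u u≤N) z≈ux)

-- Toggles, convex hulls and periodic orbits.

module Promotion (lem : ExcludedMiddle 0ℓ) (ℝ : Reals) {n} (C : CoxeterSystem n) where
  open Billiards lem ℝ C hiding (module R)
  open CoxeterSystem C using (_∙_; s; ∙-congˡ)
    renaming (Carrier to W; _≈_ to _≈ʷ_; _⁻¹ to _⁻¹ʷ; setoid to W-setoid; refl to ≈ʷ-refl; sym to ≈ʷ-sym; trans to ≈ʷ-trans; ⁻¹-cong to ⁻¹ʷ-cong)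
  open SetoidMembership W-setoid using () renaming (_∈_ to _∈ˡ_)
  open Roots lem ℝ C

  R-cong : ∀ {ℒ β γ} → β ≈ᵛ γ → β ∈ R⟨ ℒ ⟩ → γ ∈ R⟨ ℒ ⟩
  R-cong β≈γ (β∈Φ , ℒ⊆) = Φ-cong β≈γ β∈Φ , λ {w} w∈ℒ → H⁺-congˡ {w = w} β≈γ (ℒ⊆ w∈ℒ)

  wall : Fin n → W → V
  wall i u = (u ⁻¹ʷ) · α i

  wall∈Φ : ∀ i u → wall i u ∈ Φ
  wall∈Φ i u = Φ-· (u ⁻¹ʷ) (α∈Φ i)

  wall-cong : ∀ i {u v} → u ≈ʷ v → wall i u ≈ᵛ wall i v
  wall-cong i u≈v = ·-congˡ (⁻¹ʷ-cong u≈v) (α i)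

  τ-fixes : ∀ ℒ i u → wall i u ∈ R⟨ ℒ ⟩ → τ ℒ i u ≡ u
  τ-fixes ℒ i u wall∈ with lem {(u ⁻¹ʷ) · α i ∈ R⟨ ℒ ⟩}
  ... | yes _     = ≡.refl
  ... | no  wall∉ = contradiction wall∈ wall∉

  τ-moves : ∀ ℒ i u → wall i u ∉ R⟨ ℒ ⟩ → τ ℒ i u ≡ s i ∙ u
  τ-moves ℒ i u wall∉ with lem {(u ⁻¹ʷ) · α i ∈ R⟨ ℒ ⟩}
  ... | yes wall∈ = contradiction wall∈ wall∉
  ... | no  _     = ≡.refl

  ≡⇒≈ʷ : ∀ {u v} → u ≡ v → u ≈ʷ v
  ≡⇒≈ʷ ≡.refl = ≈ʷ-refl

  τ-cong : ∀ ℒ i {u v} → u ≈ʷ v → τ ℒ i u ≈ʷ τ ℒ i v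
  τ-cong ℒ i {u} {v} u≈v with toSum (lem {wall i u ∈ R⟨ ℒ ⟩})
  ... | inj₁ wall∈ = ≈ʷ-trans (≡⇒≈ʷ (τ-fixes ℒ i u wall∈))
    (≈ʷ-trans u≈v (≡⇒≈ʷ (≡.sym (τ-fixes ℒ i v (R-cong {ℒ} (wall-cong i u≈v) wall∈)))))
  ... | inj₂ wall∉ = ≈ʷ-trans (≡⇒≈ʷ (τ-moves ℒ i u wall∉))
    (≈ʷ-trans (∙-congˡ u≈v) (≡⇒≈ʷ (≡.sym (τ-moves ℒ i v (wall∉ ∘ R-cong {ℒ} (wall-cong i (≈ʷ-sym u≈v)))))))

  -- A toggle leaves H⁺ β only by crossing the wall of β, which is forbidden when β ∈ R⟨ ℒ ⟩.
  τ-preserves-H⁺ : ∀ ℒ i {u β} → β ∈ R⟨ ℒ ⟩ → u ∈ H⁺ β → τ ℒ i u ∈ H⁺ β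
  τ-preserves-H⁺ ℒ i {u} {β} β∈R u∈ with toSum (lem {wall i u ∈ R⟨ ℒ ⟩})
  ... | inj₁ wall∈ = ≡.subst (H⁺ β) (≡.sym (τ-fixes ℒ i u wall∈)) u∈
  ... | inj₂ wall∉ = ≡.subst (H⁺ β) (≡.sym (τ-moves ℒ i u wall∉))
    (decidable-stable lem λ su∉ → wall∉ (R-cong {ℒ} (crossing {β} {i} {u} u∈ su∉) β∈R))

  toggles : Pred W 0ℓ → List (Fin n) → W → W
  toggles ℒ is u = foldl (λ v i → τ ℒ i v) u is

  toggles-cong : ∀ ℒ is {u v} → u ≈ʷ v → toggles ℒ is u ≈ʷ toggles ℒ is v
  toggles-cong ℒ []       u≈v = u≈v
  toggles-cong ℒ (i ∷ is) u≈v = toggles-cong ℒ is (τ-cong ℒ i u≈v)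

  toggles-preserve-H⁺ : ∀ ℒ is {u β} → β ∈ R⟨ ℒ ⟩ → u ∈ H⁺ β → toggles ℒ is u ∈ H⁺ β
  toggles-preserve-H⁺ ℒ []       β∈R u∈ = u∈
  toggles-preserve-H⁺ ℒ (i ∷ is) β∈R u∈ = toggles-preserve-H⁺ ℒ is β∈R (τ-preserves-H⁺ ℒ i β∈R u∈)

  -- The roots that define a convex set all belong to `R⟨ ℒ ⟩`, so `ℒ` is cut out by `R⟨ ℒ ⟩`.
  convex-contains : ∀ {ℒ w} → Convex ℒ → (∀ {β} → β ∈ R⟨ ℒ ⟩ → w ∈ H⁺ β) → w ∈ ℒ
  convex-contains {w = w} (𝒜 , 𝒜⊆Φ , ℒ⇔) inside = Equivalence.from (ℒ⇔ w)
    λ {β} β∈𝒜 → inside (𝒜⊆Φ β∈𝒜 , λ {x} x∈ℒ → Equivalence.to (ℒ⇔ x) x∈ℒ β∈𝒜)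

  hull : List W → Pred W 0ℓ
  hull xs w = ∀ {β} → β ∈ Φ × All (_∈ H⁺ β) xs → w ∈ H⁺ β

  hull-convex : ∀ xs → Convex (hull xs)
  hull-convex xs = (λ β → β ∈ Φ × All (_∈ H⁺ β) xs) , proj₁ , λ w → mk⇔ id id

  hull-contains : ∀ xs → All (hull xs) xs
  hull-contains xs = All.tabulate λ x∈xs (_ , xs⊆) → All.lookup xs⊆ x∈xs

  hull-⊆ : ∀ {ℒ xs} → Convex ℒ → All ℒ xs → hull xs ⊆ ℒ
  hull-⊆ {ℒ} convex xs⊆ℒ w∈hull = convex-contains {ℒ} convex λ (β∈Φ , ℒ⊆) → w∈hull (β∈Φ , All.map ℒ⊆ xs⊆ℒ)

  ∉-All : ∀ {P : Pred W 0ℓ} xs → ¬ All P xs → Any (_∉ P) xs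
  ∉-All xs = Allₚ.¬All⇒Any¬ (λ _ → lem) xs

  -- A root that separates `x` from a point of the hull cannot have all of `x ∷ xs` on its positive
  -- side, so it separates `x` from one of these elements. This gives one finite list for the whole
  -- hull.
  hull-finite : ∀ x xs → Finite (hull (x ∷ xs))
  hull-finite x xs = ball (length D) x , λ {w} w∈hull → ∈-ball D λ {β} β∈Φ x∈ w∉ →
    Anyₚ.concatMap⁺ (separators x) (Any.map (separated⇒separator x∈)
      (∉-All (x ∷ xs) λ all∈ → w∉ (w∈hull (β∈Φ , all∈))))
    where D = concatMap (separators x) (x ∷ xs)

  -- Whether a toggle acts is decided by R⟨ ℒ ⟩, and a failure of ℒ ⊆ H⁺ β is witnessed by a single
  -- element of ℒ; so finitely many elements of ℒ determine any finite sequence of toggles.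
  SameToggles : Pred W 0ℓ → (Pred W 0ℓ → W) → Set₁
  SameToggles ℒ f = ∃[ xs ] All ℒ xs × (∀ ℒ′ → ℒ′ ⊆ ℒ → All ℒ′ xs → f ℒ′ ≡ f ℒ)

  τ-same : ∀ ℒ i u → SameToggles ℒ (λ ℒ′ → τ ℒ′ i u)
  τ-same ℒ i u with toSum (lem {wall i u ∈ R⟨ ℒ ⟩})
  -- Shrinking `ℒ` only enlarges `R⟨ ℒ ⟩`, so a toggle that fixes `u` needs no witness.
  ... | inj₁ wall∈@(wall∈Φ , ℒ⊆) = [] , [] , λ ℒ′ ℒ′⊆ℒ _ →
    ≡.trans (τ-fixes ℒ′ i u (wall∈Φ , λ {x} x∈ → ℒ⊆ (ℒ′⊆ℒ x∈))) (≡.sym (τ-fixes ℒ i u wall∈))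
  ... | inj₂ wall∉ with toSum (lem {∃[ x ] x ∈ ℒ × x ∉ H⁺ (wall i u)})
  ...   | inj₁ (x , x∈ℒ , x∉) = x ∷ [] , x∈ℒ ∷ [] , λ { ℒ′ _ (x∈ℒ′ ∷ []) →
    ≡.trans (τ-moves ℒ′ i u (λ (_ , ℒ′⊆) → x∉ (ℒ′⊆ x∈ℒ′))) (≡.sym (τ-moves ℒ i u wall∉)) }
  -- A wall is always a root, so only an element of `ℒ` can keep it out of `R⟨ ℒ ⟩`.
  ...   | inj₂ none = contradiction
    (wall∈Φ i u , λ {x} x∈ℒ → decidable-stable lem λ x∉ → none (x , x∈ℒ , x∉)) wall∉

  toggles-same : ∀ ℒ is u → SameToggles ℒ (λ ℒ′ → toggles ℒ′ is u)
  toggles-same ℒ []       u = [] , [] , λ _ _ _ → ≡.refl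
  toggles-same ℒ (i ∷ is) u =
    let xs , xs⊆ℒ , same  = τ-same ℒ i u
        ys , ys⊆ℒ , same′ = toggles-same ℒ is (τ ℒ i u)
    in xs ++ ys , Allₚ.++⁺ xs⊆ℒ ys⊆ℒ , λ ℒ′ ℒ′⊆ℒ both → ≡.trans
      (≡.cong (toggles ℒ′ is) (same ℒ′ ℒ′⊆ℒ (Allₚ.++⁻ˡ xs both))) (same′ ℒ′ ℒ′⊆ℒ (Allₚ.++⁻ʳ xs both))

  ∈ˡ-pigeonhole : ∀ {ws} (f : ℕ → W) → (∀ k → f k ∈ˡ ws) → ∃₂ λ a b → a ℕ.< b × f a ≈ʷ f b
  ∈ˡ-pigeonhole {ws} f f∈ =
    let i , j , i<j , eq = pigeonhole (ℕₚ.n<1+n (length ws)) (λ k → Any.index (f∈ (toℕ k)))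
    in toℕ i , toℕ j , i<j , ≈ʷ-trans (Anyₚ.lookup-index (f∈ (toℕ i)))
      (≈ʷ-trans (≡⇒≈ʷ (≡.cong (List.lookup ws) eq)) (≈ʷ-sym (Anyₚ.lookup-index (f∈ (toℕ j)))))

  module _ (c : CoxeterElement C) where
    indices = CoxeterElement.indices c

    Pro^-same : ∀ ℒ K u → SameToggles ℒ (λ ℒ′ → Pro^ c ℒ′ K u)
    Pro^-same ℒ zero    u = [] , [] , λ _ _ _ → ≡.refl
    Pro^-same ℒ (suc K) u =
      let xs , xs⊆ℒ , same  = Pro^-same ℒ K u
          ys , ys⊆ℒ , same′ = toggles-same ℒ indices (Pro^ c ℒ K u)
      in xs ++ ys , Allₚ.++⁺ xs⊆ℒ ys⊆ℒ , λ ℒ′ ℒ′⊆ℒ both → ≡.trans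
        (≡.cong (toggles ℒ′ indices) (same ℒ′ ℒ′⊆ℒ (Allₚ.++⁻ˡ xs both))) (same′ ℒ′ ℒ′⊆ℒ (Allₚ.++⁻ʳ xs both))

    Pro^-cong : ∀ ℒ K {u v} → u ≈ʷ v → Pro^ c ℒ K u ≈ʷ Pro^ c ℒ K v
    Pro^-cong ℒ zero    u≈v = u≈v
    Pro^-cong ℒ (suc K) u≈v = toggles-cong ℒ indices (Pro^-cong ℒ K u≈v)

    Pro^-+ : ∀ ℒ K L u → Pro^ c ℒ (K ℕ.+ L) u ≡ Pro^ c ℒ K (Pro^ c ℒ L u)
    Pro^-+ ℒ K L u = fold-+ u (Pro c ℒ) K

    Pro^-preserves-H⁺ : ∀ ℒ K {u β} → β ∈ R⟨ ℒ ⟩ → u ∈ H⁺ β → Pro^ c ℒ K u ∈ H⁺ β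
    Pro^-preserves-H⁺ ℒ zero    β∈R u∈ = u∈
    Pro^-preserves-H⁺ ℒ (suc K) β∈R u∈ = toggles-preserve-H⁺ ℒ indices β∈R (Pro^-preserves-H⁺ ℒ K β∈R u∈)

    Pro^-preserves : ∀ {ℒ} → Convex ℒ → ∀ K {u} → u ∈ ℒ → Pro^ c ℒ K u ∈ ℒ
    Pro^-preserves {ℒ} convex K u∈ℒ = convex-contains {ℒ} convex λ {β} β∈R →
      Pro^-preserves-H⁺ ℒ K β∈R (proj₂ β∈R u∈ℒ)

    Pro^-period : ∀ ℒ {K u} → Pro^ c ℒ K u ≈ʷ u → ∀ N → Pro^ c ℒ (N ℕ.* K) u ≈ʷ u
    Pro^-period ℒ         period zero    = ≈ʷ-refl
    Pro^-period ℒ {K} {u} period (suc N) = ≈ʷ-trans (≡⇒≈ʷ (Pro^-+ ℒ K (N ℕ.* K) u))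
      (≈ʷ-trans (Pro^-cong ℒ K (Pro^-period ℒ period N)) period)

    -- If the orbit is in `ℒ` at time `N`, it still is at time `N * suc K`, a multiple of the
    -- period, when it is back at `u`. The return is only up to `≈ʷ`, which half-spaces respect.
    superheavy⇒heavy : ∀ {ℒ} → Convex ℒ → Superheavy c ℒ → Heavy c ℒ
    superheavy⇒heavy {ℒ} convex superheavy u (suc K , _ , period) = convex-contains {ℒ} convex λ {β} β∈R →
      H⁺-congʳ {β} (Pro^-period ℒ {suc K} period N)
        (≡.subst (H⁺ β) (≡.trans (≡.sym (Pro^-+ ℒ (N ℕ.* suc K ℕ.∸ N) N u)) (≡.cong (λ k → Pro^ c ℒ k u) (ℕₚ.m∸n+n≡m (ℕₚ.m≤m*n N (suc K)))))
          (proj₂ β∈R (Pro^-preserves {ℒ} convex (N ℕ.* suc K ℕ.∸ N) (proj₂ (superheavy u)))))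
      where N = proj₁ (superheavy u)

    -- A separator of x ∈ ℒ from an orbit point of u either lies in R⟨ ℒ ⟩, and then it separates x
    -- from u already, or it separates x from another element of ℒ.
    orbit-finite : ∀ {ℒ x} → Finite ℒ → x ∈ ℒ → ∀ u → ∃[ ws ] (∀ K → Pro^ c ℒ K u ∈ˡ ws)
    orbit-finite {ℒ} {x} (ws , ℒ⊆ws) x∈ℒ u = ball (length D) x , λ K → ∈-ball D (separated K)
      where
      D = concatMap (separators x) (u ∷ ws)
      separated : ∀ K {β} → β ∈ Φ → x ∈ H⁺ β → Pro^ c ℒ K u ∉ H⁺ β → Any (β ≈ᵛ_) D
      separated K {β} β∈Φ x∈ v∉ = Anyₚ.concatMap⁺ (separators x) (Any.map (separated⇒separator x∈)
        (∉-All (u ∷ ws) λ { (u∈ ∷ ws⊆) → v∉ (Pro^-preserves-H⁺ ℒ K (β∈Φ , λ {y} y∈ℒ →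
          let y≈w , w∈ = All.lookupAny ws⊆ (ℒ⊆ws y∈ℒ) in H⁺-congʳ {β} (≈ʷ-sym w∈) y≈w) u∈) }))

    heavy⇒superheavy : ∀ {ℒ} → Satisfiable ℒ → Finite ℒ → Heavy c ℒ → Superheavy c ℒ
    heavy⇒superheavy {ℒ} (x , x∈ℒ) ℒ-finite heavy u =
      let ws , orbit⊆ = orbit-finite {ℒ} ℒ-finite x∈ℒ u
          a , b , a<b , eq = ∈ˡ-pigeonhole (λ k → Pro^ c ℒ k u) orbit⊆
      -- The point at time `a` recurs at time `b`, hence is periodic with period `b ∸ a`.
      in a , heavy _ (b ℕ.∸ a , ℕₚ.m<n⇒0<n∸m a<b , ≈ʷ-trans
        (≡⇒≈ʷ (≡.trans (≡.sym (Pro^-+ ℒ (b ℕ.∸ a) a u)) (≡.cong (λ k → Pro^ c ℒ k u) (ℕₚ.m∸n+n≡m (ℕₚ.<⇒≤ a<b)))))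
        (≈ʷ-sym eq))

    finitely-heavy⇒heavy : (∀ ℒ → Satisfiable ℒ → Finite ℒ → Convex ℒ → Heavy c ℒ) →
                           ∀ ℒ → Satisfiable ℒ → Convex ℒ → Heavy c ℒ
    finitely-heavy⇒heavy finitely-heavy ℒ (x , x∈ℒ) convex u (K , 1≤K , period) =
      let xs , xs⊆ℒ , same = Pro^-same ℒ K u
          -- The extra element `x` keeps the hull nonempty when `xs` is empty, and is the base point
          -- of its finiteness proof.
          ℒ′ = hull (x ∷ xs)
          ℒ′⊆ℒ = hull-⊆ {ℒ} {x ∷ xs} convex (x∈ℒ ∷ xs⊆ℒ)
          xs⊆ℒ′ = hull-contains (x ∷ xs)
      in ℒ′⊆ℒ (finitely-heavy ℒ′ (x , All.head xs⊆ℒ′) (hull-finite x xs) (hull-convex (x ∷ xs)) u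
        (K , 1≤K , ≈ʷ-trans (≡⇒≈ʷ (same ℒ′ ℒ′⊆ℒ (All.tail xs⊆ℒ′))) period))

proposition1p8 : (lem : ExcludedMiddle 0ℓ) (ℝ : Reals)
    (n : ℕ) (C : CoxeterSystem n) (c : CoxeterElement C) →
    let open Billiards lem ℝ C in
    ((∀ ℒ → Satisfiable ℒ → Convex ℒ → Heavy c ℒ)
    ⇔ (∀ ℒ → Satisfiable ℒ → Finite ℒ → Convex ℒ → Heavy c ℒ))
    × ((∀ ℒ → Satisfiable ℒ → Finite ℒ → Convex ℒ → Heavy c ℒ)
    ⇔ (∀ ℒ → Satisfiable ℒ → Finite ℒ → Convex ℒ → Superheavy c ℒ))
proposition1p8 lem ℝ n C c =
  mk⇔ (λ heavy ℒ nonempty _ convex → heavy ℒ nonempty convex) (finitely-heavy⇒heavy c) ,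
  mk⇔ (λ heavy ℒ nonempty ℒ-finite convex → heavy⇒superheavy c nonempty ℒ-finite (heavy ℒ nonempty ℒ-finite convex))
      (λ superheavy ℒ nonempty ℒ-finite convex → superheavy⇒heavy c convex (superheavy ℒ nonempty ℒ-finite convex))
  where open Promotion lem ℝ C
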